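{- For $n\ge1$, $$\sum_{\pi\in C_l\wr\mathfrak{S}_n}t^{\mathrm{fexc}(\pi)}r^{\mathrm{fix}(\pi)}q^{(\mathrm{maj}-\mathrm{exc})\pi}=\sum_{\pi\in C_l\wr\mathfrak{S}_n} t^{\mathrm{flec}(\pi)}r^{\mathrm{pix}(\pi)}q^{\mathrm{inv}(\pi)-\mathrm{lec}(\pi)}.$$
   Context: Fix $l\ge1$. $C_l\wr\mathfrak{S}_n$ is the set of words $\pi=\pi_1\cdots\pi_n$ with letters $\pi_i=|\pi_i|^{\epsilon_i}$, $\epsilon_i\in\{0,\dots,l-1\}$, such that $|\pi|=|\pi_1|\cdots|\pi_n|$ is a permutation of $[n]$. With the color order $1^{l-1}<\cdots<n^{l-1}<1^{l-2}<\cdots<n^{l-2}<\cdots<1^0<\cdots<n^0$: $\mathrm{maj}(\pi)=\sum\{j\in[n-1]:\pi_j>\pi_{j+1}\}$, $\mathrm{exc}(\pi)=|\{j:\pi_j>j^0\}|$, $\mathrm{fexc}(\pi)=l\,\mathrm{exc}(\pi)+\sum_i\epsilon_i$, $\mathrm{fix}(\pi)=|\{j:\pi_j=j^0\}|$. A word $v_1\cdots v_m$ over the positive integers is a hook if $v_1>v_2$ and either $m=2$ or $v_2<v_3<\dots<v_m$. A word $w=w_1\cdots w_m$ of colored letters $a^\epsilon$ is a colored hook if either $m\ge2$, $|w|$ is a hook, and only $w_1$ may have positive color; or $m\ge1$, $|w|$ is increasing, $w_1$ has positive color and all other letters have color $0$. Every $\pi\in C_l\wr\mathfrak{S}_n$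 has a unique factorization $\pi=p\,\tau_1\tau_2\cdots\tau_r$ (colored hook factorization) where $p$ consists of $0$-colored letters with $|p|$ increasing (possibly empty) and each $\tau_i$ is a colored hook. For a word $v$ over integers, $\mathrm{inv}(v)=|\{(i,j):i<j,v_i>v_j\}|$. Set $\mathrm{inv}(\pi)=\mathrm{inv}(|\pi|)$, $\mathrm{lec}(\pi)=\sum_{i=1}^r\mathrm{inv}(|\tau_i|)$, $\mathrm{flec}(\pi)=l\cdot\mathrm{lec}(\pi)+\sum_{i=1}^n\epsilon_i$, $\mathrm{pix}(\pi)=$ length of $p$. -}

module Defs where

open import Data.Bool using (Bool; true; false; _∧_; _∨_; not; if_then_else_)
open import Data.Nat using (ℕ; zero; suc; _+_; _*_; _<ᵇ_; _≡ᵇ_)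
import Data.Nat as ℕ
open import Data.Integer as ℤ using (ℤ; +_; _-_)
open import Data.List using (List; []; _∷_; map; concatMap; upTo; length; filter; filterᵇ; take; drop)
open import Data.Nat.ListAction using (sum)
open import Data.Product using (_×_; _,_; proj₁; proj₂)
open import Data.Product.Properties using (≡-dec)
open import Relation.Binary using (DecidableEquality)
import Data.List.Membership.DecPropositional as DecMem

-- A colored letter a^ε is the pair (a , ε), with a ∈ [n] (1-based) and ε ∈ {0..l-1}.
Letter : Set
Letter = ℕ × ℕ

∣_∣ : List Letter → List ℕ
∣ w ∣ = map proj₁ w

col : Letter → ℕ
col = proj₂

-- color order: 1^{l-1} < ... < n^{l-1} < ... < 1^0 < ... < n^0
-- (a , e) <c (b , f)  iff  f < e, or e = f and a < b
_<c_ : Letter → Letter → Bool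
(a , e) <c (b , f) = (f <ᵇ e) ∨ ((e ≡ᵇ f) ∧ (a <ᵇ b))

allᵇ : {A : Set} → (A → Bool) → List A → Bool
allᵇ p [] = true
allᵇ p (x ∷ xs) = p x ∧ allᵇ p xs

letters : ℕ → ℕ → List Letter
letters l n = concatMap (λ a → map (λ e → (a , e)) (upTo l)) (map suc (upTo n))

words : ℕ → ℕ → ℕ → List (List Letter)
words l n zero = [] ∷ []
words l n (suc k) = concatMap (λ x → map (x ∷_) (words l n k)) (letters l n)

elemᵇ : ℕ → List ℕ → Bool
elemᵇ x [] = false
elemᵇ x (y ∷ ys) = (x ≡ᵇ y) ∨ elemᵇ x ys

distinct : List ℕ → Bool
distinct [] = true
distinct (x ∷ xs) = not (elemᵇ x xs) ∧ distinct xs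

ColoredPerms : ℕ → ℕ → List (List Letter)
ColoredPerms l n = filterᵇ (λ w → distinct ∣ w ∣) (words l n n)

majAux : ℕ → List Letter → ℕ
majAux j [] = 0
majAux j (x ∷ []) = 0
majAux j (x ∷ y ∷ rest) = (if y <c x then j else 0) + majAux (suc j) (y ∷ rest)

maj : List Letter → ℕ
maj = majAux 1

excAux : ℕ → List Letter → ℕ
excAux j [] = 0
excAux j (x ∷ xs) = (if (j , 0) <c x then 1 else 0) + excAux (suc j) xs

exc : List Letter → ℕ
exc = excAux 1

fixAux : ℕ → List Letter → ℕ
fixAux j [] = 0
fixAux j (x ∷ xs) = (if (proj₁ x ≡ᵇ j) ∧ (col x ≡ᵇ 0) then 1 else 0) + fixAux (suc j) xs

fix : List Letter → ℕ
fix = fixAux 1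

colsum : List Letter → ℕ
colsum w = sum (map col w)

fexc : ℕ → List Letter → ℕ
fexc l π = l * exc π + colsum π

invN : List ℕ → ℕ
invN [] = 0
invN (x ∷ xs) = length (filterᵇ (_<ᵇ x) xs) + invN xs

inv : List Letter → ℕ
inv π = invN ∣ π ∣

incr : List ℕ → Bool
incr [] = true
incr (x ∷ []) = true
incr (x ∷ y ∷ rest) = (x <ᵇ y) ∧ incr (y ∷ rest)

isHook : List ℕ → Bool
isHook (v₁ ∷ v₂ ∷ rest) = (v₂ <ᵇ v₁) ∧ incr (v₂ ∷ rest)
isHook _ = false

color0 : Letter → Bool
color0 x = col x ≡ᵇ 0

isColoredHook : List Letter → Bool
isColoredHook [] = false
isColoredHook (x ∷ xs) =
  (isHook ∣ x ∷ xs ∣ ∧ allᵇ color0 xs)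
  ∨ (incr ∣ x ∷ xs ∣ ∧ (0 <ᵇ col x) ∧ allᵇ color0 xs)

blocks : {A : Set} → List A → List (List (List A))
blocks [] = [] ∷ []
blocks (x ∷ xs) = concatMap ext (blocks xs)
  where
  ext : _ → _
  ext [] = ((x ∷ []) ∷ []) ∷ []
  ext (b ∷ bs) = ((x ∷ []) ∷ b ∷ bs) ∷ ((x ∷ b) ∷ bs) ∷ []

candidates : List Letter → List (List Letter × List (List Letter))
candidates π =
  concatMap (λ k → map (λ τs → (take k π , τs)) (blocks (drop k π)))
            (upTo (suc (length π)))

isCHF : List Letter × List (List Letter) → Bool
isCHF (p , τs) = (allᵇ color0 p ∧ incr ∣ p ∣) ∧ allᵇ isColoredHook τs

-- the colored hook factorizations of π (a one-element list, by uniqueness)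
chfs : List Letter → List (List Letter × List (List Letter))
chfs π = filterᵇ isCHF (candidates π)

lecOf : List (List Letter) → ℕ
lecOf τs = sum (map (λ τ → invN ∣ τ ∣) τs)

-- Exponent triples (exponent of t, of r, of q)

Triple : Set
Triple = ℕ × ℕ × ℤ

_≟T_ : DecidableEquality Triple
_≟T_ = ≡-dec ℕ._≟_ (≡-dec ℕ._≟_ ℤ._≟_)

stat₁ : ℕ → List Letter → Triple
stat₁ l π = (fexc l π , fix π , (+ maj π) - (+ exc π))

-- (flec, pix, inv - lec) computed from a colored hook factorization
stat₂Of : ℕ → List Letter → List Letter × List (List Letter) → Triple
stat₂Of l π (p , τs) = (l * lecOf τs + colsum π , length p , (+ inv π) - (+ lecOf τs))

stats₂ : ℕ → List Letter → List Triple
stats₂ l π = map (stat₂Of l π) (chfs π)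

open DecMem _≟T_ public using (_∈?_)

coeffLHS : ℕ → ℕ → Triple → ℕ
coeffLHS l n s = length (filter (λ π → stat₁ l π ≟T s) (ColoredPerms l n))

coeffRHS : ℕ → ℕ → Triple → ℕ
coeffRHS l n s = length (filter (λ π → s ∈? stats₂ l π) (ColoredPerms l n))

{-# OPTIONS --safe #-}
module Submission where

-- Let T = t^l. Call a letter v of color 0 at a position p < v an excedance and recolor it by an additional
-- color l. Then fexc becomes the sum of the colors, maj - exc becomes the major index for the color order, and the
-- left-hand side is a sum over (l+1)-colored permutations. Modulo q^M, dividing it by (1 - q)...(1 - q^n) turns
-- it into a sum over pairs of a permutation and a decomposition of it into M increasing blocks. Recording for
-- each value the block that contains it, the sum over the permutations with given block sizes c becomes the
-- coefficient of x^c in a product of linear forms x_1, ..., x_M (one form for each value), up to factors for the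
-- final runs of fixed points of the blocks. These coefficients are found by walking through the blocks as in
-- MacMahon's master theorem and Foata's transformation of excedances into descents. With E(a) = ∏ (1 - a q^i z)
-- over i < M, the walk yields the generating function
--     F(z) E(1) = ((1 - t) + t F(z)) E(T),   and with the fixed points   F(z) E(1) / E(r).
-- On the right-hand side, cutting off the first hook gives a recurrence with q-binomial coefficients, in which a
-- hook of length k has the weight h_k = t + t^2 + ... + t^(lk-1) = (t - T^k) / (1 - t); its generating function is
-- the same. So for all integers t, r, q ≥ 2 the two sums agree modulo every power of q, hence are equal,
-- and the coefficients are read off as digits in a large base.

open import Defs
import Data.Integer as ℤ
import Data.Integer.Properties as ℤ
open import Data.Integer using (ℤ; 0ℤ; 1ℤ)
open import Data.Integer.Tactic.RingSolver using (solve-∀)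
open import Data.Nat as ℕ using (ℕ; zero; suc; _<_; _≤_; _<ᵇ_; _≡ᵇ_)
import Data.Nat.Properties as ℕ
import Data.Nat.DivMod as ℕ
open import Data.Nat.Tactic.RingSolver renaming (solve-∀ to solveℕ-∀)
open import Data.Bool using (Bool; true; false; if_then_else_; _∧_; _∨_; not)
import Data.Bool as Bool
import Data.Bool.Properties as Bool
open import Data.Fin as Fin using (Fin; zero; suc; toℕ)
import Data.Fin.Properties as Fin
open import Data.Vec as Vec using (Vec; []; _∷_; lookup)
open import Data.List using (List; []; _∷_; map; concatMap; concat; length; _++_; replicate; upTo; applyUpTo; allFin; take; drop; filter; filterᵇ)
import Data.List.Properties as List
open import Data.List.Relation.Unary.All as All using (All; []; _∷_)
import Data.List.Relation.Unary.All.Properties as All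
open import Data.List.Relation.Unary.Any using (here; there)
open import Data.List.Relation.Unary.AllPairs as AllPairs using (AllPairs; []; _∷_)
import Data.List.Relation.Unary.AllPairs.Properties as AllPairs
open import Data.List.Relation.Binary.Pointwise as Pointwise using (Pointwise; []; _∷_)
open import Data.List.Relation.Binary.Permutation.Propositional as Perm using (_↭_; prep; swap; ↭-refl; ↭-trans; ↭-sym)
import Data.List.Relation.Binary.Permutation.Propositional.Properties as Perm
open import Data.Maybe as Maybe using (Maybe; just; nothing)
open import Data.Product using (∃; ∃₂; _×_; _,_; proj₁; proj₂)
open import Data.Sum using (_⊎_; inj₁; inj₂)
open import Function using (_∘_; id)
open import Function.Bundles using (mk⇔)
open import Relation.Binary using (tri<; tri≈; tri>)
open import Relation.Binary.PropositionalEquality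
open import Relation.Nullary using (Dec; yes; no; does; contradiction)
open import Relation.Nullary.Decidable using (dec-true; dec-false; does-⇔)
open ≡-Reasoning

-- The variables `t`, `r`, `q` stand for integers throughout. Division by a q-factorial is replaced
-- by multiplication with `D` and a congruence modulo q^M, where the number M of blocks is also the
-- precision. Polynomial rings and limits are avoided; in return, equality has to be recovered from
-- all M at once, and the coefficients from the values at many integers. Taking t ≥ 2 also makes 1 -
-- t cancellable. The obstacle in the walk is that the linear forms belonging to one block are not
-- all equal. A recolored letter must exceed its position, so the smallest of the values that are
-- positions of a block cannot be recolored inside this block; its form lacks the summand T, whereas
-- a transfer argument wants one form per block. Since the factors of a product may be taken in any
-- order, the special form is used last, when no letter of its own block is left and the missing
-- summand is invisible, or, in the block where a walk starts, first, where it provides the uniform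
-- weight g.

private variable
  A B : Set
  M : ℕ

-- The ring operations are made opaque so that unification does not look through them.
infixl 6 _+_ _-_
infixl 7 _*_
infix 8 -_
opaque
  _+_ _*_ _-_ : ℤ → ℤ → ℤ
  _+_ = ℤ._+_
  _*_ = ℤ._*_
  _-_ = ℤ._-_

  -_ : ℤ → ℤ
  -_ = ℤ.-_

  +-comm : ∀ a b → a + b ≡ b + a
  +-comm = ℤ.+-comm

  +-assoc : ∀ a b c → a + b + c ≡ a + (b + c)
  +-assoc = ℤ.+-assoc

  +-identityˡ : ∀ a → 0ℤ + a ≡ a
  +-identityˡ = ℤ.+-identityˡ

  +-identityʳ : ∀ a → a + 0ℤ ≡ a
  +-identityʳ = ℤ.+-identityʳ

  *-comm : ∀ a b → a * b ≡ b * a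
  *-comm = ℤ.*-comm

  *-assoc : ∀ a b c → a * b * c ≡ a * (b * c)
  *-assoc = ℤ.*-assoc

  *-identityˡ : ∀ a → 1ℤ * a ≡ a
  *-identityˡ = ℤ.*-identityˡ

  *-identityʳ : ∀ a → a * 1ℤ ≡ a
  *-identityʳ = ℤ.*-identityʳ

  *-zeroˡ : ∀ a → 0ℤ * a ≡ 0ℤ
  *-zeroˡ = ℤ.*-zeroˡ

  *-zeroʳ : ∀ a → a * 0ℤ ≡ 0ℤ
  *-zeroʳ = ℤ.*-zeroʳ

  *-distribˡ-+ : ∀ a b c → a * (b + c) ≡ a * b + a * c
  *-distribˡ-+ = ℤ.*-distribˡ-+

  *-distribʳ-+ : ∀ a b c → (b + c) * a ≡ b * a + c * a
  *-distribʳ-+ = ℤ.*-distribʳ-+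

  interchange : ∀ a b c d → (a + b) + (c + d) ≡ (a + c) + (b + d)
  interchange = solve-∀

  *-interchange : ∀ a b c d → (a * b) * (c * d) ≡ (a * c) * (b * d)
  *-interchange = solve-∀

  *-exchange : ∀ a b c → a * (b * c) ≡ b * (a * c)
  *-exchange = solve-∀

infixr 9 _^_
_^_ : ℤ → ℕ → ℤ
a ^ zero = 1ℤ
a ^ suc n = a * a ^ n

^-+ : ∀ a m n → a ^ (m ℕ.+ n) ≡ a ^ m * a ^ n
^-+ a zero n = sym (*-identityˡ _)
^-+ a (suc m) n = trans (cong (a *_) (^-+ a m n)) (sym (*-assoc _ _ _))

^-* : ∀ a m n → a ^ (m ℕ.* n) ≡ (a ^ m) ^ n
^-* a m zero = cong (a ^_) (ℕ.*-zeroʳ m)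
^-* a m (suc n) = trans (cong (a ^_) (ℕ.*-suc m n)) (trans (^-+ a m (m ℕ.* n)) (cong (a ^ m *_) (^-* a m n)))

*-^ : ∀ a b n → (a * b) ^ n ≡ a ^ n * b ^ n
*-^ a b zero = sym (*-identityˡ _)
*-^ a b (suc n) = trans (cong (a * b *_) (*-^ a b n)) (*-interchange _ _ _ _)

-- Finite sums indexed by lists

⟦_⟧ : Bool → ℤ
⟦ true ⟧ = 1ℤ
⟦ false ⟧ = 0ℤ

∑ : List A → (A → ℤ) → ℤ
∑ [] f = 0ℤ
∑ (x ∷ xs) f = f x + ∑ xs f

∑-cong : (xs : List A) {f g : A → ℤ} → (∀ x → f x ≡ g x) → ∑ xs f ≡ ∑ xs g
∑-cong [] e = refl
∑-cong (x ∷ xs) e = cong₂ _+_ (e x) (∑-cong xs e)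

∑-cong-All : {P : A → Set} {xs : List A} → All P xs → {f g : A → ℤ} → (∀ {x} → P x → f x ≡ g x) → ∑ xs f ≡ ∑ xs g
∑-cong-All [] e = refl
∑-cong-All (p ∷ ps) e = cong₂ _+_ (e p) (∑-cong-All ps e)

∑-++ : (xs ys : List A) (f : A → ℤ) → ∑ (xs ++ ys) f ≡ ∑ xs f + ∑ ys f
∑-++ [] ys f = sym (+-identityˡ _)
∑-++ (x ∷ xs) ys f = trans (cong (f x +_) (∑-++ xs ys f)) (sym (+-assoc (f x) _ _))

∑-map : (h : A → B) (xs : List A) (f : B → ℤ) → ∑ (map h xs) f ≡ ∑ xs (f ∘ h)
∑-map h [] f = refl
∑-map h (x ∷ xs) f = cong (f (h x) +_) (∑-map h xs f)

∑-concatMap : (h : A → List B) (xs : List A) (f : B → ℤ) → ∑ (concatMap h xs) f ≡ ∑ xs (λ x → ∑ (h x) f)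
∑-concatMap h [] f = refl
∑-concatMap h (x ∷ xs) f = trans (∑-++ (h x) _ f) (cong (∑ (h x) f +_) (∑-concatMap h xs f))

∑-zero : (xs : List A) → ∑ xs (λ _ → 0ℤ) ≡ 0ℤ
∑-zero [] = refl
∑-zero (x ∷ xs) = trans (+-identityˡ _) (∑-zero xs)

∑-+ : (xs : List A) (f g : A → ℤ) → ∑ xs (λ x → f x + g x) ≡ ∑ xs f + ∑ xs g
∑-+ [] f g = sym (+-identityˡ 0ℤ)
∑-+ (x ∷ xs) f g = trans (cong (f x + g x +_) (∑-+ xs f g)) (interchange (f x) (g x) (∑ xs f) (∑ xs g))

∑-*ˡ : (c : ℤ) (xs : List A) (f : A → ℤ) → ∑ xs (λ x → c * f x) ≡ c * ∑ xs f
∑-*ˡ c [] f = sym (*-zeroʳ c)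
∑-*ˡ c (x ∷ xs) f = trans (cong (c * f x +_) (∑-*ˡ c xs f)) (sym (*-distribˡ-+ c (f x) _))

∑-*ʳ : (c : ℤ) (xs : List A) (f : A → ℤ) → ∑ xs (λ x → f x * c) ≡ ∑ xs f * c
∑-*ʳ c xs f = trans (∑-cong xs (λ x → *-comm (f x) c)) (trans (∑-*ˡ c xs f) (*-comm c _))

∑-swap : (xs : List A) (ys : List B) (f : A → B → ℤ) →
  ∑ xs (λ x → ∑ ys (f x)) ≡ ∑ ys (λ y → ∑ xs (λ x → f x y))
∑-swap [] ys f = sym (∑-zero ys)
∑-swap (x ∷ xs) ys f = trans (cong (∑ ys (f x) +_) (∑-swap xs ys f)) (sym (∑-+ ys (f x) _))

-- power series in one variable, as coefficient sequences
PS : Set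
PS = ℕ → ℤ

antidiag : ℕ → List (ℕ × ℕ)
antidiag zero = (0 , 0) ∷ []
antidiag (suc n) = (0 , suc n) ∷ map (λ (i , j) → (suc i , j)) (antidiag n)

∑-antidiag : ∀ n (f : ℕ × ℕ → ℤ) →
  ∑ (antidiag (suc n)) f ≡ f (0 , suc n) + ∑ (antidiag n) (λ (i , j) → f (suc i , j))
∑-antidiag n f = cong (f (0 , suc n) +_) (∑-map _ (antidiag n) f)

∑-antidiagʳ : ∀ n (f : ℕ × ℕ → ℤ) →
  ∑ (antidiag (suc n)) f ≡ ∑ (antidiag n) (λ (i , j) → f (i , suc j)) + f (suc n , 0)
∑-antidiagʳ zero f = eq (f (0 , 1)) (f (1 , 0))
  where opaque
    unfolding _+_
    eq : ∀ x y → x + (y + 0ℤ) ≡ (x + 0ℤ) + y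
    eq = solve-∀
∑-antidiagʳ (suc n) f = begin
  ∑ (antidiag (suc (suc n))) f ≡⟨ ∑-antidiag (suc n) f ⟩
  f (0 , suc (suc n)) + ∑ (antidiag (suc n)) (λ (i , j) → f (suc i , j))
    ≡⟨ cong (f (0 , suc (suc n)) +_) (∑-antidiagʳ n _) ⟩
  f (0 , suc (suc n)) + (∑ (antidiag n) (λ (i , j) → f (suc i , suc j)) + f (suc (suc n) , 0))
    ≡⟨ +-assoc (f (0 , suc (suc n))) (∑ (antidiag n) (λ (i , j) → f (suc i , suc j))) _ ⟨
  f (0 , suc (suc n)) + ∑ (antidiag n) (λ (i , j) → f (suc i , suc j)) + f (suc (suc n) , 0)
    ≡⟨ cong (_+ f (suc (suc n) , 0)) (∑-antidiag n (λ (i , j) → f (i , suc j))) ⟨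
  ∑ (antidiag (suc n)) (λ (i , j) → f (i , suc j)) + f (suc (suc n) , 0) ∎

∑-antidiag-comm : ∀ n (f : ℕ → ℕ → ℤ) →
  ∑ (antidiag n) (λ (i , j) → f i j) ≡ ∑ (antidiag n) (λ (i , j) → f j i)
∑-antidiag-comm zero f = refl
∑-antidiag-comm (suc n) f = begin
  ∑ (antidiag (suc n)) (λ (i , j) → f i j) ≡⟨ ∑-antidiag n (λ (i , j) → f i j) ⟩
  f 0 (suc n) + ∑ (antidiag n) (λ (i , j) → f (suc i) j)
    ≡⟨ cong (f 0 (suc n) +_) (∑-antidiag-comm n (λ i j → f (suc i) j)) ⟩
  f 0 (suc n) + ∑ (antidiag n) (λ (i , j) → f (suc j) i) ≡⟨ +-comm (f 0 (suc n)) _ ⟩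
  ∑ (antidiag n) (λ (i , j) → f (suc j) i) + f 0 (suc n) ≡⟨ ∑-antidiagʳ n (λ (i , j) → f j i) ⟨
  ∑ (antidiag (suc n)) (λ (i , j) → f j i) ∎

∑-antidiag-assoc : ∀ n (f : ℕ → ℕ → ℕ → ℤ) →
  ∑ (antidiag n) (λ (i , j) → ∑ (antidiag i) (λ (a , b) → f a b j))
  ≡ ∑ (antidiag n) (λ (a , i) → ∑ (antidiag i) (λ (b , j) → f a b j))
∑-antidiag-assoc zero f = refl
∑-antidiag-assoc (suc n) f = begin
  ∑ (antidiag (suc n)) (λ (i , j) → ∑ (antidiag i) (λ (a , b) → f a b j))
    ≡⟨ ∑-antidiag n (λ (i , j) → ∑ (antidiag i) (λ (a , b) → f a b j)) ⟩
  (f 0 0 (suc n) + 0ℤ) + ∑ (antidiag n) (λ (i , j) → ∑ (antidiag (suc i)) (λ (a , b) → f a b j))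
    ≡⟨ cong₂ _+_ (+-identityʳ (f 0 0 (suc n))) (∑-cong (antidiag n) (λ (i , j) → ∑-antidiag i (λ (a , b)
        → f a b j))) ⟩
  f 0 0 (suc n) + ∑ (antidiag n) (λ (i , j) → f 0 (suc i) j + ∑ (antidiag i) (λ (a , b) → f (suc a) b j))
    ≡⟨ cong (f 0 0 (suc n) +_) (∑-+ (antidiag n) _ _) ⟩
  f 0 0 (suc n) + (∑ (antidiag n) (λ (i , j) → f 0 (suc i) j) + ∑ (antidiag n) (λ (i , j) → ∑ (antidiag i) (λ (a , b)
      → f (suc a) b j)))
    ≡⟨ cong (λ z → f 0 0 (suc n) + (∑ (antidiag n) (λ (i , j) → f 0 (suc i) j) + z)) (∑-antidiag-assoc n (λ a → f
        (suc a))) ⟩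
  f 0 0 (suc n) + (∑ (antidiag n) (λ (i , j) → f 0 (suc i) j) + ∑ (antidiag n) (λ (a , i) → ∑ (antidiag i) (λ (b , j)
      → f (suc a) b j)))
    ≡⟨ +-assoc (f 0 0 (suc n)) (∑ (antidiag n) (λ (i , j) → f 0 (suc i) j)) _ ⟨
  (f 0 0 (suc n) + ∑ (antidiag n) (λ (i , j) → f 0 (suc i) j)) + ∑ (antidiag n) (λ (a , i) → ∑ (antidiag i) (λ (b , j)
      → f (suc a) b j))
    ≡⟨ cong (_+ ∑ (antidiag n) (λ (a , i) → ∑ (antidiag i) (λ (b , j) → f (suc a) b j))) (∑-antidiag n (λ (b , j)
        → f 0 b j)) ⟨
  ∑ (antidiag (suc n)) (λ (b , j) → f 0 b j) + ∑ (antidiag n) (λ (a , i) → ∑ (antidiag i) (λ (b , j) → f (suc a) b j))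
    ≡⟨ ∑-antidiag n (λ (a , i) → ∑ (antidiag i) (λ (b , j) → f a b j)) ⟨
  ∑ (antidiag (suc n)) (λ (a , i) → ∑ (antidiag i) (λ (b , j) → f a b j)) ∎

antidiag-sum : ∀ n → All (λ (i , j) → i ℕ.+ j ≡ n) (antidiag n)
antidiag-sum zero = refl ∷ []
antidiag-sum (suc n) = refl ∷ All.map⁺ (All.map (cong suc) (antidiag-sum n))

infixl 7 _⊛_
_⊛_ : PS → PS → PS
(f ⊛ g) n = ∑ (antidiag n) (λ (i , j) → f i * g j)

one : PS
one zero = 1ℤ
one (suc n) = 0ℤ

⊛-cong : {f f′ g g′ : PS} → f ≗ f′ → g ≗ g′ → f ⊛ g ≗ f′ ⊛ g′
⊛-cong e e′ n = ∑-cong (antidiag n) (λ (i , j) → cong₂ _*_ (e i) (e′ j))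

⊛-comm : (f g : PS) → f ⊛ g ≗ g ⊛ f
⊛-comm f g n = trans (∑-antidiag-comm n (λ i j → f i * g j)) (∑-cong (antidiag n) (λ (i , j) → *-comm (f j) (g i)))

⊛-assoc : (f g h : PS) → (f ⊛ g) ⊛ h ≗ f ⊛ (g ⊛ h)
⊛-assoc f g h n = begin
  ∑ (antidiag n) (λ (i , j) → ∑ (antidiag i) (λ (a , b) → f a * g b) * h j)
    ≡⟨ ∑-cong (antidiag n) (λ (i , j) → sym (∑-*ʳ (h j) (antidiag i) _)) ⟩
  ∑ (antidiag n) (λ (i , j) → ∑ (antidiag i) (λ (a , b) → f a * g b * h j))
    ≡⟨ ∑-antidiag-assoc n (λ a b j → f a * g b * h j) ⟩
  ∑ (antidiag n) (λ (a , i) → ∑ (antidiag i) (λ (b , j) → f a * g b * h j))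
    ≡⟨ ∑-cong (antidiag n) (λ (a , i) → trans (∑-cong (antidiag i) (λ (b , j) → *-assoc (f a) (g b) (h j))) (∑-*ˡ
        (f a) (antidiag i) _)) ⟩
  (f ⊛ (g ⊛ h)) n ∎

⊛-identityˡ : (f : PS) → one ⊛ f ≗ f
⊛-identityˡ f zero = trans (+-identityʳ _) (*-identityˡ (f 0))
⊛-identityˡ f (suc n) = begin
  (one ⊛ f) (suc n) ≡⟨ ∑-antidiag n (λ (i , j) → one i * f j) ⟩
  1ℤ * f (suc n) + ∑ (antidiag n) (λ (i , j) → 0ℤ * f j)
    ≡⟨ cong₂ _+_ (*-identityˡ (f (suc n))) (trans (∑-cong (antidiag n) (λ (i , j) → *-zeroˡ (f j))) (∑-zero
        (antidiag n))) ⟩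
  f (suc n) + 0ℤ ≡⟨ +-identityʳ _ ⟩
  f (suc n) ∎

⊛-identityʳ : (f : PS) → f ⊛ one ≗ f
⊛-identityʳ f n = trans (⊛-comm f one n) (⊛-identityˡ f n)

⊛-scaleˡ : (c : ℤ) (f g : PS) → (λ n → c * f n) ⊛ g ≗ (λ n → c * (f ⊛ g) n)
⊛-scaleˡ c f g n = trans (∑-cong (antidiag n) (λ (i , j) → *-assoc c (f i) (g j))) (∑-*ˡ c (antidiag n) _)

⊛-distribʳ : (f g h : PS) → (λ n → f n + g n) ⊛ h ≗ (λ n → (f ⊛ h) n + (g ⊛ h) n)
⊛-distribʳ f g h n = trans (∑-cong (antidiag n) (λ (i , j) → *-distribʳ-+ (h j) (f i) (g i))) (∑-+ (antidiag n) _ _)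

-- lin a f = (1 - a z) f
lin : ℤ → PS → PS
lin a f zero = f zero
lin a f (suc n) = f (suc n) - a * f n

lin-cong : ∀ a {f g : PS} → f ≗ g → lin a f ≗ lin a g
lin-cong a e zero = e zero
lin-cong a e (suc n) = cong₂ (λ x y → x - a * y) (e (suc n)) (e n)

lin-comm : ∀ a b (f : PS) → lin a (lin b f) ≗ lin b (lin a f)
lin-comm a b f zero = refl
lin-comm a b f (suc zero) = eq (f 1) (f 0) a b
  where opaque
    unfolding _+_
    eq : ∀ x y a b → (x - b * y) - a * y ≡ (x - a * y) - b * y
    eq = solve-∀
lin-comm a b f (suc (suc n)) = eq (f (suc (suc n))) (f (suc n)) (f n) a b
  where opaque
    unfolding _+_
    eq : ∀ x y z a b → (x - b * y) - a * (y - b * z) ≡ (x - a * y) - b * (y - a * z)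
    eq = solve-∀

lin-⊛ : ∀ a (f g : PS) → lin a f ⊛ g ≗ lin a (f ⊛ g)
lin-⊛ a f g zero = refl
lin-⊛ a f g (suc n) = begin
  (lin a f ⊛ g) (suc n) ≡⟨ ∑-antidiag n (λ (i , j) → lin a f i * g j) ⟩
  f 0 * g (suc n) + ∑ (antidiag n) (λ (i , j) → (f (suc i) - a * f i) * g j)
    ≡⟨ cong (f 0 * g (suc n) +_) (trans (∑-cong (antidiag n) (λ (i , j) → eq₁ (f (suc i)) a (f i) (g j))) (trans (∑-+
        (antidiag n) (λ (i , j) → f (suc i) * g j) (λ (i , j) → (- a) * (f i * g j))) (cong (∑ (antidiag n) (λ (i , j)
        → f (suc i) * g j) +_) (∑-*ˡ (- a) (antidiag n) (λ (i , j) → f i * g j))))) ⟩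
  f 0 * g (suc n) + (∑ (antidiag n) (λ (i , j) → f (suc i) * g j) + (- a) * (f ⊛ g) n)
    ≡⟨ eq₂ (f 0 * g (suc n)) _ a ((f ⊛ g) n) ⟩
  (f 0 * g (suc n) + ∑ (antidiag n) (λ (i , j) → f (suc i) * g j)) - a * (f ⊛ g) n
    ≡⟨ cong (_- a * (f ⊛ g) n) (∑-antidiag n (λ (i , j) → f i * g j)) ⟨
  (f ⊛ g) (suc n) - a * (f ⊛ g) n ∎
  where opaque
    unfolding _+_
    eq₁ : ∀ x a y z → (x - a * y) * z ≡ x * z + (- a) * (y * z)
    eq₁ = solve-∀
    eq₂ : ∀ x y a z → x + (y + (- a) * z) ≡ (x + y) - a * z
    eq₂ = solve-∀

lin-⊛ʳ : ∀ a (f g : PS) → f ⊛ lin a g ≗ lin a (f ⊛ g)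
lin-⊛ʳ a f g n = begin
  (f ⊛ lin a g) n ≡⟨ ⊛-comm f (lin a g) n ⟩
  (lin a g ⊛ f) n ≡⟨ lin-⊛ a g f n ⟩
  lin a (g ⊛ f) n ≡⟨ lin-cong a (⊛-comm g f) n ⟩
  lin a (f ⊛ g) n ∎

-- Cuts, splits and the major index

cuts : List A → List (List A × List A)
cuts [] = ([] , []) ∷ []
cuts (x ∷ w) = ([] , x ∷ w) ∷ map (λ (u , v) → (x ∷ u , v)) (cuts w)

∑-cuts : ∀ x (w : List A) (f : List A × List A → ℤ) →
  ∑ (cuts (x ∷ w)) f ≡ f ([] , x ∷ w) + ∑ (cuts w) (λ (u , v) → f (x ∷ u , v))
∑-cuts x w f = cong (f ([] , x ∷ w) +_) (∑-map _ (cuts w) f)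

cuts-++ : (w : List A) → All (λ (u , v) → u ++ v ≡ w) (cuts w)
cuts-++ [] = refl ∷ []
cuts-++ (x ∷ w) = refl ∷ All.map⁺ (All.map (cong (x ∷_)) (cuts-++ w))

∑-cuts-assoc : (w : List A) (f : List A → List A → List A → ℤ) →
  ∑ (cuts w) (λ (r , c) → ∑ (cuts r) (λ (a , b) → f a b c))
  ≡ ∑ (cuts w) (λ (a , r) → ∑ (cuts r) (λ (b , c) → f a b c))
∑-cuts-assoc [] f = refl
∑-cuts-assoc (x ∷ w) f = begin
  ∑ (cuts (x ∷ w)) (λ (r , c) → ∑ (cuts r) (λ (a , b) → f a b c))
    ≡⟨ ∑-cuts x w (λ (r , c) → ∑ (cuts r) (λ (a , b) → f a b c)) ⟩
  (f [] [] (x ∷ w) + 0ℤ) + ∑ (cuts w) (λ (r , c) → ∑ (cuts (x ∷ r)) (λ (a , b) → f a b c))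
    ≡⟨ cong₂ _+_ (+-identityʳ _) (trans (∑-cong (cuts w) (λ (r , c) → ∑-cuts x r (λ (a , b) → f a b c))) (∑-+
        (cuts w) _ _)) ⟩
  f [] [] (x ∷ w) + (∑ (cuts w) (λ (r , c) → f [] (x ∷ r) c) + ∑ (cuts w) (λ (r , c) → ∑ (cuts r) (λ (a , b) → f
      (x ∷ a) b c)))
    ≡⟨ cong (λ z → f [] [] (x ∷ w) + (∑ (cuts w) (λ (r , c) → f [] (x ∷ r) c) + z)) (∑-cuts-assoc w (λ a → f
        (x ∷ a))) ⟩
  f [] [] (x ∷ w) + (∑ (cuts w) (λ (r , c) → f [] (x ∷ r) c) + ∑ (cuts w) (λ (a , r) → ∑ (cuts r) (λ (b , c) → f
      (x ∷ a) b c)))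
    ≡⟨ +-assoc _ _ _ ⟨
  (f [] [] (x ∷ w) + ∑ (cuts w) (λ (r , c) → f [] (x ∷ r) c)) + ∑ (cuts w) (λ (a , r) → ∑ (cuts r) (λ (b , c) → f
      (x ∷ a) b c))
    ≡⟨ cong₂ _+_ (∑-cuts x w (λ (b , c) → f [] b c)) refl ⟨
  ∑ (cuts (x ∷ w)) (λ (b , c) → f [] b c) + ∑ (cuts w) (λ (a , r) → ∑ (cuts r) (λ (b , c) → f (x ∷ a) b c))
    ≡⟨ ∑-cuts x w (λ (a , r) → ∑ (cuts r) (λ (b , c) → f a b c)) ⟨
  ∑ (cuts (x ∷ w)) (λ (a , r) → ∑ (cuts r) (λ (b , c) → f a b c)) ∎

splits : List A → List (List A × List A)
splits [] = ([] , []) ∷ []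
splits (x ∷ R) = map (λ (u , v) → (x ∷ u , v)) (splits R) ++ map (λ (u , v) → (u , x ∷ v)) (splits R)

∑-splits : ∀ x (R : List A) (f : List A × List A → ℤ) →
  ∑ (splits (x ∷ R)) f ≡ ∑ (splits R) (λ (u , v) → f (x ∷ u , v)) + ∑ (splits R) (λ (u , v) → f (u , x ∷ v))
∑-splits x R f = trans (∑-++ (map _ (splits R)) _ f) (cong₂ _+_ (∑-map _ (splits R) f) (∑-map _ (splits R) f))

splits-length : (R : List A) → All (λ (u , v) → length u ℕ.+ length v ≡ length R) (splits R)
splits-length [] = refl ∷ []
splits-length (x ∷ R) = All.++⁺ (All.map⁺ (All.map (cong suc) (splits-length R)))
  (All.map⁺ (All.map (λ {(u , v)} e → trans (ℕ.+-suc (length u) (length v)) (cong suc e)) (splits-length R)))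

splits-All : {P : A → Set} {R : List A} → All P R → All (λ (u , v) → All P u × All P v) (splits R)
splits-All [] = ([] , []) ∷ []
splits-All (p ∷ ps) = All.++⁺ (All.map⁺ (All.map (λ (a , b) → (p ∷ a , b)) (splits-All ps)))
  (All.map⁺ (All.map (λ (a , b) → (a , p ∷ b)) (splits-All ps)))

Sorted : List ℕ → Set
Sorted = AllPairs _<_

splits-sorted : {R : List ℕ} → Sorted R → All (λ (u , v) → Sorted u × Sorted v) (splits R)
splits-sorted [] = ([] , []) ∷ []
splits-sorted (p ∷ ps) =
  All.++⁺ (All.map⁺ (All.map (λ ((a , _) , (b , c)) → (a ∷ b , c)) (All.zip (splits-All p , splits-sorted ps))))
  (All.map⁺ (All.map (λ ((_ , a) , (b , c)) → (b , a ∷ c)) (All.zip (splits-All p , splits-sorted ps))))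

-- The inversions between the two parts of a concatenation, that is, those lying in neither part
-- (see `invN-++`). Over the splits of a sorted list into parts of fixed sizes, `q ^ cross` sums to
-- a Gaussian binomial coefficient.
cross : List ℕ → List ℕ → ℕ
cross [] v = 0
cross (b ∷ u) v = length (filterᵇ (_<ᵇ b) v) ℕ.+ cross u v

<ᵇ-true : ∀ {m n} → m < n → (m <ᵇ n) ≡ true
<ᵇ-true {m} {n} p with m <ᵇ n | ℕ.<⇒<ᵇ p
... | true | _ = refl

<ᵇ-false : ∀ {m n} → n ℕ.≤ m → (m <ᵇ n) ≡ false
<ᵇ-false {m} {n} p with m <ᵇ n in e
... | false = refl
... | true = contradiction p (ℕ.<⇒≱ (ℕ.<ᵇ⇒< m n (subst Bool.T (sym e) _)))

<ᵇ⇒< : ∀ {m n} → (m <ᵇ n) ≡ true → m < n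
<ᵇ⇒< {m} {n} e = ℕ.<ᵇ⇒< m n (subst Bool.T (sym e) _)

<ᵇ⇒≥ : ∀ {m n} → (m <ᵇ n) ≡ false → n ≤ m
<ᵇ⇒≥ {m} {n} e with m ℕ.<? n
... | no p = ℕ.≮⇒≥ p
... | yes p with () ← trans (sym e) (<ᵇ-true p)

≡ᵇ-refl : ∀ x → (x ≡ᵇ x) ≡ true
≡ᵇ-refl zero = refl
≡ᵇ-refl (suc x) = ≡ᵇ-refl x

≡ᵇ-false : ∀ {x y} → x ≢ y → (x ≡ᵇ y) ≡ false
≡ᵇ-false {x} {y} ne with x ≡ᵇ y in e
... | false = refl
... | true = contradiction (ℕ.≡ᵇ⇒≡ x y (subst Bool.T (sym e) _)) ne

≡ᵇ-true : ∀ {x y} → (x ≡ᵇ y) ≡ true → x ≡ y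
≡ᵇ-true {x} {y} e = ℕ.≡ᵇ⇒≡ x y (subst Bool.T (sym e) _)

filterᵇ-<-none : ∀ {x} {v : List ℕ} → All (x <_) v → length (filterᵇ (_<ᵇ x) v) ≡ 0
filterᵇ-<-none [] = refl
filterᵇ-<-none (p ∷ ps) rewrite <ᵇ-false (ℕ.<⇒≤ p) = filterᵇ-<-none ps

cross-∷ˡ : ∀ {x} u {v} → All (x <_) v → cross (x ∷ u) v ≡ cross u v
cross-∷ˡ u p = cong (ℕ._+ cross u _) (filterᵇ-<-none p)

cross-∷ʳ : ∀ {x u} v → All (x <_) u → cross u (x ∷ v) ≡ length u ℕ.+ cross u v
cross-∷ʳ v [] = refl
cross-∷ʳ {x} {b ∷ u} v (p ∷ ps) rewrite <ᵇ-true p | cross-∷ʳ v ps =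
  cong suc (begin
    l ℕ.+ (length u ℕ.+ cross u v) ≡⟨ ℕ.+-assoc l _ _ ⟨
    l ℕ.+ length u ℕ.+ cross u v ≡⟨ cong (ℕ._+ cross u v) (ℕ.+-comm l _) ⟩
    length u ℕ.+ l ℕ.+ cross u v ≡⟨ ℕ.+-assoc (length u) _ _ ⟩
    length u ℕ.+ (l ℕ.+ cross u v) ∎)
  where l = length (filterᵇ (_<ᵇ b) v)

sorted? : (A → A → Bool) → List A → Bool
sorted? lt [] = true
sorted? lt (x ∷ []) = true
sorted? lt (x ∷ y ∷ w) = lt x y ∧ sorted? lt (y ∷ w)

-- A pair counts as a descent when `lt` fails. For distinct values and a total order this is the
-- usual major index, with the first position numbered `j`.
majFrom : (A → A → Bool) → ℕ → List A → ℕ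
majFrom lt j [] = 0
majFrom lt j (x ∷ []) = 0
majFrom lt j (x ∷ y ∷ w) = (if lt x y then 0 else j) ℕ.+ majFrom lt (suc j) (y ∷ w)

null? : List A → Bool
null? [] = true
null? (x ∷ w) = false

-- q-factorials, congruences modulo q^M, and the major index

module _ (q : ℤ) where

  -- The product of 1 - q^m over i < m ≤ i + j. The shifted product is the factor by which `D` grows
  -- when a block of length j is appended to a word of length i.
  Dr : ℕ → ℕ → ℤ
  Dr i zero = 1ℤ
  Dr i (suc j) = (1ℤ - q ^ suc i) * Dr (suc i) j

  D : ℕ → ℤ
  D = Dr 0

  Dr-split : ∀ i j k → Dr i (j ℕ.+ k) ≡ Dr i j * Dr (i ℕ.+ j) k
  Dr-split i zero k = trans (cong (λ z → Dr z k) (sym (ℕ.+-identityʳ i))) (sym (*-identityˡ _))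
  Dr-split i (suc j) k = begin
    (1ℤ - q ^ suc i) * Dr (suc i) (j ℕ.+ k) ≡⟨ cong₂ _*_ refl (Dr-split (suc i) j k) ⟩
    (1ℤ - q ^ suc i) * (Dr (suc i) j * Dr (suc i ℕ.+ j) k) ≡⟨ *-assoc _ _ _ ⟨
    (1ℤ - q ^ suc i) * Dr (suc i) j * Dr (suc i ℕ.+ j) k ≡⟨ cong (λ z → Dr i (suc j) * Dr z k) (sym (ℕ.+-suc i j)) ⟩
    Dr i (suc j) * Dr (i ℕ.+ suc j) k ∎

  D-suc : ∀ n → D (suc n) ≡ D n * (1ℤ - q ^ suc n)
  D-suc n = begin
    D (suc n) ≡⟨ cong D (ℕ.+-comm n 1) ⟨
    D (n ℕ.+ 1) ≡⟨ Dr-split 0 n 1 ⟩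
    D n * ((1ℤ - q ^ suc n) * 1ℤ) ≡⟨ cong (D n *_) (*-identityʳ _) ⟩
    D n * (1ℤ - q ^ suc n) ∎

  infix 4 _≈[_]_
  -- With the quotient as explicit data, matching on the equation substitutes `x`, and each
  -- compatibility lemma becomes one polynomial identity.
  record _≈[_]_ (x : ℤ) (M : ℕ) (y : ℤ) : Set where
    constructor _,_
    field
      quotient : ℤ
      equation : x ≡ y + q ^ M * quotient

  ≡⇒≈ : ∀ {M x y} → x ≡ y → x ≈[ M ] y
  ≡⇒≈ {M} {x} {y} refl = 0ℤ , sym (trans (cong (x +_) (*-zeroʳ _)) (+-identityʳ x))

  ≈-trans : ∀ {M x y z} → x ≈[ M ] y → y ≈[ M ] z → x ≈[ M ] z
  ≈-trans {M} {z = z} (a , refl) (b , refl) = b + a , eq z (q ^ M) b a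
    where opaque
      unfolding _+_
      eq : ∀ z Q b a → z + Q * b + Q * a ≡ z + Q * (b + a)
      eq = solve-∀

  ≈-sym : ∀ {M x y} → x ≈[ M ] y → y ≈[ M ] x
  ≈-sym {M} {y = y} (a , refl) = - a , eq y (q ^ M) a
    where opaque
      unfolding _+_
      eq : ∀ z Q a → z ≡ z + Q * a + Q * (- a)
      eq = solve-∀

  ≈-+ : ∀ {M x x′ y y′} → x ≈[ M ] x′ → y ≈[ M ] y′ → x + y ≈[ M ] x′ + y′
  ≈-+ {M} {x′ = x} {y′ = y} (a , refl) (b , refl) = a + b , eq x y (q ^ M) a b
    where opaque
      unfolding _+_
      eq : ∀ x y Q a b → (x + Q * a) + (y + Q * b) ≡ x + y + Q * (a + b)
      eq = solve-∀

  ≈-* : ∀ {M x x′ y y′} → x ≈[ M ] x′ → y ≈[ M ] y′ → x * y ≈[ M ] x′ * y′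
  ≈-* {M} {x′ = x} {y′ = y} (a , refl) (b , refl) = x * b + a * y + a * q ^ M * b , eq x y (q ^ M) a b
    where opaque
      unfolding _+_
      eq : ∀ x y Q a b → (x + Q * a) * (y + Q * b) ≡ x * y + Q * (x * b + a * y + a * Q * b)
      eq = solve-∀

  ≈-*ˡ : ∀ {M} c {x y} → x ≈[ M ] y → c * x ≈[ M ] c * y
  ≈-*ˡ c p = ≈-* (≡⇒≈ refl) p

  ≈-∑ : ∀ {M} {P : A → Set} {xs : List A} → All P xs → {f g : A → ℤ} →
    (∀ {x} → P x → f x ≈[ M ] g x) → ∑ xs f ≈[ M ] ∑ xs g
  ≈-∑ [] e = ≡⇒≈ refl
  ≈-∑ (p ∷ ps) e = ≈-+ (e p) (≈-∑ ps e)

  -- A positive power of q gains one step of precision. This is what each further block, or each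
  -- further variable, contributes to the inductions on M.
  ≈-q^suc : ∀ {M} k {x y} → x ≈[ M ] y → q ^ suc k * x ≈[ suc M ] q ^ suc k * y
  ≈-q^suc {M} k {y = y} (a , refl) = q ^ k * a , eq q (q ^ k) (q ^ M) y a
    where opaque
      unfolding _+_
      eq : ∀ q K Q y a → q * K * (y + Q * a) ≡ q * K * y + q * Q * (K * a)
      eq = solve-∀

  -- Decompositions of w into M increasing, possibly empty, blocks; each of the M-1 cuts has the weight q^position.
  Q : (A → A → Bool) → ℕ → List A → ℤ
  Q lt zero w = ⟦ null? w ⟧
  Q lt (suc M) w = ∑ (cuts w) (λ (u , v) → q ^ length u * (Q lt M u * ⟦ sorted? lt v ⟧))

  Q-[] : ∀ (lt : A → A → Bool) M → Q lt M [] ≡ 1ℤ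
  Q-[] lt zero = refl
  Q-[] lt (suc M) rewrite Q-[] lt M = trans (+-identityʳ _) (trans (*-identityˡ _) (*-identityʳ _))

  private
    -- For i = 0 the subtracted term is that of the cut in front of `x`. In the induction, the term
    -- of the first cut and the correction for the rest merge into the longer product `(1 - Q) * d`
    -- at an ascent; at a descent the additional factor `q ^ suc i` makes them cancel.
    tail-sum : ∀ (lt : A → A → Bool) i x (v : List A) →
      ∑ (cuts v) (λ (a , b) → ⟦ sorted? lt b ⟧ * (q ^ (suc i ℕ.+ length a) * Dr (suc i ℕ.+ length a) (length b))
          * q ^ majFrom lt (suc i) (x ∷ a))
      ≡ q ^ majFrom lt (suc i) (x ∷ v) - ⟦ sorted? lt (x ∷ v) ⟧ * Dr i (suc (length v))
    tail-sum lt i x [] rewrite ℕ.+-identityʳ i = eq (q ^ suc i)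
      where opaque
        unfolding _+_
        eq : ∀ Q → 1ℤ * (Q * 1ℤ) * 1ℤ + 0ℤ ≡ 1ℤ - 1ℤ * ((1ℤ - Q) * 1ℤ)
        eq = solve-∀
    tail-sum {A} lt i x (y ∷ v) = begin
      ∑ (cuts (y ∷ v)) F ≡⟨ ∑-cuts y v F ⟩
      F ([] , y ∷ v) + ∑ (cuts v) (λ (a , b) → F (y ∷ a , b))
        ≡⟨ cong (F ([] , y ∷ v) +_) (∑-cong (cuts v) (λ (a , b) → shift a b)) ⟩
      F ([] , y ∷ v) + ∑ (cuts v) (λ (a , b) → q ^ c * (⟦ sorted? lt b ⟧ * (q ^ (suc (suc i) ℕ.+ length a) * Dr (suc
          (suc i) ℕ.+ length a) (length b)) * q ^ majFrom lt (suc (suc i)) (y ∷ a)))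
        ≡⟨ cong (F ([] , y ∷ v) +_) (trans (∑-*ˡ (q ^ c) (cuts v) _) (cong (q ^ c *_) (tail-sum lt (suc i) y v))) ⟩
      F ([] , y ∷ v) + q ^ c * (q ^ majFrom lt (suc (suc i)) (y ∷ v) - ⟦ sorted? lt (y ∷ v) ⟧ * Dr (suc i) (suc
          (length v)))
        ≡⟨ final ⟩
      q ^ majFrom lt (suc i) (x ∷ y ∷ v) - ⟦ sorted? lt (x ∷ y ∷ v) ⟧ * Dr i (suc (suc (length v))) ∎
      where
      c = if lt x y then 0 else suc i
      F : List A × List A → ℤ
      F = λ (a , b) → ⟦ sorted? lt b ⟧ * (q ^ (suc i ℕ.+ length a) * Dr (suc i ℕ.+ length a) (length b))
          * q ^ majFrom lt (suc i) (x ∷ a)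
      opaque
        unfolding _+_
        eq₀ : ∀ a C m → a * (C * m) ≡ C * (a * m)
        eq₀ = solve-∀
        eq₁ : ∀ s Q d m → s * (Q * d) * 1ℤ + 1ℤ * (m - s * d) ≡ m - s * ((1ℤ - Q) * d)
        eq₁ = solve-∀
        eq₂ : ∀ s Q d m e → s * (Q * d) * 1ℤ + Q * (m - s * d) ≡ Q * m - 0ℤ * e
        eq₂ = solve-∀
      shift : ∀ a b → F (y ∷ a , b) ≡ q ^ c * (⟦ sorted? lt b ⟧ * (q ^ (suc (suc i) ℕ.+ length a) * Dr (suc
          (suc i) ℕ.+ length a) (length b)) * q ^ majFrom lt (suc (suc i)) (y ∷ a))
      shift a b rewrite ℕ.+-suc i (length a) | ^-+ q c (majFrom lt (suc (suc i)) (y ∷ a)) = eq₀ _ _ _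
      final : F ([] , y ∷ v) + q ^ c * (q ^ majFrom lt (suc (suc i)) (y ∷ v) - ⟦ sorted? lt (y ∷ v) ⟧ * Dr (suc i)
          (suc (length v)))
        ≡ q ^ majFrom lt (suc i) (x ∷ y ∷ v) - ⟦ sorted? lt (x ∷ y ∷ v) ⟧ * Dr i (suc (suc (length v)))
      final rewrite ℕ.+-identityʳ i with lt x y
      ... | true = eq₁ ⟦ sorted? lt (y ∷ v) ⟧ (q ^ suc i) (Dr (suc i) (suc (length v))) (q ^ majFrom lt (suc (suc i))
          (y ∷ v))
      ... | false rewrite ^-+ q i (majFrom lt (suc (suc i)) (y ∷ v)) = trans (eq₂ ⟦ sorted? lt (y ∷ v) ⟧ (q ^ suc i)
          (Dr (suc i) (suc (length v))) (q ^ majFrom lt (suc (suc i)) (y ∷ v)) (Dr i (suc (suc (length v))))) (cong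
          (_- 0ℤ * Dr i (suc (suc (length v)))) (*-assoc _ _ _))

    cut-sum : ∀ (lt : A → A → Bool) (w : List A) →
      ∑ (cuts w) (λ (a , b) → ⟦ sorted? lt b ⟧ * (q ^ length a * Dr (length a) (length b)) * q ^ majFrom lt 1 a)
      ≡ q ^ majFrom lt 1 w
    cut-sum lt [] = eq
      where opaque
        unfolding _+_
        eq : 1ℤ * (1ℤ * 1ℤ) * 1ℤ + 0ℤ ≡ 1ℤ
        eq = refl
    cut-sum {A} lt (x ∷ w) = begin
      ∑ (cuts (x ∷ w)) F ≡⟨ ∑-cuts x w F ⟩
      F ([] , x ∷ w) + ∑ (cuts w) (λ (a , b) → F (x ∷ a , b)) ≡⟨ cong (F ([] , x ∷ w) +_) (tail-sum lt 0 x w) ⟩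
      F ([] , x ∷ w) + (q ^ majFrom lt 1 (x ∷ w) - ⟦ sorted? lt (x ∷ w) ⟧ * D (suc (length w)))
        ≡⟨ eq ⟦ sorted? lt (x ∷ w) ⟧ (D (suc (length w))) (q ^ majFrom lt 1 (x ∷ w)) ⟩
      q ^ majFrom lt 1 (x ∷ w) ∎
      where
      F : List A × List A → ℤ
      F = λ (a , b) → ⟦ sorted? lt b ⟧ * (q ^ length a * Dr (length a) (length b)) * q ^ majFrom lt 1 a
      opaque
        unfolding _+_
        eq : ∀ s d m → s * (1ℤ * d) * 1ℤ + (m - s * d) ≡ m
        eq = solve-∀

  -- The familiar fact that q^maj divided by the q-factorial counts the decompositions of a word
  -- into increasing blocks by their cut positions, truncated to M blocks. Splitting off the last
  -- block reduces it to `cut-sum`: a nonempty front part carries a positive power of q, which lifts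
  -- the induction hypothesis from M to M + 1, and an empty one is treated exactly.
  D*Q≈q^maj : ∀ (lt : A → A → Bool) M (w : List A) → D (length w) * Q lt M w ≈[ M ] q ^ majFrom lt 1 w
  D*Q≈q^maj lt zero w = D (length w) * Q lt zero w - q ^ majFrom lt 1 w , eq _ _
    where opaque
      unfolding _+_
      eq : ∀ a b → a ≡ b + 1ℤ * (a - b)
      eq = solve-∀
  D*Q≈q^maj {A} lt (suc M) w =
    ≈-trans (≡⇒≈ (sym (∑-*ˡ (D (length w)) (cuts w) _)))
      (≈-trans (≈-∑ (cuts-++ w) (λ {(u , v)} e → subst (λ n → D n * _ ≈[ suc M ] _) (cong length e) (step u v)))
        (≡⇒≈ (cut-sum lt w)))
    where
    opaque
      unfolding _+_
      eq₁ : ∀ d r k x s → d * r * (k * (x * s)) ≡ s * r * (k * (d * x))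
      eq₁ = solve-∀
      eq₂ : ∀ k m s r → s * r * (k * m) ≡ s * (k * r) * m
      eq₂ = solve-∀
    core : ∀ (u : List A) → q ^ length u * (D (length u) * Q lt M u) ≈[ suc M ] q ^ length u * q ^ majFrom lt 1 u
    core [] = ≡⇒≈ (cong (λ z → 1ℤ * (1ℤ * z)) (Q-[] lt M) ∙ cong (1ℤ *_) (*-identityˡ _))
      where _∙_ = trans
    core (x ∷ u) = ≈-q^suc (length u) (D*Q≈q^maj lt M (x ∷ u))
    step : ∀ u v → D (length (u ++ v)) * (q ^ length u * (Q lt M u * ⟦ sorted? lt v ⟧))
      ≈[ suc M ] ⟦ sorted? lt v ⟧ * (q ^ length u * Dr (length u) (length v)) * q ^ majFrom lt 1 u
    step u v rewrite List.length-++ u {v} | Dr-split 0 (length u) (length v) =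
      ≈-trans (≡⇒≈ (eq₁ (D (length u)) (Dr (length u) (length v)) (q ^ length u) (Q lt M u) ⟦ sorted? lt v ⟧))
        (≈-trans (≈-*ˡ _ (core u)) (≡⇒≈ (eq₂ (q ^ length u) (q ^ majFrom lt 1 u) ⟦ sorted? lt v ⟧ (Dr (length u)
            (length v)))))

module _ (q : ℤ) where

  -- The q-binomial theorem in the form: the exponential generating function with respect to the
  -- q-factorials D turns sums over subsets weighted by inversions into products of power series.
  ∑-splits-cross : ∀ {R} → Sorted R → (Ψ : ℕ → ℕ → ℤ) →
    ∑ (splits R) (λ (u , v) → q ^ cross u v * (D q (length u) * D q (length v) * Ψ (length u) (length v)))
    ≡ D q (length R) * ∑ (antidiag (length R)) (λ (i , j) → Ψ i j)
  ∑-splits-cross [] Ψ = eq (Ψ 0 0)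
    where opaque
      unfolding _+_
      eq : ∀ x → 1ℤ * (1ℤ * 1ℤ * x) + 0ℤ ≡ 1ℤ * (x + 0ℤ)
      eq = solve-∀
  ∑-splits-cross {x ∷ R} (x< ∷ sR) Ψ = begin
    ∑ (splits (x ∷ R)) F ≡⟨ ∑-splits x R F ⟩
    ∑ (splits R) (λ (u , v) → F (x ∷ u , v)) + ∑ (splits R) (λ (u , v) → F (u , x ∷ v))
      ≡⟨ ∑-+ (splits R) _ _ ⟨
    ∑ (splits R) (λ (u , v) → F (x ∷ u , v) + F (u , x ∷ v))
      ≡⟨ ∑-cong-All (splits-All x<) (λ {(u , v)} (x<u , x<v) → pointwise u v x<u x<v) ⟩
    ∑ (splits R) (λ (u , v) → q ^ cross u v * (D q (length u) * D q (length v) * Ψ′ (length u) (length v)))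
      ≡⟨ ∑-splits-cross sR Ψ′ ⟩
    D q n * ∑ (antidiag n) (λ (i , j) → Ψ′ i j)
      ≡⟨ cong (D q n *_) (∑-+ (antidiag n) _ _) ⟩
    D q n * (∑ (antidiag n) (λ (i , j) → G (suc i) j) + ∑ (antidiag n) (λ (i , j) → H i (suc j)))
      ≡⟨ cong (D q n *_) (cong₂ _+_ left right) ⟩
    D q n * (∑ (antidiag (suc n)) (λ (i , j) → G i j) + ∑ (antidiag (suc n)) (λ (i , j) → H i j))
      ≡⟨ cong (D q n *_) (∑-+ (antidiag (suc n)) _ _) ⟨
    D q n * ∑ (antidiag (suc n)) (λ (i , j) → G i j + H i j)
      ≡⟨ cong (D q n *_) (∑-cong-All (antidiag-sum (suc n)) (λ {(i , j)} e → total i j e)) ⟩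
    D q n * ∑ (antidiag (suc n)) (λ (i , j) → (1ℤ - q ^ suc n) * Ψ i j)
      ≡⟨ cong (D q n *_) (∑-*ˡ _ (antidiag (suc n)) _) ⟩
    D q n * ((1ℤ - q ^ suc n) * ∑ (antidiag (suc n)) (λ (i , j) → Ψ i j)) ≡⟨ *-assoc _ _ _ ⟨
    D q n * (1ℤ - q ^ suc n) * ∑ (antidiag (suc n)) (λ (i , j) → Ψ i j)
        ≡⟨ cong (_* ∑ (antidiag (suc n)) (λ (i , j) → Ψ i j)) (D-suc q n) ⟨
    D q (suc n) * ∑ (antidiag (suc n)) (λ (i , j) → Ψ i j) ∎
    where
    n = length R
    F : List ℕ × List ℕ → ℤ
    F (u , v) = q ^ cross u v * (D q (length u) * D q (length v) * Ψ (length u) (length v))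
    -- `G` puts the smallest element x into the first part, where it causes no crossing; `H` puts it
    -- into the second part, where it crosses all of the first. That `G` vanishes for i = 0 and `H`
    -- for j = 0 supplies the missing boundary terms, and (1 - q^i) + q^i (1 - q^j) = 1 - q^(i+j) is
    -- the q-Pascal rule.
    G H Ψ′ : ℕ → ℕ → ℤ
    G i j = (1ℤ - q ^ i) * Ψ i j
    H i j = q ^ i * ((1ℤ - q ^ j) * Ψ i j)
    Ψ′ i j = G (suc i) j + H i (suc j)
    opaque
      unfolding _+_
      eq₁ : ∀ c d a e K Ψ₁ Ψ₂ b → c * (d * a * e * Ψ₁) + K * c * (d * (e * b) * Ψ₂) ≡ c * (d * e * (a * Ψ₁ + K * (b
          * Ψ₂)))
      eq₁ = solve-∀
      eq₂ : ∀ a b x → (1ℤ - a) * x + a * ((1ℤ - b) * x) ≡ (1ℤ - a * b) * x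
      eq₂ = solve-∀
      zero-left : ∀ x y → y ≡ (1ℤ - 1ℤ) * x + y
      zero-left = solve-∀
      zero-right : ∀ a x y → y ≡ y + a * ((1ℤ - 1ℤ) * x)
      zero-right = solve-∀
    pointwise : ∀ u v → All (x <_) u → All (x <_) v → F (x ∷ u , v) + F (u , x ∷ v) ≡ q ^ cross u v * (D q (length u)
        * D q (length v) * Ψ′ (length u) (length v))
    pointwise u v x<u x<v
      rewrite cross-∷ˡ u x<v | cross-∷ʳ v x<u | D-suc q (length u) | D-suc q (length v) | ^-+ q (length u) (cross u v)
      = eq₁ (q ^ cross u v) (D q (length u)) (1ℤ - q ^ suc (length u)) (D q (length v)) (q ^ length u) (Ψ (suc
          (length u)) (length v)) (Ψ (length u) (suc (length v))) (1ℤ - q ^ suc (length v))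
    left : ∑ (antidiag n) (λ (i , j) → G (suc i) j) ≡ ∑ (antidiag (suc n)) (λ (i , j) → G i j)
    left = trans (zero-left (Ψ 0 (suc n)) _) (sym (∑-antidiag n (λ (i , j) → G i j)))
    right : ∑ (antidiag n) (λ (i , j) → H i (suc j)) ≡ ∑ (antidiag (suc n)) (λ (i , j) → H i j)
    right = trans (zero-right (q ^ suc n) (Ψ (suc n) 0) _) (sym (∑-antidiagʳ n (λ (i , j) → H i j)))
    total : ∀ i j → i ℕ.+ j ≡ suc n → G i j + H i j ≡ (1ℤ - q ^ suc n) * Ψ i j
    total i j e = trans (eq₂ (q ^ i) (q ^ j) (Ψ i j)) (cong (λ z → (1ℤ - z) * Ψ i j) (trans (sym (^-+ q i j)) (cong
        (q ^_) e)))

-- The products E and their inverses for powers of q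

-- E xs a = ∏ (1 - a x z)
E : ∀ {M} → Vec ℤ M → ℤ → PS
E [] a = one
E (x ∷ xs) a = lin (a * x) (E xs a)

scale : ℤ → PS → PS
scale q f n = q ^ n * f n

scale-⊛ : ∀ q f g → scale q (f ⊛ g) ≗ scale q f ⊛ scale q g
scale-⊛ q f g n = trans (sym (∑-*ˡ (q ^ n) (antidiag n) _)) (∑-cong-All (antidiag-sum n)
  (λ {(i , j)} e → trans (cong (λ z → z * (f i * g j)) (trans (cong (q ^_) (sym e)) (^-+ q i j)))
      (*-interchange _ _ _ _)))

scale-lin : ∀ q a f → scale q (lin a f) ≗ lin (a * q) (scale q f)
scale-lin q a f zero = refl
scale-lin q a f (suc n) = eq q (q ^ n) a (f n) (f (suc n))
  where opaque
    unfolding _+_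
    eq : ∀ q Q a x y → q * Q * (y - a * x) ≡ q * Q * y - a * q * (Q * x)
    eq = solve-∀

scale-one : ∀ q → scale q one ≗ one
scale-one q zero = *-identityˡ _
scale-one q (suc n) = *-zeroʳ _

module _ (q : ℤ) where

  powers : ∀ M → Vec ℤ M
  powers zero = []
  powers (suc M) = q ^ M ∷ powers M

  -- `powers` lists the highest power first, but the recurrence of `h` splits off the variable 1 and
  -- rescales the others by q. The factors are commuted to give E the same shape.
  E-powers : ∀ M a → E (powers (suc M)) a ≗ lin a (scale q (E (powers M) a))
  E-powers zero a n = trans (cong (λ z → lin z one n) (*-identityʳ a)) (lin-cong a (λ k → sym (scale-one q k)) n)
  E-powers (suc M) a n = begin
    lin (a * (q * q ^ M)) (E (powers (suc M)) a) n ≡⟨ lin-cong _ (E-powers M a) n ⟩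
    lin (a * (q * q ^ M)) (lin a (scale q (E (powers M) a))) n ≡⟨ lin-comm _ a _ n ⟩
    lin a (lin (a * (q * q ^ M)) (scale q (E (powers M) a))) n
      ≡⟨ lin-cong a (λ k → trans (cong (λ z → lin z (scale q (E (powers M) a)) k) (eq a q (q ^ M))) (sym
          (scale-lin q _ _ k))) n ⟩
    lin a (scale q (E (powers (suc M)) a)) n ∎
    where opaque
      unfolding _+_
      eq : ∀ a q Q → a * (q * Q) ≡ a * Q * q
      eq = solve-∀

  -- the complete homogeneous symmetric functions of powers M
  h : ℕ → PS
  h M zero = 1ℤ
  h zero (suc k) = 0ℤ
  h (suc M) (suc k) = h (suc M) k + q ^ suc k * h M (suc k)

  H : ℕ → ℤ → PS
  H M a = scale a (h M)

  lin-H : ∀ M a → lin a (H (suc M) a) ≗ scale q (H M a)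
  lin-H M a zero = sym (*-identityˡ _)
  lin-H M a (suc k) = eq a (a ^ k) (h (suc M) k) (q ^ suc k) (h M (suc k))
    where opaque
      unfolding _+_
      eq : ∀ a A x Q y → a * A * (x + Q * y) - a * (A * x) ≡ Q * (a * A * y)
      eq = solve-∀

  H⊛E : ∀ M a → H M a ⊛ E (powers M) a ≗ one
  H⊛E zero a n = trans (⊛-identityʳ (H 0 a) n) (H-zero n)
    where
    H-zero : ∀ n → H 0 a n ≡ one n
    H-zero zero = *-identityˡ _
    H-zero (suc n) = *-zeroʳ _
  H⊛E (suc M) a n = begin
    (H (suc M) a ⊛ E (powers (suc M)) a) n ≡⟨ ⊛-cong (λ _ → refl) (E-powers M a) n ⟩
    (H (suc M) a ⊛ lin a (scale q (E (powers M) a))) n ≡⟨ lin-⊛ʳ a (H (suc M) a) _ n ⟩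
    lin a (H (suc M) a ⊛ scale q (E (powers M) a)) n ≡⟨ lin-⊛ a (H (suc M) a) _ n ⟨
    (lin a (H (suc M) a) ⊛ scale q (E (powers M) a)) n ≡⟨ ⊛-cong (lin-H M a) (λ _ → refl) n ⟩
    (scale q (H M a) ⊛ scale q (E (powers M) a)) n ≡⟨ scale-⊛ q (H M a) _ n ⟨
    scale q (H M a ⊛ E (powers M) a) n ≡⟨ cong (q ^ n *_) (H⊛E M a n) ⟩
    scale q one n ≡⟨ scale-one q n ⟩
    one n ∎

  -- `h M k` is a Gaussian binomial coefficient whose limit for large M is 1 / D(k). In its
  -- recurrence the term with fewer variables carries `q ^ suc k`, which makes up for the lower
  -- precision of the induction hypothesis.
  D*h≈1 : ∀ M k → _≈[_]_ q (D q k * h M k) M 1ℤ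
  D*h≈1 M zero = ≡⇒≈ q (*-identityˡ _)
  D*h≈1 zero (suc k) = D q (suc k) * h zero (suc k) - 1ℤ , eq _
    where opaque
      unfolding _+_
      eq : ∀ a → a ≡ 1ℤ + 1ℤ * (a - 1ℤ)
      eq = solve-∀
  D*h≈1 (suc M) (suc k) =
    ≈-trans q (≡⇒≈ q (trans (cong (_* h (suc M) (suc k)) (D-suc q k)) (trans (eq₁ (D q k) (q ^ suc k) (h (suc M) k)
        (h M (suc k)))
        (cong (λ z → (1ℤ - q ^ suc k) * (D q k * h (suc M) k) + q ^ suc k * (z * h M (suc k))) (sym (D-suc q k))))))
      (≈-trans q (≈-+ q (≈-*ˡ q (1ℤ - q ^ suc k) (D*h≈1 (suc M) k)) (≈-q^suc q k (D*h≈1 M (suc k)))) (≡⇒≈ q (eq₂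
          (q ^ suc k))))
    where opaque
      unfolding _+_
      eq₁ : ∀ d Q x y → d * (1ℤ - Q) * (x + Q * y) ≡ (1ℤ - Q) * (d * x) + Q * (d * (1ℤ - Q) * y)
      eq₁ = solve-∀
      eq₂ : ∀ Q → (1ℤ - Q) * 1ℤ + Q * 1ℤ ≡ 1ℤ
      eq₂ = solve-∀

-- Coefficients of products of linear forms

∑-allFin : ∀ M (f : Fin (suc M) → ℤ) → ∑ (allFin (suc M)) f ≡ f zero + ∑ (allFin M) (f ∘ suc)
∑-allFin M f = cong (f zero +_) (trans (cong (λ xs → ∑ xs f) (sym (List.map-tabulate id suc))) (∑-map suc
    (allFin M) f))

δ : Fin M → Fin M → ℤ
δ u j = ⟦ does (u Fin.≟ j) ⟧

∑-δ : ∀ {M} (u : Fin M) (f : Fin M → ℤ) → ∑ (allFin M) (λ j → δ u j * f j) ≡ f u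
∑-δ {suc M} zero f = begin
  ∑ (allFin (suc M)) (λ j → δ zero j * f j) ≡⟨ ∑-allFin M (λ j → δ zero j * f j) ⟩
  1ℤ * f zero + ∑ (allFin M) (λ j → 0ℤ * f (suc j))
    ≡⟨ cong₂ _+_ (*-identityˡ _) (trans (∑-cong (allFin M) (λ j → *-zeroˡ _)) (∑-zero (allFin M))) ⟩
  f zero + 0ℤ ≡⟨ +-identityʳ _ ⟩
  f zero ∎
∑-δ {suc M} (suc u) f = begin
  ∑ (allFin (suc M)) (λ j → δ (suc u) j * f j) ≡⟨ ∑-allFin M (λ j → δ (suc u) j * f j) ⟩
  0ℤ * f zero + ∑ (allFin M) (λ j → δ u j * f (suc j)) ≡⟨ cong₂ _+_ (*-zeroˡ _) (∑-δ u (f ∘ suc)) ⟩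
  0ℤ + f (suc u) ≡⟨ +-identityˡ _ ⟩
  f (suc u) ∎

inc : Fin M → Vec ℕ M → Vec ℕ M
inc zero (k ∷ c) = suc k ∷ c
inc (suc j) (k ∷ c) = k ∷ inc j c

dec : Fin M → Vec ℕ M → Maybe (Vec ℕ M)
dec zero (zero ∷ c) = nothing
dec zero (suc k ∷ c) = just (k ∷ c)
dec (suc j) (k ∷ c) = Maybe.map (k ∷_) (dec j c)

inc-injective : ∀ (j : Fin M) {c d} → inc j c ≡ inc j d → c ≡ d
inc-injective zero {_ ∷ _} {_ ∷ _} refl = refl
inc-injective (suc j) {k ∷ c} {_ ∷ d} e = cong₂ _∷_ (cong Vec.head e) (inc-injective j (cong Vec.tail e))

dec-just : ∀ (j : Fin M) c {d} → dec j c ≡ just d → c ≡ inc j d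
dec-just zero (suc k ∷ c) refl = refl
dec-just (suc j) (k ∷ c) e with dec j c in e′
dec-just (suc j) (k ∷ c) refl | just d = cong (k ∷_) (dec-just j c e′)

dec-nothing : ∀ (j : Fin M) c → lookup c j ≡ 0 → dec j c ≡ nothing
dec-nothing zero (zero ∷ c) e = refl
dec-nothing (suc j) (k ∷ c) e = cong (Maybe.map (k ∷_)) (dec-nothing j c e)

lookup-inc : ∀ (j : Fin M) c → lookup (inc j c) j ≡ suc (lookup c j)
lookup-inc zero (k ∷ c) = refl
lookup-inc (suc j) (k ∷ c) = lookup-inc j c

lookup-inc-≢ : ∀ (j i : Fin M) c → i ≢ j → lookup (inc j c) i ≡ lookup c i
lookup-inc-≢ zero zero (k ∷ c) ne = contradiction refl ne
lookup-inc-≢ zero (suc i) (k ∷ c) ne = refl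
lookup-inc-≢ (suc j) zero (k ∷ c) ne = refl
lookup-inc-≢ (suc j) (suc i) (k ∷ c) ne = lookup-inc-≢ j i c (ne ∘ cong suc)

sum-inc : ∀ (j : Fin M) c → Vec.sum (inc j c) ≡ suc (Vec.sum c)
sum-inc zero (k ∷ c) = refl
sum-inc (suc j) (k ∷ c) = trans (cong (k ℕ.+_) (sum-inc j c)) (ℕ.+-suc k _)

inc-≢ : ∀ (v u : Fin M) {m c} → inc v m ≡ inc u c → u ≢ v → ∃ λ d → m ≡ inc u d × c ≡ inc v d
inc-≢ zero zero e ne = contradiction refl ne
inc-≢ zero (suc u) {k ∷ m} {_ ∷ c} refl ne = k ∷ c , refl , refl
inc-≢ (suc v) zero {_ ∷ m} {k ∷ c} refl ne = k ∷ m , refl , refl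
inc-≢ (suc v) (suc u) {k ∷ m} {_ ∷ c} e ne with inc-≢ v u {m} {c} (cong Vec.tail e) (ne ∘ cong suc)
... | d , e₁ , e₂ = k ∷ d , cong (k ∷_) e₁ , cong₂ _∷_ (sym (cong Vec.head e)) e₂

lookup-suc : ∀ (j : Fin M) c {k} → lookup c j ≡ suc k → ∃ λ d → c ≡ inc j d
lookup-suc zero (suc k ∷ c) e = k ∷ c , refl
lookup-suc (suc j) (k ∷ c) e with lookup-suc j c e
... | d , refl = k ∷ d , refl

sum-suc : ∀ (c : Vec ℕ M) {n} → Vec.sum c ≡ suc n →
  ∃₂ λ v d → c ≡ inc v d × (∀ i → toℕ i < toℕ v → lookup c i ≡ 0)
sum-suc (suc k ∷ c) e = zero , k ∷ c , refl , λ _ ()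
sum-suc (zero ∷ c) e with sum-suc c e
... | v , d , e′ , z = suc v , 0 ∷ d , cong (0 ∷_) e′ , λ { zero _ → refl ; (suc i) (ℕ.s≤s p) → z i p }

at : (A → ℤ) → Maybe A → ℤ
at G nothing = 0ℤ
at G (just c) = G c

at-cong : ∀ {G G′ : A → ℤ} m → (∀ {c} → m ≡ just c → G c ≡ G′ c) → at G m ≡ at G′ m
at-cong nothing e = refl
at-cong (just c) e = e refl

at-∑ : (xs : List B) (G : B → A → ℤ) (m : Maybe A) → at (λ c → ∑ xs (λ x → G x c)) m ≡ ∑ xs (λ x → at (G x) m)
at-∑ xs G nothing = sym (∑-zero xs)
at-∑ xs G (just c) = refl

at-* : (a : ℤ) (G : A → ℤ) (m : Maybe A) → at (λ c → a * G c) m ≡ a * at G m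
at-* a G nothing = sym (*-zeroʳ a)
at-* a G (just c) = refl

at-map : (h : A → B) (G : B → ℤ) (m : Maybe A) → at G (Maybe.map h m) ≡ at (G ∘ h) m
at-map h G nothing = refl
at-map h G (just c) = refl

at-dec-comm : ∀ (j k : Fin M) c (G : Vec ℕ M → ℤ) → at (at G ∘ dec k) (dec j c) ≡ at (at G ∘ dec j) (dec k c)
at-dec-comm zero zero c G = refl
at-dec-comm zero (suc k) (zero ∷ c) G with dec k c
... | nothing = refl
... | just _ = refl
at-dec-comm zero (suc k) (suc _ ∷ c) G with dec k c
... | nothing = refl
... | just _ = refl
at-dec-comm (suc j) zero (zero ∷ c) G with dec j c
... | nothing = refl
... | just _ = refl
at-dec-comm (suc j) zero (suc _ ∷ c) G with dec j c
... | nothing = refl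
... | just _ = refl
at-dec-comm (suc j) (suc k) (x ∷ c) G = begin
  at (at G ∘ dec (suc k)) (Maybe.map (x ∷_) (dec j c)) ≡⟨ at-map (x ∷_) _ (dec j c) ⟩
  at (λ d → at G (Maybe.map (x ∷_) (dec k d))) (dec j c) ≡⟨ at-cong (dec j c) (λ {d} _ → at-map (x ∷_) G (dec k d)) ⟩
  at (at (G ∘ (x ∷_)) ∘ dec k) (dec j c) ≡⟨ at-dec-comm j k c (G ∘ (x ∷_)) ⟩
  at (at (G ∘ (x ∷_)) ∘ dec j) (dec k c) ≡⟨ at-cong (dec k c) (λ {d} _ → at-map (x ∷_) G (dec j d)) ⟨
  at (λ d → at G (Maybe.map (x ∷_) (dec j d))) (dec k c) ≡⟨ at-map (x ∷_) _ (dec k c) ⟨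
  at (at G ∘ dec (suc j)) (Maybe.map (x ∷_) (dec k c)) ∎

allZero : Vec ℕ M → Bool
allZero [] = true
allZero (zero ∷ c) = allZero c
allZero (suc _ ∷ c) = false

Form : ℕ → Set
Form M = Fin M → ℤ

-- the coefficient of x^c in the product of the given linear forms
Co : List (Form M) → Vec ℕ M → ℤ
Co [] c = ⟦ allZero c ⟧
Co {M} (ℓ ∷ ℓs) c = ∑ (allFin M) (λ j → ℓ j * at (Co ℓs) (dec j c))

Co-∷ : ∀ (ℓ : Form M) ℓs ℓs′ → Co ℓs ≗ Co ℓs′ → Co (ℓ ∷ ℓs) ≗ Co (ℓ ∷ ℓs′)
Co-∷ ℓ _ _ e c = ∑-cong (allFin _) (λ j → cong (ℓ j *_) (at-cong (dec j c) (λ {d} _ → e d)))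

Co-swap : ∀ (ℓ ℓ′ : Form M) ℓs → Co (ℓ ∷ ℓ′ ∷ ℓs) ≗ Co (ℓ′ ∷ ℓ ∷ ℓs)
Co-swap {M} ℓ ℓ′ ℓs c = begin
  Co (ℓ ∷ ℓ′ ∷ ℓs) c ≡⟨ ∑-cong (allFin M) (expand ℓ ℓ′) ⟩
  ∑ (allFin M) (λ j → ∑ (allFin M) (λ k → ℓ j * (ℓ′ k * at (at (Co ℓs) ∘ dec k) (dec j c))))
      ≡⟨ ∑-swap (allFin M) (allFin M) _ ⟩
  ∑ (allFin M) (λ k → ∑ (allFin M) (λ j → ℓ j * (ℓ′ k * at (at (Co ℓs) ∘ dec k) (dec j c))))
    ≡⟨ ∑-cong (allFin M) (λ k → ∑-cong (allFin M) (λ j → trans (cong (λ z → ℓ j * (ℓ′ k * z)) (at-dec-comm j k c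
        (Co ℓs))) (*-exchange (ℓ j) (ℓ′ k) _))) ⟩
  ∑ (allFin M) (λ k → ∑ (allFin M) (λ j → ℓ′ k * (ℓ j * at (at (Co ℓs) ∘ dec j) (dec k c))))
      ≡⟨ ∑-cong (allFin M) (expand ℓ′ ℓ) ⟨
  Co (ℓ′ ∷ ℓ ∷ ℓs) c ∎
  where
  expand : ∀ (ℓ ℓ′ : Form M) j → ℓ j * at (Co (ℓ′ ∷ ℓs)) (dec j c) ≡ ∑ (allFin M) (λ k → ℓ j * (ℓ′ k * at (at
      (Co ℓs) ∘ dec k) (dec j c)))
  expand ℓ ℓ′ j = trans (cong (ℓ j *_) (trans (at-∑ (allFin M) (λ k d → ℓ′ k * at (Co ℓs) (dec k d)) (dec j c))
      (∑-cong (allFin M) (λ k → at-* (ℓ′ k) _ (dec j c)))))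
    (sym (∑-*ˡ (ℓ j) (allFin M) _))

-- This freedom is what the walk exploits: at each step any of the remaining factors may be the next
-- one to be expanded.
Co-↭ : ∀ {ℓs ℓs′ : List (Form M)} → ℓs ↭ ℓs′ → Co ℓs ≗ Co ℓs′
Co-↭ Perm.refl c = refl
Co-↭ (prep {xs} {ys} ℓ p) c = Co-∷ ℓ xs ys (Co-↭ p) c
Co-↭ (swap {xs} {ys} ℓ ℓ′ p) c = trans (Co-swap ℓ ℓ′ xs c) (Co-∷ ℓ′ (ℓ ∷ xs) (ℓ ∷ ys) (λ d → Co-∷ ℓ xs ys
    (Co-↭ p) d) c)
Co-↭ (Perm.trans p p′) c = trans (Co-↭ p c) (Co-↭ p′ c)

-- A form matters only at letters that are still available. This permits replacing `L u` by `L+ u`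
-- once the letter u is used up.
Co-head-cong : ∀ {ℓ ℓ′ : Form M} ℓs c → (∀ j {d} → dec j c ≡ just d → ℓ j ≡ ℓ′ j) → Co (ℓ ∷ ℓs) c ≡ Co (ℓ′ ∷ ℓs) c
Co-head-cong {M} {ℓ} {ℓ′} ℓs c e = ∑-cong (allFin M) f
  where
  f : ∀ j → ℓ j * at (Co ℓs) (dec j c) ≡ ℓ′ j * at (Co ℓs) (dec j c)
  f j with dec j c in e′
  ... | nothing = trans (*-zeroʳ _) (sym (*-zeroʳ _))
  ... | just d = cong (_* Co ℓs d) (e j e′)

bag : (Fin M → ℕ → List A) → Vec ℕ M → List A
bag b [] = []
bag b (k ∷ m) = b zero k ++ bag (b ∘ suc) m

bag-cong : ∀ {b b′ : Fin M → ℕ → List A} m → (∀ u → b u (lookup m u) ≡ b′ u (lookup m u)) → bag b m ≡ bag b′ m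
bag-cong [] e = refl
bag-cong (k ∷ m) e = cong₂ _++_ (e zero) (bag-cong m (e ∘ suc))

bag-inc : ∀ {b b′ : Fin M → ℕ → List A} {x} (u : Fin M) m → b u (suc (lookup m u)) ↭ x ∷ b′ u (lookup m u) →
  (∀ w k → w ≢ u → b w k ≡ b′ w k) → bag b (inc u m) ↭ x ∷ bag b′ m
bag-inc {b = b} zero (k ∷ m) p e = Perm.++⁺ p (Perm.↭-reflexive (bag-cong m (λ w → e (suc w) _ (λ ()))))
bag-inc {b = b} {b′} {x} (suc u) (k ∷ m) p e rewrite e zero k (λ ()) =
  ↭-trans (Perm.++⁺ˡ (b′ zero k) (bag-inc u m p (λ w k ne → e (suc w) k (ne ∘ Fin.suc-injective)))) (Perm.shift x
      (b′ zero k) _)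

bag-zero : ∀ {b : Fin M → ℕ → List A} m → (∀ u → b u 0 ≡ []) → Vec.sum m ≡ 0 → bag b m ≡ []
bag-zero [] e s = refl
bag-zero {b = b} (zero ∷ m) e s rewrite e zero = bag-zero m (e ∘ suc) s

comps : ∀ M → ℕ → List (Vec ℕ M)
comps zero zero = [] ∷ []
comps zero (suc n) = []
comps (suc M) n = concatMap (λ (d , m) → map (d ∷_) (comps M m)) (antidiag n)

∑-comps : ∀ M n (f : Vec ℕ (suc M) → ℤ) →
  ∑ (comps (suc M) n) f ≡ ∑ (antidiag n) (λ (d , m) → ∑ (comps M m) (λ c → f (d ∷ c)))
∑-comps M n f = trans (∑-concatMap _ (antidiag n) f) (∑-cong (antidiag n) (λ (d , m) → ∑-map (d ∷_) (comps M m) f))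

comps-sum : ∀ M n → All (λ c → Vec.sum c ≡ n) (comps M n)
comps-sum zero zero = refl ∷ []
comps-sum zero (suc n) = []
comps-sum (suc M) n = All.concat⁺ (All.map⁺ (All.map (λ {(d , m)} e → All.map⁺ (All.map (λ e′ → trans (cong
    (d ℕ.+_) e′) e) (comps-sum M m))) (antidiag-sum n)))

∑-comps-0 : ∀ M (f : Vec ℕ M → ℤ) → ∑ (comps M 0) f ≡ f (Vec.replicate M 0)
∑-comps-0 zero f = +-identityʳ _
∑-comps-0 (suc M) f = trans (∑-comps M 0 f) (trans (+-identityʳ _) (∑-comps-0 M (f ∘ (0 ∷_))))

∑-comps-dec-0 : ∀ {M} (j : Fin M) (G : Vec ℕ M → ℤ) → ∑ (comps M 0) (at G ∘ dec j) ≡ 0ℤ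
∑-comps-dec-0 {M} j G = trans (∑-comps-0 M _) (cong (at G) (dec-nothing j (Vec.replicate M 0) (lookup-replicate j)))
  where lookup-replicate : ∀ {M} (j : Fin M) → lookup (Vec.replicate M 0) j ≡ 0
        lookup-replicate zero = refl
        lookup-replicate (suc j) = lookup-replicate j

∑-comps-dec : ∀ {M} n (j : Fin M) (G : Vec ℕ M → ℤ) → ∑ (comps M (suc n)) (at G ∘ dec j) ≡ ∑ (comps M n) G
∑-comps-dec {suc M} n zero G = begin
  ∑ (comps (suc M) (suc n)) (at G ∘ dec zero) ≡⟨ ∑-comps M (suc n) _ ⟩
  ∑ (antidiag (suc n)) (λ (d , m) → ∑ (comps M m) (λ c → at G (dec zero (d ∷ c))))
      ≡⟨ ∑-antidiag n (λ (d , m) → ∑ (comps M m) (λ c → at G (dec zero (d ∷ c)))) ⟩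
  ∑ (comps M (suc n)) (λ c → 0ℤ) + ∑ (antidiag n) (λ (d , m) → ∑ (comps M m) (λ c → G (d ∷ c)))
    ≡⟨ cong₂ _+_ (∑-zero (comps M (suc n))) (sym (∑-comps M n G)) ⟩
  0ℤ + ∑ (comps (suc M) n) G ≡⟨ +-identityˡ _ ⟩
  ∑ (comps (suc M) n) G ∎
∑-comps-dec {suc M} n (suc j) G = begin
  ∑ (comps (suc M) (suc n)) (at G ∘ dec (suc j)) ≡⟨ ∑-comps M (suc n) _ ⟩
  ∑ (antidiag (suc n)) (λ (d , m) → ∑ (comps M m) (λ c → at G (Maybe.map (d ∷_) (dec j c))))
    ≡⟨ ∑-cong (antidiag (suc n)) (λ (d , m) → ∑-cong (comps M m) (λ c → at-map (d ∷_) G (dec j c))) ⟩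
  ∑ (antidiag (suc n)) (λ (d , m) → ∑ (comps M m) (at (G ∘ (d ∷_)) ∘ dec j))
    ≡⟨ ∑-antidiagʳ n (λ (d , m) → ∑ (comps M m) (at (G ∘ (d ∷_)) ∘ dec j)) ⟩
  ∑ (antidiag n) (λ (d , m) → ∑ (comps M (suc m)) (at (G ∘ (d ∷_)) ∘ dec j)) + ∑ (comps M 0) (at (G ∘
      (suc n ∷_)) ∘ dec j)
    ≡⟨ cong₂ _+_ (∑-cong (antidiag n) (λ (d , m) → ∑-comps-dec m j (G ∘ (d ∷_)))) (∑-comps-dec-0 j (G ∘ (suc n ∷_))) ⟩
  ∑ (antidiag n) (λ (d , m) → ∑ (comps M m) (G ∘ (d ∷_))) + 0ℤ ≡⟨ +-identityʳ _ ⟩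
  ∑ (antidiag n) (λ (d , m) → ∑ (comps M m) (G ∘ (d ∷_))) ≡⟨ ∑-comps M n G ⟨
  ∑ (comps (suc M) n) G ∎

mono : Vec ℤ M → Vec ℕ M → ℤ
mono [] [] = 1ℤ
mono (x ∷ xs) (k ∷ c) = x ^ k * mono xs c

mono-inc : ∀ (xs : Vec ℤ M) j c → mono xs (inc j c) ≡ lookup xs j * mono xs c
mono-inc (x ∷ xs) zero (k ∷ c) = *-assoc _ _ _
mono-inc (x ∷ xs) (suc j) (k ∷ c) = trans (cong (x ^ k *_) (mono-inc xs j c)) (*-exchange (x ^ k) (lookup xs j)
    (mono xs c))

mono-0 : (xs : Vec ℤ M) → mono xs (Vec.replicate M 0) ≡ 1ℤ
mono-0 [] = refl
mono-0 (x ∷ xs) = trans (*-identityˡ _) (mono-0 xs)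

allZero-0 : ∀ M → allZero (Vec.replicate M 0) ≡ true
allZero-0 zero = refl
allZero-0 (suc M) = allZero-0 M

-- Taking out one letter j divides the monomial by x_j and lowers the degree by one. So expanding
-- the first form is multiplication by a linear form on the level of generating functions.
∑-mono-dec : ∀ {M} (xs : Vec ℤ M) n (ℓ : Form M) (G : Fin M → Vec ℕ M → ℤ) →
  ∑ (comps M (suc n)) (λ c → mono xs c * ∑ (allFin M) (λ j → ℓ j * at (G j) (dec j c)))
  ≡ ∑ (allFin M) (λ j → ℓ j * (lookup xs j * ∑ (comps M n) (λ c → mono xs c * G j c)))
∑-mono-dec {M} xs n ℓ G = begin
  ∑ (comps M (suc n)) (λ c → mono xs c * ∑ (allFin M) (λ j → ℓ j * at (G j) (dec j c)))
    ≡⟨ ∑-cong (comps M (suc n)) (λ c → trans (sym (∑-*ˡ (mono xs c) (allFin M) _)) (∑-cong (allFin M) (λ j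
        → move j c))) ⟩
  ∑ (comps M (suc n)) (λ c → ∑ (allFin M) (λ j → ℓ j * (lookup xs j * at (λ d → mono xs d * G j d) (dec j c))))
    ≡⟨ ∑-swap (comps M (suc n)) (allFin M) _ ⟩
  ∑ (allFin M) (λ j → ∑ (comps M (suc n)) (λ c → ℓ j * (lookup xs j * at (λ d → mono xs d * G j d) (dec j c))))
    ≡⟨ ∑-cong (allFin M) (λ j → trans (∑-*ˡ (ℓ j) (comps M (suc n)) _) (cong (ℓ j *_) (trans (∑-*ˡ (lookup xs j)
        (comps M (suc n)) _) (cong (lookup xs j *_) (∑-comps-dec n j _))))) ⟩
  ∑ (allFin M) (λ j → ℓ j * (lookup xs j * ∑ (comps M n) (λ c → mono xs c * G j c))) ∎
  where
  opaque
    unfolding _+_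
    eq : ∀ l x m g → x * m * (l * g) ≡ l * (x * (m * g))
    eq = solve-∀
  move : ∀ j c → mono xs c * (ℓ j * at (G j) (dec j c)) ≡ ℓ j * (lookup xs j * at (λ d → mono xs d * G j d) (dec j c))
  move j c with dec j c in e
  ... | nothing = trans (cong (mono xs c *_) (*-zeroʳ (ℓ j))) (trans (*-zeroʳ (mono xs c)) (sym (trans (cong (ℓ j *_)
      (*-zeroʳ (lookup xs j))) (*-zeroʳ (ℓ j)))))
  ... | just d rewrite dec-just j c e | mono-inc xs j d = eq (ℓ j) (lookup xs j) (mono xs d) (G j d)

-- A telescoping product: Ψ_u / Ψ_(u+1) = (1 - T x_u z) / (1 - x_u z), with the denominators cleared
-- one after the other.
lin-chain : ∀ {M} T (xs : Vec ℤ M) (Ψ : ℕ → PS) →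
  (∀ u → lin (1ℤ * lookup xs u) (Ψ (toℕ u)) ≗ lin (T * lookup xs u) (Ψ (suc (toℕ u)))) →
  Ψ 0 ⊛ E xs 1ℤ ≗ Ψ M ⊛ E xs T
lin-chain T [] Ψ e n = refl
lin-chain {suc M} T (x ∷ xs) Ψ e n = begin
  (Ψ 0 ⊛ lin (1ℤ * x) (E xs 1ℤ)) n ≡⟨ lin-⊛ʳ _ (Ψ 0) (E xs 1ℤ) n ⟩
  lin (1ℤ * x) (Ψ 0 ⊛ E xs 1ℤ) n ≡⟨ lin-⊛ _ (Ψ 0) (E xs 1ℤ) n ⟨
  (lin (1ℤ * x) (Ψ 0) ⊛ E xs 1ℤ) n ≡⟨ ⊛-cong (e zero) (λ _ → refl) n ⟩
  (lin (T * x) (Ψ 1) ⊛ E xs 1ℤ) n ≡⟨ lin-⊛ _ (Ψ 1) (E xs 1ℤ) n ⟩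
  lin (T * x) (Ψ 1 ⊛ E xs 1ℤ) n ≡⟨ lin-cong _ (lin-chain T xs (Ψ ∘ suc) (e ∘ suc)) n ⟩
  lin (T * x) (Ψ (suc M) ⊛ E xs T) n ≡⟨ lin-⊛ʳ _ (Ψ (suc M)) (E xs T) n ⟨
  (Ψ (suc M) ⊛ lin (T * x) (E xs T)) n ∎

-- Coefficient extraction by walks through the blocks

module Walk (t g T : ℤ) where

  -- In the application g is the weight of the colors 0, ..., l-1 and t g that of the colors 1, ...,
  -- l. A value that is a position of block k exceeds all positions of an earlier block j, where it
  -- cannot have color 0 but may be recolored.
  threshold : ℕ → Form M
  threshold k j = if toℕ j <ᵇ k then t * g else g

  -- `L u` belongs to the first value of block u. The other values of the block have `L+ u`, since
  -- inside their own block they admit the additional color l as well.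
  L L+ : Fin M → Form M
  L u = threshold (toℕ u)
  L+ u j = L u j + T * δ u j

  closed : Fin M → ℕ → List (Form M)
  closed u zero = []
  closed u (suc k) = L u ∷ replicate k (L+ u)

  -- The block v from which the walk departed has already given up its special form; all other
  -- blocks still own theirs.
  opened : Fin M → Fin M → ℕ → List (Form M)
  opened v u k = if does (u Fin.≟ v) then replicate k (L+ u) else closed u k

  -- The total weight of the walks of length n from u whose steps spend the letters c. The weight of
  -- a step depends only on its two ends, not on what has been popped before.
  φ : ℕ → Fin M → Vec ℕ M → ℤ
  φ zero u c = ⟦ allZero c ⟧
  φ {M} (suc n) u c = ∑ (allFin M) (λ j → L+ u j * at (φ n j) (dec j c))

  private
    opened-≡ : ∀ (v : Fin M) k → opened v v k ≡ replicate k (L+ v)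
    opened-≡ v k rewrite dec-true (v Fin.≟ v) refl = refl

    opened-≢ : ∀ (v u : Fin M) k → u ≢ v → opened v u k ≡ closed u k
    opened-≢ v u k ne rewrite dec-false (u Fin.≟ v) ne = refl

    threshold-≥ : ∀ k (j : Fin M) → k ≤ toℕ j → threshold k j ≡ g
    threshold-≥ k j p rewrite <ᵇ-false p = refl

    L+-≢ : ∀ (u j : Fin M) → u ≢ j → L+ u j ≡ L u j
    L+-≢ u j ne rewrite dec-false (u Fin.≟ j) ne = trans (cong (L u j +_) (*-zeroʳ T)) (+-identityʳ _)

    Co-∷-at : ∀ n (ℓ : Form M) ℓs c → (∀ j {d} → c ≡ inc j d → Co ℓs d ≡ φ n j d) →
      Co (ℓ ∷ ℓs) c ≡ ∑ (allFin M) (λ j → ℓ j * at (φ n j) (dec j c))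
    Co-∷-at n ℓ ℓs c e = ∑-cong (allFin _) (λ j → cong (ℓ j *_) (at-cong (dec j c) (λ e′ → e j (dec-just j c e′))))

    zero-below : ∀ {v j : Fin M} {c d} → c ≡ inc j d → (∀ i → toℕ i < toℕ v → lookup c i ≡ 0) →
      toℕ v ≤ toℕ j × (∀ i → toℕ i < toℕ v → lookup d i ≡ 0)
    zero-below {v = v} {j} {d = d} refl z = v≤j , λ i p → trans (sym (lookup-inc-≢ j i d (λ { refl → ℕ.<⇒≱ p v≤j })))
        (z i p)
      where
      v≤j : toℕ v ≤ toℕ j
      v≤j with toℕ v ℕ.≤? toℕ j
      ... | yes p = p
      ... | no p with () ← trans (sym (lookup-inc j d)) (z j (ℕ.≰⇒> p))

  -- Coefficient extraction by walking: standing at u, the next step is the form popped from block u;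
  -- v is the base of the walk, and the blocks m still to be popped differ from the letters c still to be
  -- used by the two endpoints of the walk.
  walk : ∀ n (v u : Fin M) m c → Vec.sum c ≡ n → inc v m ≡ inc u c →
    (∀ i → toℕ i < toℕ v → lookup c i ≡ 0) → Co (bag (opened v) m) c ≡ φ n u c
  start : ∀ n (c : Vec ℕ M) → Vec.sum c ≡ suc n →
    Co (bag closed c) c ≡ ∑ (allFin M) (λ j → g * at (φ n j) (dec j c))

  walk n v u m c s e z with u Fin.≟ v
  walk n v u m c s e z | no ne with inc-≢ v u {m} {c} e ne
  walk zero v u m c s e z | no ne | d , e₁ , refl with () ← trans (sym (sum-inc v d)) s
  walk {M} (suc n) v u m c s e z | no ne | d , refl , e₂ = begin
    Co (bag (opened v) (inc u d)) c ≡⟨ Co-↭ (bag-inc u d (pop (lookup d u)) (λ _ _ _ → refl)) c ⟩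
    Co (top (lookup d u) ∷ bag (opened v) d) c ≡⟨ Co-head-cong (bag (opened v) d) c (top-L+ _ refl) ⟩
    Co (L+ u ∷ bag (opened v) d) c ≡⟨ Co-∷-at n (L+ u) (bag (opened v) d) c (λ j {d′} e′ →
        walk n v j d d′ (ℕ.suc-injective (trans (sym (sum-inc j d′)) (trans (cong Vec.sum (sym e′)) s))) (trans
            (sym e₂) e′) (proj₂ (zero-below {v = v} {j} e′ z))) ⟩
    φ (suc n) u c ∎
    where
    -- The special form `L u` is kept until it is the last one of block u. By the balance of the
    -- walk no letter u is then left either, and `L u` agrees with `L+ u` on all letters other than
    -- u.
    top : ℕ → Form M
    top zero = L u
    top (suc _) = L+ u
    pop : ∀ k → opened v u (suc k) ↭ top k ∷ opened v u k
    pop k rewrite opened-≢ v u (suc k) ne | opened-≢ v u k ne with k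
    ... | zero = ↭-refl
    ... | suc k = swap _ _ ↭-refl
    top-L+ : ∀ k → k ≡ lookup d u → ∀ j {d′} → dec j c ≡ just d′ → top k j ≡ L+ u j
    top-L+ (suc k) e′ j e″ = refl
    top-L+ zero e′ j e″ = sym (L+-≢ u j u≢j)
      where
      u≢j : u ≢ j
      u≢j refl with () ← trans (sym e″) (dec-nothing u c (trans (cong (λ z → lookup z u) e₂) (trans
          (lookup-inc-≢ v u d ne) (sym e′))))
  walk n v u m c s e z | yes refl with inc-injective v {m} {c} e | lookup c v in e′
  walk zero v u m c s e z | yes refl | refl | suc k with lookup-suc v c e′
  ... | d , refl with () ← trans (sym (sum-inc v d)) s
  walk {M} (suc n) v u m c s e z | yes refl | refl | suc k with lookup-suc v c e′
  ... | d , e₂ = begin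
    Co (bag (opened v) c) c ≡⟨ cong (λ x → Co (bag (opened v) x) c) e₂ ⟩
    Co (bag (opened v) (inc v d)) c ≡⟨ Co-↭ (bag-inc v d (pop (lookup d v)) (λ _ _ _ → refl)) c ⟩
    Co (L+ v ∷ bag (opened v) d) c ≡⟨ Co-∷-at n (L+ v) (bag (opened v) d) c (λ j {d′} e″ →
        walk n v j d d′ (ℕ.suc-injective (trans (sym (sum-inc j d′)) (trans (cong Vec.sum (sym e″)) s))) (trans
            (sym e₂) e″) (proj₂ (zero-below {v = v} {j} e″ z))) ⟩
    φ (suc n) v c ∎
    where
    pop : ∀ k → opened v v (suc k) ↭ L+ v ∷ opened v v k
    pop k rewrite opened-≡ v (suc k) | opened-≡ v k = ↭-refl
  walk zero v u m c s e z | yes refl | refl | zero = cong (λ ℓs → Co ℓs c) (bag-zero c opened-0 s)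
    where
    opened-0 : ∀ u → opened v u 0 ≡ []
    opened-0 u with does (u Fin.≟ v)
    ... | true = refl
    ... | false = refl
  -- Back at the base, with its forms and letters exhausted, the remaining product has the initial
  -- shape, so a new walk starts. All remaining letters lie above v, so the uniform weight g of its
  -- first step equals `L+ v`, and the new walk continues the old one as if by a step from v. This
  -- is how Foata joins cycles to a word.
  walk {M} (suc n) v u m c s e z | yes refl | refl | zero = begin
    Co (bag (opened v) c) c ≡⟨ cong (λ ℓs → Co ℓs c) (bag-cong c open-closed) ⟩
    Co (bag closed c) c ≡⟨ start n c s ⟩
    ∑ (allFin M) (λ j → g * at (φ n j) (dec j c)) ≡⟨ ∑-cong (allFin M) weight ⟩
    φ (suc n) v c ∎
    where
    open-closed : ∀ u → opened v u (lookup c u) ≡ closed u (lookup c u)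
    open-closed u with u Fin.≟ v
    ... | yes refl rewrite e′ = refl
    ... | no _ = refl
    weight : ∀ j → g * at (φ n j) (dec j c) ≡ L+ v j * at (φ n j) (dec j c)
    weight j with dec j c in e″
    ... | nothing = trans (*-zeroʳ _) (sym (*-zeroʳ _))
    ... | just d = cong (_* φ n j d) (sym (trans (L+-≢ v j ne) (threshold-≥ (toℕ v) j (proj₁ (zero-below {v = v} {j}
        (dec-just j c e″) z)))))
      where
      ne : v ≢ j
      ne refl with () ← trans (sym e″) (dec-nothing v c e′)

  -- The walk starts at the first block v in use, and there with the special form: every available
  -- letter j has j ≥ v, so `L v` takes the value g on it.
  start {M} n c s with sum-suc c s
  ... | v , d , e , z = begin
    Co (bag closed c) c ≡⟨ cong (λ x → Co (bag closed x) c) e ⟩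
    Co (bag closed (inc v d)) c ≡⟨ Co-↭ (bag-inc v d pop (λ w k ne → sym (opened-≢ v w k ne))) c ⟩
    Co (L v ∷ bag (opened v) d) c ≡⟨ Co-∷-at n (L v) (bag (opened v) d) c (λ j {d′} e′ →
        walk n v j d d′ (ℕ.suc-injective (trans (sym (sum-inc j d′)) (trans (cong Vec.sum (sym e′)) s))) (trans
            (sym e) e′) (proj₂ (zero-below {v = v} {j} e′ z))) ⟩
    ∑ (allFin M) (λ j → L v j * at (φ n j) (dec j c)) ≡⟨ ∑-cong (allFin M) weight ⟩
    ∑ (allFin M) (λ j → g * at (φ n j) (dec j c)) ∎
    where
    pop : closed v (suc (lookup d v)) ↭ L v ∷ opened v v (lookup d v)
    pop rewrite opened-≡ v (lookup d v) = ↭-refl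
    weight : ∀ j → L v j * at (φ n j) (dec j c) ≡ g * at (φ n j) (dec j c)
    weight j with dec j c in e″
    ... | nothing = trans (*-zeroʳ _) (sym (*-zeroʳ _))
    ... | just d′ = cong (_* φ n j d′) (threshold-≥ (toℕ v) j (proj₁ (zero-below {v = v} {j} (dec-just j c e″) z)))

  module _ {M} (xs : Vec ℤ M) where

    Φ : Fin M → PS
    Φ u n = ∑ (comps M n) (λ c → mono xs c * φ n u c)

    F : PS
    F n = ∑ (comps M n) (λ c → mono xs c * Co (bag closed c) c)

    -- Interpolates between F, for k = 0, and (1 - t) + t F, for k = M. The neighbours at u and u +
    -- 1 are both linear multiples of `Φ u`, which yields the quotients for `lin-chain`.
    Ψ : ℕ → PS
    Ψ k zero = 1ℤ
    Ψ k (suc n) = ∑ (allFin M) (λ j → threshold k j * (lookup xs j * Φ j n))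

    private
      at-0 : ∀ (G : Vec ℕ M → ℤ) → G (Vec.replicate M 0) ≡ 1ℤ → ∑ (comps M 0) (λ c → mono xs c * G c) ≡ 1ℤ
      at-0 G e = trans (∑-comps-0 M _) (trans (cong₂ _*_ (mono-0 xs) e) (*-identityˡ _))

      sum-replicate : ∀ M → Vec.sum (Vec.replicate M 0) ≡ 0
      sum-replicate zero = refl
      sum-replicate (suc M) = sum-replicate M

      F-Ψ : F ≗ Ψ 0
      F-Ψ zero = at-0 _ (trans (cong (λ ℓs → Co ℓs (Vec.replicate M 0)) (bag-zero (Vec.replicate M 0) (λ _ → refl)
          (sum-replicate M))) (cong ⟦_⟧ (allZero-0 M)))
      F-Ψ (suc n) = trans (∑-cong-All (comps-sum M (suc n)) (λ {c} s → cong (mono xs c *_) (start n c s)))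
          (∑-mono-dec xs n (λ _ → g) (φ n))

      Φ-lin : ∀ u → Ψ (toℕ u) ≗ lin (T * lookup xs u) (Φ u)
      Φ-lin u zero = sym (at-0 _ (cong ⟦_⟧ (allZero-0 M)))
      Φ-lin u (suc n) = begin
        ∑ (allFin M) (λ j → L u j * (lookup xs j * Φ j n))
          ≡⟨ eq _ _ ⟩
        ∑ (allFin M) (λ j → L u j * (lookup xs j * Φ j n)) + T * lookup xs u * Φ u n - T * lookup xs u * Φ u n
          ≡⟨ cong (λ z → ∑ (allFin M) (λ j → L u j * (lookup xs j * Φ j n)) + z - T * lookup xs u * Φ u n) diag ⟩
        ∑ (allFin M) (λ j → L u j * (lookup xs j * Φ j n)) + ∑ (allFin M) (λ j → T * δ u j * (lookup xs j
            * Φ j n)) - T * lookup xs u * Φ u n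
          ≡⟨ cong (_- T * lookup xs u * Φ u n) (∑-+ (allFin M) _ _) ⟨
        ∑ (allFin M) (λ j → L u j * (lookup xs j * Φ j n) + T * δ u j * (lookup xs j * Φ j n)) - T * lookup xs u
            * Φ u n
          ≡⟨ cong (_- T * lookup xs u * Φ u n) (∑-cong (allFin M) (λ j → sym (*-distribʳ-+ (lookup xs j * Φ j n)
              (L u j) (T * δ u j)))) ⟩
        ∑ (allFin M) (λ j → L+ u j * (lookup xs j * Φ j n)) - T * lookup xs u * Φ u n
          ≡⟨ cong (_- T * lookup xs u * Φ u n) (∑-mono-dec xs n (L+ u) (φ n)) ⟨
        Φ u (suc n) - T * lookup xs u * Φ u n ∎
        where
        opaque
          unfolding _+_
          eq : ∀ a b → a ≡ a + b - b
          eq = solve-∀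
        diag : T * lookup xs u * Φ u n ≡ ∑ (allFin M) (λ j → T * δ u j * (lookup xs j * Φ j n))
        diag = begin
          T * lookup xs u * Φ u n ≡⟨ *-assoc _ _ _ ⟩
          T * (lookup xs u * Φ u n) ≡⟨ cong (T *_) (∑-δ u (λ j → lookup xs j * Φ j n)) ⟨
          T * ∑ (allFin M) (λ j → δ u j * (lookup xs j * Φ j n)) ≡⟨ ∑-*ˡ T (allFin M) _ ⟨
          ∑ (allFin M) (λ j → T * (δ u j * (lookup xs j * Φ j n))) ≡⟨ ∑-cong (allFin M) (λ j → *-assoc _ _ _) ⟨
          ∑ (allFin M) (λ j → T * δ u j * (lookup xs j * Φ j n)) ∎

      Ψ-last : ∀ n → Ψ M n ≡ (1ℤ - t) * one n + t * F n
      Ψ-last zero = trans (eq t) (cong (λ z → (1ℤ - t) * 1ℤ + t * z) (sym (F-Ψ 0)))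
        where opaque
          unfolding _+_
          eq : ∀ t → 1ℤ ≡ (1ℤ - t) * 1ℤ + t * 1ℤ
          eq = solve-∀
      Ψ-last (suc n) = begin
        ∑ (allFin M) (λ j → threshold M j * (lookup xs j * Φ j n))
          ≡⟨ ∑-cong (allFin M) (λ j → trans (cong (_* (lookup xs j * Φ j n)) (below j)) (*-assoc _ _ _)) ⟩
        ∑ (allFin M) (λ j → t * (g * (lookup xs j * Φ j n))) ≡⟨ ∑-*ˡ t (allFin M) _ ⟩
        t * Ψ 0 (suc n) ≡⟨ cong (t *_) (F-Ψ (suc n)) ⟨
        t * F (suc n) ≡⟨ eq t _ ⟩
        (1ℤ - t) * 0ℤ + t * F (suc n) ∎
        where
        opaque
          unfolding _+_
          eq : ∀ t f → t * f ≡ (1ℤ - t) * 0ℤ + t * f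
          eq = solve-∀
        below : ∀ (j : Fin M) → threshold M j ≡ t * g
        below j rewrite <ᵇ-true (Fin.toℕ<n j) = refl

    module _ (g-T : (1ℤ - t) * g ≡ 1ℤ - T) where

      private
        -- Moving the threshold past u only changes the weight of the letter u, from g to t g. By
        -- hypothesis this is a change by T - 1, which turns the coefficient T of `Φ-lin` into 1.
        Φ-lin′ : ∀ u → Ψ (suc (toℕ u)) ≗ lin (1ℤ * lookup xs u) (Φ u)
        Φ-lin′ u zero = sym (at-0 _ (cong ⟦_⟧ (allZero-0 M)))
        Φ-lin′ u (suc n) = begin
          ∑ (allFin M) (λ j → threshold (suc (toℕ u)) j * (lookup xs j * Φ j n))
            ≡⟨ ∑-cong (allFin M) (λ j → trans (cong (_* (lookup xs j * Φ j n)) (raise j)) (trans (*-distribʳ-+ _ _ _)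
                (cong (L u j * (lookup xs j * Φ j n) +_) (*-assoc _ _ _)))) ⟩
          ∑ (allFin M) (λ j → L u j * (lookup xs j * Φ j n) + (T - 1ℤ) * (δ u j * (lookup xs j * Φ j n)))
            ≡⟨ trans (∑-+ (allFin M) _ _) (cong (∑ (allFin M) (λ j → L u j * (lookup xs j * Φ j n)) +_) (trans (∑-*ˡ
                (T - 1ℤ) (allFin M) _) (cong ((T - 1ℤ) *_) (∑-δ u (λ j → lookup xs j * Φ j n))))) ⟩
          Ψ (toℕ u) (suc n) + (T - 1ℤ) * (lookup xs u * Φ u n)
              ≡⟨ cong (_+ (T - 1ℤ) * (lookup xs u * Φ u n)) (Φ-lin u (suc n)) ⟩
          (Φ u (suc n) - T * lookup xs u * Φ u n) + (T - 1ℤ) * (lookup xs u * Φ u n)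
              ≡⟨ eq (Φ u (suc n)) T (lookup xs u) (Φ u n) ⟩
          Φ u (suc n) - 1ℤ * lookup xs u * Φ u n ∎
          where
          opaque
            unfolding _+_
            eq : ∀ a T x b → (a - T * x * b) + (T - 1ℤ) * (x * b) ≡ a - 1ℤ * x * b
            eq = solve-∀
            eq₁ : ∀ t g → t * g ≡ g - (1ℤ - t) * g
            eq₁ = solve-∀
            eq₂ : ∀ g T → g - (1ℤ - T) ≡ g + (T - 1ℤ) * 1ℤ
            eq₂ = solve-∀
          same : ∀ (j : Fin M) → toℕ j ≢ toℕ u → (toℕ j <ᵇ suc (toℕ u)) ≡ (toℕ j <ᵇ toℕ u)
          same j ne with toℕ j <ᵇ toℕ u in e₁ | toℕ j <ᵇ suc (toℕ u) in e₂
          ... | true | true = refl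
          ... | false | false = refl
          ... | true | false = contradiction (ℕ.m<n⇒m<1+n (ℕ.<ᵇ⇒< (toℕ j) (toℕ u) (subst Bool.T (sym e₁) _))) (λ p
              → subst Bool.T e₂ (ℕ.<⇒<ᵇ p))
          ... | false | true = contradiction (ℕ.≤∧≢⇒< (ℕ.≤-pred (ℕ.<ᵇ⇒< (toℕ j) (suc (toℕ u)) (subst Bool.T
              (sym e₂) _))) ne) (λ p → subst Bool.T e₁ (ℕ.<⇒<ᵇ p))
          raise : ∀ (j : Fin M) → threshold (suc (toℕ u)) j ≡ L u j + (T - 1ℤ) * δ u j
          raise j with u Fin.≟ j
          ... | yes refl rewrite threshold-≥ (toℕ u) u ℕ.≤-refl | <ᵇ-true (ℕ.n<1+n (toℕ u)) = trans (eq₁ t g) (trans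
              (cong (λ z → g - z) g-T) (eq₂ g T))
          raise j | no ne rewrite same j (λ e → ne (sym (Fin.toℕ-injective e))) = sym (trans (cong (L u j +_)
              (*-zeroʳ _)) (+-identityʳ _))

      F⊛E : F ⊛ E xs 1ℤ ≗ (λ n → (1ℤ - t) * one n + t * F n) ⊛ E xs T
      F⊛E n = begin
        (F ⊛ E xs 1ℤ) n ≡⟨ ⊛-cong F-Ψ (λ _ → refl) n ⟩
        (Ψ 0 ⊛ E xs 1ℤ) n
            ≡⟨ lin-chain T xs Ψ (λ u k → trans (lin-cong _ (Φ-lin u) k) (trans (lin-comm _ _ (Φ u) k) (sym (lin-cong _
            (Φ-lin′ u) k)))) n ⟩
        (Ψ M ⊛ E xs T) n ≡⟨ ⊛-cong Ψ-last (λ _ → refl) n ⟩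
        ((λ n → (1ℤ - t) * one n + t * F n) ⊛ E xs T) n ∎

-- Colored permutations by insertion

∑-filterᵇ : (p : A → Bool) (xs : List A) (f : A → ℤ) → ∑ (filterᵇ p xs) f ≡ ∑ xs (λ x → ⟦ p x ⟧ * f x)
∑-filterᵇ p [] f = refl
∑-filterᵇ p (x ∷ xs) f with p x
... | true = cong₂ _+_ (sym (*-identityˡ _)) (∑-filterᵇ p xs f)
... | false = trans (∑-filterᵇ p xs f) (sym (trans (cong (_+ ∑ xs (λ x → ⟦ p x ⟧ * f x)) (*-zeroˡ _))
    (+-identityˡ _)))

⟦∧⟧ : ∀ a b → ⟦ a ∧ b ⟧ ≡ ⟦ a ⟧ * ⟦ b ⟧
⟦∧⟧ true b = sym (*-identityˡ _)
⟦∧⟧ false b = sym (*-zeroˡ _)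

values : List Letter → List ℕ
values = map proj₁

insertions : ℕ → ℕ → List Letter → List (List Letter)
insertions l x π = concatMap (λ (α , γ) → map (λ e → α ++ (x , e) ∷ γ) (upTo l)) (cuts π)

-- In use the list of values is increasing, so each inserted letter has the smallest value so far.
-- Its effect on inversions, sortedness and hooks can then be read off from its position and color.
perms : ℕ → List ℕ → List (List Letter)
perms l [] = [] ∷ []
perms l (x ∷ R) = concatMap (insertions l x) (perms l R)

module _ (l : ℕ) where

  ins : ℕ → (List Letter → ℤ) → List Letter → ℤ
  ins x F π = ∑ (cuts π) (λ (α , γ) → ∑ (upTo l) (λ e → F (α ++ (x , e) ∷ γ)))

  ∑-perms : ∀ x R F → ∑ (perms l (x ∷ R)) F ≡ ∑ (perms l R) (ins x F)
  ∑-perms x R F = trans (∑-concatMap (insertions l x) (perms l R) F)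
    (∑-cong (perms l R) (λ π → trans (∑-concatMap _ (cuts π) F) (∑-cong (cuts π) (λ (α , γ) → ∑-map _ (upTo l) F))))

  perms-↭ : ∀ R → All (λ π → (values π) ↭ R) (perms l R)
  perms-↭ [] = ↭-refl ∷ []
  perms-↭ (x ∷ R) = All.concat⁺ (All.map⁺ (All.map (λ {π} p →
    All.concat⁺ (All.map⁺ (All.map (λ {(α , γ)} e →
      All.map⁺ (All.universal (λ c → ↭-trans (insert α γ c) (prep x (subst (λ z → (values z) ↭ R) (sym e) p)))
          (upTo l))) (cuts-++ π)))) (perms-↭ R)))
    where
    insert : ∀ α γ c → (values (α ++ (x , c) ∷ γ)) ↭ x ∷ (values (α ++ γ))
    insert [] γ c = ↭-refl
    insert ((y , _) ∷ α) γ c = ↭-trans (prep y (insert α γ c)) (swap y x ↭-refl)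

  perms-length : ∀ R → All (λ π → length π ≡ length R) (perms l R)
  perms-length R = All.map (λ {π} p → trans (sym (List.length-map proj₁ π)) (Perm.↭-length p)) (perms-↭ R)

  perms-All : ∀ {P : ℕ → Set} {R} → All P R → All (λ π → All P (values π)) (perms l R)
  perms-All ps = All.map (λ p → Perm.All-resp-↭ (↭-sym p) ps) (perms-↭ _)

  ins-cong : ∀ x F G π → (∀ α γ e → α ++ γ ≡ π → F (α ++ (x , e) ∷ γ) ≡ G (α ++ (x , e) ∷ γ)) → ins x F π ≡ ins x G π
  ins-cong x F G π e = ∑-cong-All (cuts-++ π) (λ {(α , γ)} eq → ∑-cong (upTo l) (λ c → e α γ c eq))

  ins-*ˡ : ∀ x a F π → ins x (λ w → a * F w) π ≡ a * ins x F π
  ins-*ˡ x a F π = trans (∑-cong (cuts π) (λ (α , γ) → ∑-*ˡ a (upTo l) (λ e → F (α ++ (x , e) ∷ γ)))) (∑-*ˡ a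
      (cuts π) _)

  picks : List A → List (A × List A)
  picks [] = []
  picks (x ∷ R) = (x , R) ∷ map (λ (y , R′) → (y , x ∷ R′)) (picks R)

  private
    after-head : ℕ → (List Letter → ℤ) → List Letter → ℤ
    after-head x F [] = 0ℤ
    after-head x F (y ∷ π) = ins x (F ∘ (y ∷_)) π

    ins-head : ∀ x F π → ins x F π ≡ ∑ (upTo l) (λ e → F ((x , e) ∷ π)) + after-head x F π
    ins-head x F [] = refl
    ins-head x F (y ∷ π) = ∑-cuts y π (λ (α , γ) → ∑ (upTo l) (λ e → F (α ++ (x , e) ∷ γ)))

    firstLetter : List ℕ → (List Letter → ℤ) → ℤ
    firstLetter R F = ∑ (picks R) (λ (y , R′) → ∑ (upTo l) (λ e → ∑ (perms l R′) (λ π → F ((y , e) ∷ π))))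

    -- Regroups the permutations by their first letter, because words are enumerated from the left.
    -- The empty permutation has no first letter, hence the condition on `F []`.
    ∑-perms-head : ∀ R F → F [] ≡ 0ℤ → ∑ (perms l R) F ≡ firstLetter R F

    ∑-perms-∷ : ∀ x R F → ∑ (perms l (x ∷ R)) F ≡ firstLetter (x ∷ R) F
    ∑-perms-∷ x R F = begin
      ∑ (perms l (x ∷ R)) F ≡⟨ ∑-perms x R F ⟩
      ∑ (perms l R) (ins x F) ≡⟨ ∑-cong (perms l R) (ins-head x F) ⟩
      ∑ (perms l R) (λ π → ∑ (upTo l) (λ e → F ((x , e) ∷ π)) + after-head x F π) ≡⟨ ∑-+ (perms l R) _ _ ⟩
      ∑ (perms l R) (λ π → ∑ (upTo l) (λ e → F ((x , e) ∷ π))) + ∑ (perms l R) (after-head x F)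
        ≡⟨ cong₂ _+_ (∑-swap (perms l R) (upTo l) _) (∑-perms-head R (after-head x F) refl) ⟩
      ∑ (upTo l) (λ e → ∑ (perms l R) (λ π → F ((x , e) ∷ π))) + firstLetter R (after-head x F)
        ≡⟨ cong (∑ (upTo l) (λ e → ∑ (perms l R) (λ π → F ((x , e) ∷ π))) +_) (∑-cong (picks R) (λ (y , R′) → ∑-cong
            (upTo l) (λ e → ∑-perms x R′ (λ π → F ((y , e) ∷ π))))) ⟨
      ∑ (upTo l) (λ e → ∑ (perms l R) (λ π → F ((x , e) ∷ π))) + ∑ (picks R) (λ (y , R′) → ∑ (upTo l) (λ e → ∑
          (perms l (x ∷ R′)) (λ π → F ((y , e) ∷ π))))
        ≡⟨ cong (∑ (upTo l) (λ e → ∑ (perms l R) (λ π → F ((x , e) ∷ π))) +_) (∑-map (λ (y , R′) → (y , x ∷ R′))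
            (picks R) _) ⟨
      firstLetter (x ∷ R) F ∎

    ∑-perms-head [] F e = trans (+-identityʳ _) e
    ∑-perms-head (x ∷ R) F e = ∑-perms-∷ x R F

  lettersOver : List ℕ → List Letter
  lettersOver V = concatMap (λ a → map (λ e → (a , e)) (upTo l)) V

  wordsOver : List ℕ → ℕ → List (List Letter)
  wordsOver V zero = [] ∷ []
  wordsOver V (suc k) = concatMap (λ x → map (x ∷_) (wordsOver V k)) (lettersOver V)

  words≡wordsOver : ∀ n k → words l n k ≡ wordsOver (map suc (upTo n)) k
  words≡wordsOver n zero = refl
  words≡wordsOver n (suc k) = cong (λ W → concatMap (λ x → map (x ∷_) W) (letters l n)) (words≡wordsOver n k)

  ∑-wordsOver : ∀ V k F → ∑ (wordsOver V (suc k)) F ≡ ∑ V (λ a → ∑ (upTo l) (λ e → ∑ (wordsOver V k) (λ w → F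
      ((a , e) ∷ w))))
  ∑-wordsOver V k F = begin
    ∑ (wordsOver V (suc k)) F ≡⟨ ∑-concatMap _ (lettersOver V) F ⟩
    ∑ (lettersOver V) (λ x → ∑ (map (x ∷_) (wordsOver V k)) F)
        ≡⟨ ∑-cong (lettersOver V) (λ x → ∑-map (x ∷_) (wordsOver V k) F) ⟩
    ∑ (lettersOver V) (λ x → ∑ (wordsOver V k) (λ w → F (x ∷ w))) ≡⟨ ∑-concatMap _ V _ ⟩
    ∑ V (λ a → ∑ (map (λ e → (a , e)) (upTo l)) (λ x → ∑ (wordsOver V k) (λ w → F (x ∷ w))))
        ≡⟨ ∑-cong V (λ a → ∑-map (λ e → (a , e)) (upTo l) _) ⟩
    ∑ V (λ a → ∑ (upTo l) (λ e → ∑ (wordsOver V k) (λ w → F ((a , e) ∷ w)))) ∎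

  private
    -- Stated through sums instead of lists, so that it applies directly to the sum over the next
    -- letter of a word.
    Removes : List ℕ → ℕ × List ℕ → Set
    Removes V (x , V′) = ∀ (f : ℕ → ℤ) → ∑ V (λ y → ⟦ not (x ≡ᵇ y) ⟧ * f y) ≡ ∑ V′ f

    picks-removes : ∀ {V} → Sorted V → All (Removes V) (picks V)
    picks-removes [] = []
    picks-removes {x ∷ R} (x< ∷ s) = head ∷ All.map⁺ (All.map (λ {p} → tail p) (All.zip
        (picks-removes s , picked x<)))
      where
      picked : ∀ {P : ℕ → Set} {R} → All P R → All (λ (y , _) → P y) (picks R)
      picked [] = []
      picked (p ∷ ps) = p ∷ All.map⁺ (picked ps)
      head : Removes (x ∷ R) (x , R)
      head f rewrite ≡ᵇ-refl x = trans (cong₂ _+_ (*-zeroˡ _) (∑-cong-All x< (λ {y} p →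
        trans (cong (λ b → ⟦ not b ⟧ * f y) (≡ᵇ-false (ℕ.<⇒≢ p))) (*-identityˡ _)))) (+-identityˡ _)
      tail : ∀ p → Removes R p × x < proj₁ p → Removes (x ∷ R) (proj₁ p , x ∷ proj₂ p)
      tail (y , R′) (r , p) f rewrite ≡ᵇ-false (ℕ.>⇒≢ p) = cong₂ _+_ (*-identityˡ _) (r f)

    picks-sorted : ∀ {V} → Sorted V → All (λ (_ , V′) → Sorted V′ × suc (length V′) ≡ length V) (picks V)
    picks-sorted [] = []
    picks-sorted {x ∷ R} (x< ∷ s) = (s , refl) ∷ All.map⁺ (All.map (λ ((a , b) , c) → (c ∷ a) , cong suc b) (All.zip
        (picks-sorted s , rest x<)))
      where
      rest : ∀ {P : ℕ → Set} {R} → All P R → All (λ (_ , R′) → All P R′) (picks R)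
      rest [] = []
      rest (p ∷ ps) = ps ∷ All.map⁺ (All.map (p ∷_) (rest ps))

    avoid : ∀ {V x V′} → Removes V (x , V′) → ∀ k (F : List Letter → ℤ) →
      ∑ (wordsOver V k) (λ w → ⟦ not (elemᵇ x (values w)) ⟧ * F w) ≡ ∑ (wordsOver V′ k) F
    avoid r zero F = cong (_+ 0ℤ) (*-identityˡ _)
    avoid {V} {x} {V′} r (suc k) F = begin
      ∑ (wordsOver V (suc k)) (λ w → ⟦ not (elemᵇ x (values w)) ⟧ * F w) ≡⟨ ∑-wordsOver V k _ ⟩
      ∑ V (λ a → ∑ (upTo l) (λ e → ∑ (wordsOver V k) (λ w → ⟦ not ((x ≡ᵇ a) ∨ elemᵇ x (values w)) ⟧ * F
          ((a , e) ∷ w))))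
        ≡⟨ ∑-cong V (λ a → trans (∑-cong (upTo l) (λ e → trans (∑-cong (wordsOver V k) (λ w → factor (x ≡ᵇ a) (elemᵇ x
            (values w)) _)) (∑-*ˡ _ (wordsOver V k) _))) (∑-*ˡ _ (upTo l) _)) ⟩
      ∑ V (λ a → ⟦ not (x ≡ᵇ a) ⟧ * ∑ (upTo l) (λ e → ∑ (wordsOver V k) (λ w → ⟦ not (elemᵇ x (values w)) ⟧ * F
          ((a , e) ∷ w))))
        ≡⟨ r _ ⟩
      ∑ V′ (λ a → ∑ (upTo l) (λ e → ∑ (wordsOver V k) (λ w → ⟦ not (elemᵇ x (values w)) ⟧ * F ((a , e) ∷ w))))
        ≡⟨ ∑-cong V′ (λ a → ∑-cong (upTo l) (λ e → avoid {V} {x} {V′} r k _)) ⟩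
      ∑ V′ (λ a → ∑ (upTo l) (λ e → ∑ (wordsOver V′ k) (λ w → F ((a , e) ∷ w)))) ≡⟨ ∑-wordsOver V′ k F ⟨
      ∑ (wordsOver V′ (suc k)) F ∎
      where
      factor : ∀ a b z → ⟦ not (a ∨ b) ⟧ * z ≡ ⟦ not a ⟧ * (⟦ not b ⟧ * z)
      factor true b z = trans (*-zeroˡ _) (sym (*-zeroˡ _))
      factor false b z = sym (*-identityˡ _)

  -- Joins the enumeration by filtering words with the enumeration by insertion: after the first
  -- letter, words with distinct values are words over the remaining values (`avoid`).
  ∑-distinct : ∀ k {V} → Sorted V → length V ≡ k → ∀ F →
    ∑ (wordsOver V k) (λ w → ⟦ distinct (values w) ⟧ * F w) ≡ ∑ (perms l V) F
  ∑-distinct zero {[]} s e F = cong (_+ 0ℤ) (*-identityˡ _)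
  ∑-distinct (suc k) {V@(x ∷ R)} s e F = begin
    ∑ (wordsOver V (suc k)) (λ w → ⟦ distinct (values w) ⟧ * F w) ≡⟨ ∑-wordsOver V k _ ⟩
    ∑ V (λ a → ∑ (upTo l) (λ c → ∑ (wordsOver V k) (λ w → ⟦ not (elemᵇ a (values w)) ∧ distinct (values w) ⟧ * F
        ((a , c) ∷ w))))
      ≡⟨ ∑-cong V (λ a → ∑-cong (upTo l) (λ c → ∑-cong (wordsOver V k) (λ w → trans (cong (_* F ((a , c) ∷ w)) (⟦∧⟧
          (not (elemᵇ a (values w))) _)) (*-assoc _ _ _)))) ⟩
    ∑ V g ≡⟨ trans (cong (λ xs → ∑ xs g) (sym (picks-fst V))) (∑-map proj₁ (picks V) g) ⟩
    ∑ (picks V) (λ (a , V′) → g a)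
      ≡⟨ ∑-cong-All (All.zip (picks-removes s , picks-sorted s)) (λ {(a , V′)} (r , s′ , e′) → ∑-cong (upTo l) (λ c →
          trans (avoid {V} {a} {V′} r k _) (∑-distinct k s′ (ℕ.suc-injective (trans e′ e)) _))) ⟩
    firstLetter V F ≡⟨ ∑-perms-∷ x R F ⟨
    ∑ (perms l V) F ∎
    where
    g : ℕ → ℤ
    g a = ∑ (upTo l) (λ c → ∑ (wordsOver V k) (λ w → ⟦ not (elemᵇ a (values w)) ⟧ * (⟦ distinct (values w) ⟧ * F
        ((a , c) ∷ w))))
    picks-fst : ∀ (R : List ℕ) → map proj₁ (picks R) ≡ R
    picks-fst [] = refl
    picks-fst (x ∷ R) = cong (x ∷_) (trans (sym (List.map-∘ (picks R))) (picks-fst R))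

  private
    cuts-++-∷ : ∀ (α : List A) z γ (f : List A → List A → ℤ) →
      ∑ (cuts (α ++ z ∷ γ)) (λ (u , v) → f u v)
      ≡ ∑ (cuts α) (λ (a , b) → f a (b ++ z ∷ γ)) + ∑ (cuts γ) (λ (c , d) → f (α ++ z ∷ c) d)
    cuts-++-∷ [] z γ f = trans (∑-cuts z γ (λ (u , v) → f u v)) (cong₂ _+_ (sym (+-identityʳ _)) refl)
    cuts-++-∷ (x ∷ α) z γ f = begin
      ∑ (cuts (x ∷ α ++ z ∷ γ)) (λ (u , v) → f u v) ≡⟨ ∑-cuts x (α ++ z ∷ γ) (λ (u , v) → f u v) ⟩
      f [] (x ∷ α ++ z ∷ γ) + ∑ (cuts (α ++ z ∷ γ)) (λ (u , v) → f (x ∷ u) v)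
          ≡⟨ cong (f [] (x ∷ α ++ z ∷ γ) +_) (cuts-++-∷ α z γ (f ∘ (x ∷_))) ⟩
      f [] (x ∷ α ++ z ∷ γ) + (∑ (cuts α) (λ (a , b) → f (x ∷ a) (b ++ z ∷ γ)) + ∑ (cuts γ) (λ (c , d) → f
          (x ∷ α ++ z ∷ c) d)) ≡⟨ +-assoc _ _ _ ⟨
      f [] (x ∷ α ++ z ∷ γ) + ∑ (cuts α) (λ (a , b) → f (x ∷ a) (b ++ z ∷ γ)) + ∑ (cuts γ) (λ (c , d) → f
          (x ∷ α ++ z ∷ c) d)
        ≡⟨ cong₂ _+_ (∑-cuts x α (λ (a , b) → f a (b ++ z ∷ γ))) refl ⟨
      ∑ (cuts (x ∷ α)) (λ (a , b) → f a (b ++ z ∷ γ)) + ∑ (cuts γ) (λ (c , d) → f (x ∷ α ++ z ∷ c) d) ∎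

    ins-cuts : ∀ x π (f : List Letter → List Letter → ℤ) →
      ins x (λ w → ∑ (cuts w) (λ (u , v) → f u v)) π
      ≡ ∑ (cuts π) (λ (u , v) → ins x (λ u′ → f u′ v) u) + ∑ (cuts π) (λ (u , v) → ins x (f u) v)
    ins-cuts x π f = begin
      ∑ (cuts π) (λ (α , γ) → ∑ (upTo l) (λ e → ∑ (cuts (α ++ (x , e) ∷ γ)) (λ (u , v) → f u v)))
        ≡⟨ ∑-cong (cuts π) (λ (α , γ) → trans (∑-cong (upTo l) (λ e → cuts-++-∷ α (x , e) γ f)) (∑-+ (upTo l) _ _)) ⟩
      ∑ (cuts π) (λ (α , γ) → ∑ (upTo l) (λ e → ∑ (cuts α) (λ (a , b) → f a (b ++ (x , e) ∷ γ))) + ∑ (upTo l) (λ e → ∑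
          (cuts γ) (λ (c , d) → f (α ++ (x , e) ∷ c) d)))
        ≡⟨ ∑-+ (cuts π) _ _ ⟩
      ∑ (cuts π) (λ (α , γ) → ∑ (upTo l) (λ e → ∑ (cuts α) (λ (a , b) → f a (b ++ (x , e) ∷ γ)))) + ∑ (cuts π) (λ
          (α , γ) → ∑ (upTo l) (λ e → ∑ (cuts γ) (λ (c , d) → f (α ++ (x , e) ∷ c) d)))
        ≡⟨ cong₂ _+_ (trans (∑-cong (cuts π) (λ (α , γ) → ∑-swap (upTo l) (cuts α) _)) (∑-cuts-assoc π (λ a b γ → ∑
            (upTo l) (λ e → f a (b ++ (x , e) ∷ γ)))))
             (trans (∑-cong (cuts π) (λ (α , γ) → ∑-swap (upTo l) (cuts γ) _)) (sym (∑-cuts-assoc π (λ α c d → ∑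
                 (upTo l) (λ e → f (α ++ (x , e) ∷ c) d))))) ⟩
      ∑ (cuts π) (λ (u , v) → ins x (f u) v) + ∑ (cuts π) (λ (u , v) → ins x (λ u′ → f u′ v) u) ≡⟨ +-comm _ _ ⟩
      ∑ (cuts π) (λ (u , v) → ins x (λ u′ → f u′ v) u) + ∑ (cuts π) (λ (u , v) → ins x (f u) v) ∎

    cross-insertˡ : ∀ {x} α {e} γ {v} → All (x <_) v → cross (values (α ++ (x , e) ∷ γ)) v ≡ cross (values (α ++ γ)) v
    cross-insertˡ [] γ p = cross-∷ˡ (values γ) p
    cross-insertˡ ((y , _) ∷ α) {e} γ {v} p = cong (length (filterᵇ (_<ᵇ y) v) ℕ.+_) (cross-insertˡ α {e} γ p)

    filterᵇ-insert : ∀ {x y} α {e} γ → x < y → length (filterᵇ (_<ᵇ y) (values (α ++ (x , e) ∷ γ))) ≡ suc (length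
        (filterᵇ (_<ᵇ y) (values (α ++ γ))))
    filterᵇ-insert [] γ p rewrite <ᵇ-true p = refl
    filterᵇ-insert {y = y} ((z , _) ∷ α) {e} γ p with z <ᵇ y
    ... | true = cong suc (filterᵇ-insert α {e} γ p)
    ... | false = filterᵇ-insert α {e} γ p

    cross-insertʳ : ∀ {x u} α {e} γ → All (x <_) u → cross u (values (α ++ (x , e) ∷ γ)) ≡ length u ℕ.+ cross u
        (values (α ++ γ))
    cross-insertʳ α γ [] = refl
    cross-insertʳ {u = b ∷ u} α {e} γ (p ∷ ps) rewrite filterᵇ-insert α {e} γ p | cross-insertʳ α {e} γ ps = cong suc
        (trans (sym (ℕ.+-assoc k _ _)) (trans (cong (ℕ._+ cross u (values (α ++ γ))) (ℕ.+-comm k (length u)))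
        (ℕ.+-assoc (length u) _ _)))
      where k = length (filterᵇ (_<ᵇ b) (values (α ++ γ)))

  -- A permutation with a cut amounts to a split of the values and a permutation of each part, and
  -- the inversions across the cut depend only on the split. Inductively, the new smallest value
  -- causes no crossing in the left part and one with every letter to its left part when it is put
  -- into the right part, on both sides of the equation.
  ∑-perms-cuts : ∀ q {R} → Sorted R → (f : List Letter → List Letter → ℤ) →
    ∑ (perms l R) (λ π → ∑ (cuts π) (λ (u , v) → q ^ cross (values u) (values v) * f u v))
    ≡ ∑ (splits R) (λ (U , V) → q ^ cross U V * ∑ (perms l U) (λ u → ∑ (perms l V) (λ v → f u v)))
  ∑-perms-cuts q [] f = cong (_+ 0ℤ) (trans (+-identityʳ _) (cong (1ℤ *_) (sym (trans (+-identityʳ _)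
      (+-identityʳ _)))))
  ∑-perms-cuts q {x ∷ R} (x< ∷ s) f = begin
    ∑ (perms l (x ∷ R)) (λ π → ∑ (cuts π) (λ (u , v) → q ^ cross (values u) (values v) * f u v)) ≡⟨ ∑-perms x R _ ⟩
    ∑ (perms l R) (ins x (λ π → ∑ (cuts π) (λ (u , v) → q ^ cross (values u) (values v) * f u v)))
      ≡⟨ ∑-cong-All (perms-All x<) (λ {π} p → trans (ins-cuts x π _) (trans (sym (∑-+ (cuts π) _ _)) (∑-cong-All
          (cuts-++ π) (λ {(u , v)} e →
           pointwise u v (All.++⁻ (values u) (subst (All (x <_)) (trans (cong values (sym e))
               (List.map-++ proj₁ u v)) p)))))) ⟩
    ∑ (perms l R) (λ π → ∑ (cuts π) (λ (u , v) → q ^ cross (values u) (values v) * f′ u v)) ≡⟨ ∑-perms-cuts q s f′ ⟩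
    ∑ (splits R) (λ (U , V) → q ^ cross U V * ∑ (perms l U) (λ u → ∑ (perms l V) (λ v → f′ u v)))
      ≡⟨ ∑-cong-All (splits-All x<) (λ {(U , V)} (p , p′) → trans (unfold U V) (cong₂ _+_ (cong (λ k → q ^ k * ∑
          (perms l (x ∷ U)) (λ u → ∑ (perms l V) (f u))) (sym (cross-∷ˡ U p′)))
           (cong (λ k → q ^ k * ∑ (perms l U) (λ u → ∑ (perms l (x ∷ V)) (f u))) (sym (cross-∷ʳ V p))))) ⟩
    ∑ (splits R) (λ (U , V) → q ^ cross (x ∷ U) V * ∑ (perms l (x ∷ U)) (λ u → ∑ (perms l V) (λ v → f u v))
        + q ^ cross U (x ∷ V) * ∑ (perms l U) (λ u → ∑ (perms l (x ∷ V)) (λ v → f u v)))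
      ≡⟨ ∑-+ (splits R) _ _ ⟩
    ∑ (splits R) (λ (U , V) → q ^ cross (x ∷ U) V * ∑ (perms l (x ∷ U)) (λ u → ∑ (perms l V) (λ v → f u v))) + ∑
        (splits R) (λ (U , V) → q ^ cross U (x ∷ V) * ∑ (perms l U) (λ u → ∑ (perms l (x ∷ V)) (λ v → f u v)))
      ≡⟨ ∑-splits x R _ ⟨
    ∑ (splits (x ∷ R)) (λ (U , V) → q ^ cross U V * ∑ (perms l U) (λ u → ∑ (perms l V) (λ v → f u v))) ∎
    where
    f′ : List Letter → List Letter → ℤ
    f′ u v = ins x (λ u′ → f u′ v) u + q ^ length u * ins x (f u) v
    opaque
      unfolding _+_
      eq : ∀ c k a b → c * a + k * c * b ≡ c * (a + k * b)
      eq = solve-∀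
    pointwise : ∀ u v → All (x <_) (values u) × All (x <_) (values v) →
      ins x (λ u′ → q ^ cross (values u′) (values v) * f u′ v) u + ins x (λ v′ → q ^ cross (values u) (values v′)
          * f u v′) v ≡ q ^ cross (values u) (values v) * f′ u v
    pointwise u v (p , p′) = begin
      ins x (λ u′ → q ^ cross (values u′) (values v) * f u′ v) u + ins x (λ v′ → q ^ cross (values u) (values v′)
          * f u v′) v
        ≡⟨ cong₂ _+_ (trans (ins-cong x (λ u′ → q ^ cross (values u′) (values v) * f u′ v) (λ u′ → q ^ cross
            (values u) (values v) * f u′ v) u (λ α γ e eq′ → cong (λ k → q ^ k * f (α ++ (x , e) ∷ γ) v) (trans
            (cross-insertˡ α {e} γ p′) (cong (λ z → cross (values z) (values v)) eq′)))) (ins-*ˡ x _ (λ u′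
            → f u′ v) u))
             (trans (ins-cong x (λ v′ → q ^ cross (values u) (values v′) * f u v′) (λ v′ → q ^ length u * q ^ cross
                 (values u) (values v) * f u v′) v (λ α γ e eq′ → cong (λ k → k * f u (α ++ (x , e) ∷ γ)) (trans (cong
                 (q ^_) (trans (cross-insertʳ α {e} γ p) (cong₂ ℕ._+_ (List.length-map proj₁ u) (cong (λ z → cross
                 (values u) (values z)) eq′)))) (^-+ q (length u) _)))) (ins-*ˡ x _ (f u) v)) ⟩
      q ^ cross (values u) (values v) * ins x (λ u′ → f u′ v) u + q ^ length u * q ^ cross (values u) (values v)
          * ins x (f u) v
        ≡⟨ eq _ _ _ _ ⟩
      q ^ cross (values u) (values v) * f′ u v ∎
    unfold : ∀ U V → q ^ cross U V * ∑ (perms l U) (λ u → ∑ (perms l V) (λ v → f′ u v))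
      ≡ q ^ cross U V * ∑ (perms l (x ∷ U)) (λ u → ∑ (perms l V) (λ v → f u v)) + q ^ (length U ℕ.+ cross U V) * ∑
          (perms l U) (λ u → ∑ (perms l (x ∷ V)) (λ v → f u v))
    unfold U V = begin
      q ^ cross U V * ∑ (perms l U) (λ u → ∑ (perms l V) (λ v → f′ u v))
        ≡⟨ cong (q ^ cross U V *_) (trans (∑-cong (perms l U) (λ u → ∑-+ (perms l V) _ _)) (trans (∑-+
            (perms l U) _ _) (cong₂ _+_ left right))) ⟩
      q ^ cross U V * (∑ (perms l (x ∷ U)) (λ u → ∑ (perms l V) (λ v → f u v)) + q ^ length U * ∑ (perms l U) (λ u → ∑
          (perms l (x ∷ V)) (λ v → f u v)))
        ≡⟨ eq _ _ _ _ ⟨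
      q ^ cross U V * ∑ (perms l (x ∷ U)) (λ u → ∑ (perms l V) (λ v → f u v)) + q ^ length U * q ^ cross U V * ∑
          (perms l U) (λ u → ∑ (perms l (x ∷ V)) (λ v → f u v))
        ≡⟨ cong (λ k → q ^ cross U V * ∑ (perms l (x ∷ U)) (λ u → ∑ (perms l V) (λ v → f u v)) + k * ∑ (perms l U)
            (λ u → ∑ (perms l (x ∷ V)) (λ v → f u v))) (^-+ q (length U) (cross U V)) ⟨
      q ^ cross U V * ∑ (perms l (x ∷ U)) (λ u → ∑ (perms l V) (λ v → f u v)) + q ^ (length U ℕ.+ cross U V) * ∑
          (perms l U) (λ u → ∑ (perms l (x ∷ V)) (λ v → f u v)) ∎
      where
      left : ∑ (perms l U) (λ u → ∑ (perms l V) (λ v → ins x (λ u′ → f u′ v) u)) ≡ ∑ (perms l (x ∷ U)) (λ u → ∑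
          (perms l V) (λ v → f u v))
      left = begin
        ∑ (perms l U) (λ u → ∑ (perms l V) (λ v → ins x (λ u′ → f u′ v) u)) ≡⟨ ∑-swap (perms l U) (perms l V) _ ⟩
        ∑ (perms l V) (λ v → ∑ (perms l U) (ins x (λ u′ → f u′ v)))
            ≡⟨ ∑-cong (perms l V) (λ v → sym (∑-perms x U (λ u′ → f u′ v))) ⟩
        ∑ (perms l V) (λ v → ∑ (perms l (x ∷ U)) (λ u → f u v)) ≡⟨ ∑-swap (perms l V) (perms l (x ∷ U)) _ ⟩
        ∑ (perms l (x ∷ U)) (λ u → ∑ (perms l V) (λ v → f u v)) ∎
      right : ∑ (perms l U) (λ u → ∑ (perms l V) (λ v → q ^ length u * ins x (f u) v)) ≡ q ^ length U * ∑ (perms l U)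
          (λ u → ∑ (perms l (x ∷ V)) (λ v → f u v))
      right = begin
        ∑ (perms l U) (λ u → ∑ (perms l V) (λ v → q ^ length u * ins x (f u) v))
          ≡⟨ ∑-cong-All (perms-length U) (λ {u} e → trans (∑-*ˡ _ (perms l V) _) (cong₂ _*_ (cong (q ^_) e) (sym
              (∑-perms x V (f u))))) ⟩
        ∑ (perms l U) (λ u → q ^ length U * ∑ (perms l (x ∷ V)) (f u)) ≡⟨ ∑-*ˡ _ (perms l U) _ ⟩
        q ^ length U * ∑ (perms l U) (λ u → ∑ (perms l (x ∷ V)) (λ v → f u v)) ∎

  ∑-perms-null : ∀ R → ∑ (perms l R) (λ π → ⟦ null? π ⟧) ≡ ⟦ null? R ⟧
  ∑-perms-null [] = +-identityʳ _
  ∑-perms-null (x ∷ R) = trans (∑-cong-All (perms-length (x ∷ R)) (λ {π} e → nonempty π e)) (∑-zero (perms l (x ∷ R)))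
    where
    nonempty : ∀ π → length π ≡ suc (length R) → ⟦ null? π ⟧ ≡ 0ℤ
    nonempty (_ ∷ _) e = refl

upTo-sorted : ∀ n → Sorted (map suc (upTo n))
upTo-sorted n = AllPairs.map⁺ (AllPairs.map ℕ.s<s (AllPairs.applyUpTo⁺₁ id n (λ i<j _ → i<j)))

∑-ColoredPerms : ∀ l n F → ∑ (ColoredPerms l n) F ≡ ∑ (wordsOver l (map suc (upTo n)) n) (λ w → ⟦ distinct
    (values w) ⟧ * F w)
∑-ColoredPerms l n F = trans (∑-filterᵇ _ (words l n n) F) (cong (λ W → ∑ W (λ w → ⟦ distinct (values w) ⟧ * F w))
    (words≡wordsOver l n n))

1^ : ∀ n → 1ℤ ^ n ≡ 1ℤ
1^ zero = refl
1^ (suc n) = trans (*-identityˡ _) (1^ n)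

∑-perms-cuts₁ : ∀ l {R} → Sorted R → (f : List Letter → List Letter → ℤ) →
  ∑ (perms l R) (λ π → ∑ (cuts π) (λ (u , v) → f u v))
  ≡ ∑ (splits R) (λ (U , V) → ∑ (perms l U) (λ u → ∑ (perms l V) (λ v → f u v)))
∑-perms-cuts₁ l {R} s f = begin
  ∑ (perms l R) (λ π → ∑ (cuts π) (λ (u , v) → f u v))
      ≡⟨ ∑-cong (perms l R) (λ π → ∑-cong (cuts π) (λ (u , v) → sym (trivial (cross (values u) (values v))
      (f u v)))) ⟩
  ∑ (perms l R) (λ π → ∑ (cuts π) (λ (u , v) → 1ℤ ^ cross (values u) (values v) * f u v)) ≡⟨ ∑-perms-cuts l 1ℤ s f ⟩
  ∑ (splits R) (λ (U , V) → 1ℤ ^ cross U V * ∑ (perms l U) (λ u → ∑ (perms l V) (λ v → f u v)))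
      ≡⟨ ∑-cong (splits R) (λ (U , V) → trivial (cross U V) _) ⟩
  ∑ (splits R) (λ (U , V) → ∑ (perms l U) (λ u → ∑ (perms l V) (λ v → f u v))) ∎
  where
  trivial : ∀ k z → 1ℤ ^ k * z ≡ z
  trivial k z = trans (cong (_* z) (1^ k)) (*-identityˡ z)

-- The color order and excedances

<c-color : ∀ {a e b f} → f < e → ((a , e) <c (b , f)) ≡ true
<c-color p rewrite <ᵇ-true p = refl

<c-value : ∀ a e b → ((a , e) <c (b , e)) ≡ (a <ᵇ b)
<c-value a e b rewrite <ᵇ-false (ℕ.≤-refl {e}) | ≡ᵇ-refl e = refl

<c-false : ∀ {a e b f} → e < f → ((a , e) <c (b , f)) ≡ false
<c-false p rewrite <ᵇ-false (ℕ.<⇒≤ p) | ≡ᵇ-false (ℕ.<⇒≢ p) = refl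

<c-true : ∀ {a e b f} → ((a , e) <c (b , f)) ≡ true → f < e ⊎ (e ≡ f × a < b)
<c-true {a} {e} {b} {f} p with ℕ.<-cmp e f
... | tri< q _ _ with () ← trans (sym p) (<c-false {a} {e} {b} {f} q)
<c-true {a} {e} {b} {f} p | tri≈ _ refl _ = inj₂ (refl , <ᵇ⇒< (trans (sym (<c-value a e b)) p))
<c-true {a} {e} {b} {f} p | tri> _ _ q = inj₁ q

<c-trans : ∀ x y z → (x <c y) ≡ true → (y <c z) ≡ true → (x <c z) ≡ true
<c-trans (a , e) (b , f) (c , g) p q with <c-true {a} {e} {b} {f} p | <c-true {b} {f} {c} {g} q
... | inj₁ r | inj₁ s = <c-color {a} {e} {c} {g} (ℕ.<-trans s r)
... | inj₁ r | inj₂ (refl , s) = <c-color {a} {e} {c} {g} r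
... | inj₂ (refl , r) | inj₁ s = <c-color {a} {e} {c} {g} s
... | inj₂ (refl , r) | inj₂ (refl , s) = trans (<c-value a e c) (<ᵇ-true (ℕ.<-trans r s))

<c-flip : ∀ x y → proj₁ x ≢ proj₁ y → (y <c x) ≡ not (x <c y)
<c-flip (a , e) (b , f) ne with ℕ.<-cmp e f
... | tri< q _ _ rewrite <c-false {a} {e} {b} {f} q = <c-color {b} {f} {a} {e} q
... | tri> _ _ q rewrite <c-false {b} {f} {a} {e} q | <c-color {a} {e} {b} {f} q = refl
... | tri≈ _ refl _ rewrite <c-value a e b | <c-value b e a with ℕ.<-cmp a b
... | tri< q _ _ rewrite <ᵇ-true q = <ᵇ-false (ℕ.<⇒≤ q)
... | tri≈ _ q _ = contradiction q ne
... | tri> _ _ q rewrite <ᵇ-true q | <ᵇ-false (ℕ.<⇒≤ q) = refl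

sorted-head : ∀ x w → sorted? _<c_ (x ∷ w) ≡ true → All (λ y → (x <c y) ≡ true) w × sorted? _<c_ w ≡ true
sorted-head x [] e = [] , refl
sorted-head x (y ∷ w) e with x <c y in p
... | true = (p ∷ All.map (λ {z} q → <c-trans x y z p q) (proj₁ (sorted-head y w e))) , e

private
  ins-after : ∀ y x e w → All (λ z → x ≢ proj₁ z) w →
    ∑ (cuts w) (λ (α , γ) → ⟦ sorted? _<c_ (y ∷ α ++ (x , e) ∷ γ) ⟧) ≡ ⟦ y <c (x , e) ⟧ * ⟦ sorted? _<c_ (y ∷ w) ⟧
  ins-after y x e [] _ with y <c (x , e)
  ... | true = trans (+-identityʳ _) (sym (*-identityˡ _))
  ... | false = trans (+-identityʳ _) (sym (*-zeroˡ _))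
  ins-after y x e (z ∷ w) (x≢z ∷ ne) = begin
    ∑ (cuts (z ∷ w)) F ≡⟨ ∑-cuts z w F ⟩
    ⟦ (y <c X) ∧ ((X <c z) ∧ s) ⟧ + ∑ (cuts w) (λ (α , γ) → ⟦ (y <c z) ∧ sorted? _<c_ (z ∷ α ++ X ∷ γ) ⟧)
      ≡⟨ cong (⟦ (y <c X) ∧ ((X <c z) ∧ s) ⟧ +_) (trans (∑-cong (cuts w) (λ (α , γ) → ⟦∧⟧ (y <c z) _)) (trans
          (∑-*ˡ ⟦ y <c z ⟧ (cuts w) _) (cong (⟦ y <c z ⟧ *_) (ins-after z x e w ne)))) ⟩
    ⟦ (y <c X) ∧ ((X <c z) ∧ s) ⟧ + ⟦ y <c z ⟧ * (⟦ z <c X ⟧ * ⟦ s ⟧) ≡⟨ cases ⟩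
    ⟦ y <c X ⟧ * ⟦ (y <c z) ∧ s ⟧ ∎
    where
    X = (x , e)
    s = sorted? _<c_ (z ∷ w)
    F : List Letter × List Letter → ℤ
    F (α , γ) = ⟦ sorted? _<c_ (y ∷ α ++ (x , e) ∷ γ) ⟧
    opaque
      unfolding _+_
      e₁ : ∀ b → b + 1ℤ * (0ℤ * b) ≡ 1ℤ * b
      e₁ = solve-∀
      e₂ : ∀ a b → 0ℤ + a * (0ℤ * b) ≡ 0ℤ
      e₂ = solve-∀
      e₃ : ∀ b → 0ℤ + 1ℤ * (1ℤ * b) ≡ 1ℤ * b
      e₃ = solve-∀
      e₄ : ∀ a b → 0ℤ + 0ℤ * (1ℤ * b) ≡ a * 0ℤ
      e₄ = solve-∀
    cases : ⟦ (y <c X) ∧ ((X <c z) ∧ s) ⟧ + ⟦ y <c z ⟧ * (⟦ z <c X ⟧ * ⟦ s ⟧) ≡ ⟦ y <c X ⟧ * ⟦ (y <c z) ∧ s ⟧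
    cases rewrite <c-flip X z x≢z with X <c z in p | y <c X in q
    cases | true | true rewrite <c-trans y X z q p = e₁ ⟦ s ⟧
    cases | true | false = trans (e₂ ⟦ y <c z ⟧ ⟦ s ⟧) (sym (*-zeroˡ _))
    cases | false | b with y <c z in r
    cases | false | true | true = e₃ ⟦ s ⟧
    cases | false | true | false = e₄ 1ℤ ⟦ s ⟧
    cases | false | false | false = e₄ 0ℤ ⟦ s ⟧
    cases | false | false | true with () ← trans (sym q) (<c-trans y z X r (trans (<c-flip X z x≢z) (cong not p)))

  -- A new letter fits into a sorted word at exactly one place, and no insertion makes an unsorted
  -- word sorted.
  ins-sorted : ∀ x e w → All (λ z → x ≢ proj₁ z) w →
    ∑ (cuts w) (λ (α , γ) → ⟦ sorted? _<c_ (α ++ (x , e) ∷ γ) ⟧) ≡ ⟦ sorted? _<c_ w ⟧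
  ins-sorted x e [] _ = +-identityʳ _
  ins-sorted x e (z ∷ w) (x≢z ∷ ne) = begin
    ∑ (cuts (z ∷ w)) (λ (α , γ) → ⟦ sorted? _<c_ (α ++ (x , e) ∷ γ) ⟧)
        ≡⟨ ∑-cuts z w (λ (α , γ) → ⟦ sorted? _<c_ (α ++ (x , e) ∷ γ) ⟧) ⟩
    ⟦ ((x , e) <c z) ∧ sorted? _<c_ (z ∷ w) ⟧ + ∑ (cuts w) (λ (α , γ) → ⟦ sorted? _<c_ (z ∷ α ++ (x , e) ∷ γ) ⟧)
      ≡⟨ cong (⟦ ((x , e) <c z) ∧ sorted? _<c_ (z ∷ w) ⟧ +_) (ins-after z x e w ne) ⟩
    ⟦ ((x , e) <c z) ∧ sorted? _<c_ (z ∷ w) ⟧ + ⟦ z <c (x , e) ⟧ * ⟦ sorted? _<c_ (z ∷ w) ⟧ ≡⟨ cases ⟩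
    ⟦ sorted? _<c_ (z ∷ w) ⟧ ∎
    where
    cases : ⟦ ((x , e) <c z) ∧ sorted? _<c_ (z ∷ w) ⟧ + ⟦ z <c (x , e) ⟧ * ⟦ sorted? _<c_ (z ∷ w) ⟧ ≡ ⟦ sorted? _<c_
        (z ∷ w) ⟧
    cases rewrite <c-flip (x , e) z x≢z with (x , e) <c z
    ... | true = trans (cong₂ _+_ refl (*-zeroˡ _)) (+-identityʳ _)
    ... | false = trans (+-identityˡ _) (*-identityˡ _)

∏ : List A → (A → ℤ) → ℤ
∏ [] f = 1ℤ
∏ (x ∷ xs) f = f x * ∏ xs f

∏-insert : ∀ (α : List A) z γ f → ∏ (α ++ z ∷ γ) f ≡ f z * ∏ (α ++ γ) f
∏-insert [] z γ f = refl
∏-insert (x ∷ α) z γ f = trans (cong (f x *_) (∏-insert α z γ f)) (trans (sym (*-assoc _ _ _)) (trans (cong₂ _*_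
    (*-comm _ _) refl) (*-assoc _ _ _)))

∏-cong-All : {P : A → Set} {xs : List A} → All P xs → {f g : A → ℤ} → (∀ {x} → P x → f x ≡ g x) → ∏ xs f ≡ ∏ xs g
∏-cong-All [] e = refl
∏-cong-All (p ∷ ps) e = cong₂ _*_ (e p) (∏-cong-All ps e)

∏-* : ∀ (xs : List A) f g → ∏ xs (λ x → f x * g x) ≡ ∏ xs f * ∏ xs g
∏-* [] f g = sym (*-identityˡ _)
∏-* (x ∷ xs) f g = trans (cong (f x * g x *_) (∏-* xs f g)) (*-interchange _ _ _ _)

-- A sorted word is determined by the colors of its values, and these are chosen independently of
-- each other.
∑-perms-sorted : ∀ k {R} → Sorted R → (f : Letter → ℤ) →
  ∑ (perms k R) (λ π → ⟦ sorted? _<c_ π ⟧ * ∏ π f) ≡ ∏ R (λ v → ∑ (upTo k) (λ e → f (v , e)))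
∑-perms-sorted k [] f = trans (+-identityʳ _) (*-identityˡ _)
∑-perms-sorted k {x ∷ R} (x< ∷ s) f = begin
  ∑ (perms k (x ∷ R)) (λ π → ⟦ sorted? _<c_ π ⟧ * ∏ π f) ≡⟨ ∑-perms k x R _ ⟩
  ∑ (perms k R) (ins k x (λ π → ⟦ sorted? _<c_ π ⟧ * ∏ π f))
      ≡⟨ ∑-cong-All (perms-All k x<) (λ {π} p → step π (All.map⁻ p)) ⟩
  ∑ (perms k R) (λ π → ∑ (upTo k) (λ e → f (x , e)) * (⟦ sorted? _<c_ π ⟧ * ∏ π f)) ≡⟨ ∑-*ˡ _ (perms k R) _ ⟩
  ∑ (upTo k) (λ e → f (x , e)) * ∑ (perms k R) (λ π → ⟦ sorted? _<c_ π ⟧ * ∏ π f)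
      ≡⟨ cong (∑ (upTo k) (λ e → f (x , e)) *_) (∑-perms-sorted k s f) ⟩
  ∏ (x ∷ R) (λ v → ∑ (upTo k) (λ e → f (v , e))) ∎
  where
  opaque
    unfolding _+_
    eq : ∀ s a b → s * (a * b) ≡ a * b * s
    eq = solve-∀
  step : ∀ π → All (λ z → x < proj₁ z) π →
    ins k x (λ π → ⟦ sorted? _<c_ π ⟧ * ∏ π f) π ≡ ∑ (upTo k) (λ e → f (x , e)) * (⟦ sorted? _<c_ π ⟧ * ∏ π f)
  step π p = begin
    ∑ (cuts π) (λ (α , γ) → ∑ (upTo k) (λ e → ⟦ sorted? _<c_ (α ++ (x , e) ∷ γ) ⟧ * ∏ (α ++ (x , e) ∷ γ) f))
        ≡⟨ ∑-swap (cuts π) (upTo k) _ ⟩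
    ∑ (upTo k) (λ e → ∑ (cuts π) (λ (α , γ) → ⟦ sorted? _<c_ (α ++ (x , e) ∷ γ) ⟧ * ∏ (α ++ (x , e) ∷ γ) f))
      ≡⟨ ∑-cong (upTo k) (λ e → trans (∑-cong-All (cuts-++ π) (λ {(α , γ)} eq′ → cong (⟦ sorted? _<c_ (α ++
          (x , e) ∷ γ) ⟧ *_) (trans (∏-insert α (x , e) γ f) (cong (λ z → f (x , e) * ∏ z f) eq′))))
           (trans (∑-*ʳ (f (x , e) * ∏ π f) (cuts π) _) (trans (cong (_* (f (x , e) * ∏ π f)) (ins-sorted x e π
               (All.map ℕ.<⇒≢ p))) (trans (eq _ _ _) (trans (*-assoc _ _ _) (cong (f (x , e) *_) (*-comm _ _))))))) ⟩
    ∑ (upTo k) (λ e → f (x , e) * (⟦ sorted? _<c_ π ⟧ * ∏ π f)) ≡⟨ ∑-*ʳ _ (upTo k) _ ⟩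
    ∑ (upTo k) (λ e → f (x , e)) * (⟦ sorted? _<c_ π ⟧ * ∏ π f) ∎

∑-upTo-∷ : ∀ n f → ∑ (upTo (suc n)) f ≡ f 0 + ∑ (upTo n) (f ∘ suc)
∑-upTo-∷ n f = cong (f 0 +_) (trans (cong (λ xs → ∑ xs f) (sym (List.map-upTo suc n))) (∑-map suc (upTo n) f))

∑-upTo-∷ʳ : ∀ n f → ∑ (upTo (suc n)) f ≡ ∑ (upTo n) f + f n
∑-upTo-∷ʳ zero f = trans (+-identityʳ _) (sym (+-identityˡ _))
∑-upTo-∷ʳ (suc n) f = trans (∑-upTo-∷ (suc n) f) (trans (cong (f 0 +_) (∑-upTo-∷ʳ n (f ∘ suc))) (trans (sym
    (+-assoc _ _ _)) (cong₂ _+_ (sym (∑-upTo-∷ n f)) refl)))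

∣cut∣ : ∀ {u v w : List A} → u ++ v ≡ w → length u ℕ.+ length v ≡ length w
∣cut∣ {u = u} e = trans (sym (List.length-++ u)) (cong length e)

-- Excedance letters (v , 0) at a position p < v are recolored by the additional color l; since a larger color
-- makes a letter smaller, this moves the excedances to the bottom of the color order.
module Keys (k : ℕ) where

  l = suc k

  exc? : ℕ → Letter → Bool
  exc? p x = (p , 0) <c x

  key : ℕ → Letter → Letter
  key p x = if exc? p x then (proj₁ x , l) else x

  keys : ℕ → List Letter → List Letter
  keys a [] = []
  keys a (x ∷ w) = key (suc a) x ∷ keys (suc a) w

  -- Characterizes the image of `key` at position p: color l belongs to recolored excedances, and
  -- color 0 remains for letters that are none.
  valid? : ℕ → Letter → Bool
  valid? p (v , e) = if e ≡ᵇ l then p <ᵇ v else (if e ≡ᵇ 0 then not (p <ᵇ v) else true)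

  validity : ℕ → List Letter → ℤ
  validity a [] = 1ℤ
  validity a (x ∷ w) = ⟦ valid? (suc a) x ⟧ * validity (suc a) w

  ∑-key : ∀ p v (f : Letter → ℤ) → ∑ (upTo l) (λ e → f (key p (v , e))) ≡ ∑ (upTo (suc l)) (λ e → ⟦ valid? p (v , e) ⟧
      * f (v , e))
  ∑-key p v f = begin
    ∑ (upTo l) (λ e → f (key p (v , e))) ≡⟨ ∑-upTo-∷ k (λ e → f (key p (v , e))) ⟩
    f (key p (v , 0)) + ∑ (upTo k) (λ e → f (v , suc e))
      ≡⟨ cong₂ _+_ split (∑-cong-All (All.applyUpTo⁺₁ id k id) (λ {e} e<k → middle e e<k)) ⟩
    (⟦ valid? p (v , 0) ⟧ * f (v , 0) + ⟦ p <ᵇ v ⟧ * f (v , l)) + ∑ (upTo k) (λ e → ⟦ valid? p (v , suc e) ⟧ * f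
        (v , suc e)) ≡⟨ eq _ _ _ ⟩
    ⟦ valid? p (v , 0) ⟧ * f (v , 0) + (∑ (upTo k) (λ e → ⟦ valid? p (v , suc e) ⟧ * f (v , suc e)) + ⟦ p <ᵇ v ⟧ * f
        (v , l))
      ≡⟨ cong (λ z → ⟦ valid? p (v , 0) ⟧ * f (v , 0) + (∑ (upTo k) (λ e → ⟦ valid? p (v , suc e) ⟧ * f (v , suc e))
          + ⟦ z ⟧ * f (v , l))) (sym last) ⟩
    ⟦ valid? p (v , 0) ⟧ * f (v , 0) + (∑ (upTo k) (λ e → ⟦ valid? p (v , suc e) ⟧ * f (v , suc e)) + ⟦ valid? p
        (v , l) ⟧ * f (v , l))
      ≡⟨ cong (⟦ valid? p (v , 0) ⟧ * f (v , 0) +_) (∑-upTo-∷ʳ k (λ e → ⟦ valid? p (v , suc e) ⟧ * f (v , suc e))) ⟨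
    ⟦ valid? p (v , 0) ⟧ * f (v , 0) + ∑ (upTo l) (λ e → ⟦ valid? p (v , suc e) ⟧ * f (v , suc e))
        ≡⟨ ∑-upTo-∷ l (λ e → ⟦ valid? p (v , e) ⟧ * f (v , e)) ⟨
    ∑ (upTo (suc l)) (λ e → ⟦ valid? p (v , e) ⟧ * f (v , e)) ∎
    where
    opaque
      unfolding _+_
      eq : ∀ a b c → (a + b) + c ≡ a + (c + b)
      eq = solve-∀
      e₁ : ∀ a b → a ≡ 0ℤ * b + 1ℤ * a
      e₁ = solve-∀
      e₂ : ∀ a b → b ≡ 1ℤ * b + 0ℤ * a
      e₂ = solve-∀
    last : valid? p (v , l) ≡ (p <ᵇ v)
    last rewrite ≡ᵇ-refl k = refl
    split : f (key p (v , 0)) ≡ ⟦ valid? p (v , 0) ⟧ * f (v , 0) + ⟦ p <ᵇ v ⟧ * f (v , l)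
    split with p <ᵇ v
    ... | true = e₁ (f (v , l)) (f (v , 0))
    ... | false = e₂ (f (v , l)) (f (v , 0))
    middle : ∀ e → e < k → f (v , suc e) ≡ ⟦ valid? p (v , suc e) ⟧ * f (v , suc e)
    middle e e<k rewrite ≡ᵇ-false (ℕ.<⇒≢ e<k) = sym (*-identityˡ _)

  -- The recoloring acts on each letter by itself and keeps its value. It is therefore carried out
  -- on all words, before the restriction to distinct values.
  ∑-keys : ∀ V n a (f : List Letter → ℤ) →
    ∑ (wordsOver l V n) (λ w → f (keys a w)) ≡ ∑ (wordsOver (suc l) V n) (λ w → validity a w * f w)
  ∑-keys V zero a f = cong (_+ 0ℤ) (sym (*-identityˡ _))
  ∑-keys V (suc n) a f = begin
    ∑ (wordsOver l V (suc n)) (λ w → f (keys a w)) ≡⟨ ∑-wordsOver l V n _ ⟩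
    ∑ V (λ v → ∑ (upTo l) (λ e → ∑ (wordsOver l V n) (λ w → f (key (suc a) (v , e) ∷ keys (suc a) w))))
      ≡⟨ ∑-cong V (λ v → trans (∑-cong (upTo l) (λ e → ∑-keys V n (suc a) (λ w → f (key (suc a) (v , e) ∷ w)))) (∑-key
          (suc a) v (λ x → ∑ (wordsOver (suc l) V n) (λ w → validity (suc a) w * f (x ∷ w))))) ⟩
    ∑ V (λ v → ∑ (upTo (suc l)) (λ e → ⟦ valid? (suc a) (v , e) ⟧ * ∑ (wordsOver (suc l) V n) (λ w → validity
        (suc a) w * f ((v , e) ∷ w))))
      ≡⟨ ∑-cong V (λ v → ∑-cong (upTo (suc l)) (λ e → trans (sym (∑-*ˡ _ (wordsOver (suc l) V n) _)) (∑-cong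
          (wordsOver (suc l) V n) (λ w → sym (*-assoc _ _ _))))) ⟩
    ∑ V (λ v → ∑ (upTo (suc l)) (λ e → ∑ (wordsOver (suc l) V n) (λ w → validity a ((v , e) ∷ w) * f ((v , e) ∷ w))))
        ≡⟨ ∑-wordsOver (suc l) V n _ ⟨
    ∑ (wordsOver (suc l) V (suc n)) (λ w → validity a w * f w) ∎

  values-keys : ∀ a w → values (keys a w) ≡ values w
  values-keys a [] = refl
  values-keys a (x ∷ w) = cong₂ _∷_ head (values-keys (suc a) w)
    where
    head : proj₁ (key (suc a) x) ≡ proj₁ x
    head with exc? (suc a) x
    ... | true = refl
    ... | false = refl

  colsum-keys : ∀ a w → colsum (keys a w) ≡ l ℕ.* excAux (suc a) w ℕ.+ colsum w
  colsum-keys a [] = sym (cong (ℕ._+ 0) (ℕ.*-zeroʳ l))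
  colsum-keys a ((v , suc e) ∷ w) rewrite colsum-keys (suc a) w = trans (sym (ℕ.+-assoc (suc e) (l ℕ.* X) _)) (trans
      (cong (ℕ._+ colsum w) (ℕ.+-comm (suc e) (l ℕ.* X))) (ℕ.+-assoc (l ℕ.* X) _ _))
    where X = excAux (suc (suc a)) w
  colsum-keys a ((v , zero) ∷ w) rewrite colsum-keys (suc a) w with suc a <ᵇ v
  ... | true = trans (sym (ℕ.+-assoc l _ _)) (cong (ℕ._+ colsum w) (sym (ℕ.*-suc l (excAux (suc (suc a)) w))))
  ... | false = refl

  fix-keys : ∀ a w → fixAux (suc a) (keys a w) ≡ fixAux (suc a) w
  fix-keys a [] = refl
  fix-keys a ((v , suc e) ∷ w) = cong (_ ℕ.+_) (fix-keys (suc a) w)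
  fix-keys a ((v , zero) ∷ w) with suc a <ᵇ v in e
  ... | false = cong (_ ℕ.+_) (fix-keys (suc a) w)
  ... | true rewrite ≡ᵇ-false (ℕ.>⇒≢ (<ᵇ⇒< {suc a} {v} e))  = fix-keys (suc a) w

  private
    -- The recoloring changes the comparison of two neighbours only if exactly one of them is an
    -- excedance: from descent to ascent if it is the left one, from ascent to descent if it is the
    -- right one. An excedance at position p is thus counted p times from its right and p - 1 times
    -- from its left, and the sum over all pairs leaves one for each excedance.
    pair : ∀ a x y → proj₁ x ≢ proj₁ y → col x < l → col y < l →
      (if y <c x then suc a else 0) ℕ.+ (if exc? (suc (suc a)) y then suc a else 0)
      ≡ (if key (suc a) x <c key (suc (suc a)) y then 0 else suc a) ℕ.+ (if exc? (suc a) x then suc a else 0)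
    pair a (v , suc e) (v′ , suc e′) ne c c′ = cong (ℕ._+ 0) (flip (<c-flip (v , suc e) (v′ , suc e′) ne))
      where
      flip : ∀ {b b′} → b ≡ not b′ → (if b then suc a else 0) ≡ (if b′ then 0 else suc a)
      flip {b′ = true} refl = refl
      flip {b′ = false} refl = refl
    pair a (v , suc e) (v′ , zero) ne c c′ with suc (suc a) <ᵇ v′
    ... | true rewrite <c-false {v} {suc e} {v′} {l} c = sym (ℕ.+-identityʳ (suc a))
    ... | false = refl
    pair a (v , zero) (v′ , suc e′) ne c c′ with suc a <ᵇ v
    ... | true rewrite <c-color {v} {l} {v′} {suc e′} c′ = ℕ.+-identityʳ (suc a)
    ... | false = refl
    pair a (v , zero) (v′ , zero) ne c c′ with suc a <ᵇ v in p | suc (suc a) <ᵇ v′ in p′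
    ... | true | true rewrite <c-value v l v′ = cong (ℕ._+ suc a) (flip (<c-flip (v , 0) (v′ , 0) ne))
      where
      flip : ∀ {b b′} → b ≡ not b′ → (if b then suc a else 0) ≡ (if b′ then 0 else suc a)
      flip {b′ = true} refl = refl
      flip {b′ = false} refl = refl
    ... | true | false rewrite <ᵇ-true (ℕ.≤∧≢⇒< (ℕ.≤-trans (<ᵇ⇒≥ {suc (suc a)} {v′} p′) (<ᵇ⇒< {suc a} {v} p))
        (ne ∘ sym)) = ℕ.+-identityʳ (suc a)
    ... | false | true rewrite <ᵇ-false (ℕ.≤-trans (<ᵇ⇒≥ {suc a} {v} p) (ℕ.≤-trans (ℕ.n≤1+n (suc a)) (ℕ.<⇒≤ (<ᵇ⇒< {suc
        (suc a)} {v′} p′)))) = sym (ℕ.+-identityʳ (suc a))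
    ... | false | false = cong (ℕ._+ 0) (flip (<c-flip (v , 0) (v′ , 0) ne))
      where
      flip : ∀ {b b′} → b ≡ not b′ → (if b then suc a else 0) ≡ (if b′ then 0 else suc a)
      flip {b′ = true} refl = refl
      flip {b′ = false} refl = refl

    -- The boundary term of the telescoping sum, for the first letter, which has no left neighbour
    -- in the suffix under consideration. It vanishes for the full word, where a = 0.
    headTerm : ℕ → List Letter → ℕ
    headTerm a [] = 0
    headTerm a (x ∷ w) = if exc? (suc a) x then a else 0

    maj-keys-from : ∀ a w → AllPairs _≢_ (values w) → All (λ x → col x < l) w → All (_≤ a ℕ.+ length w) (values w) →
      majAux (suc a) w ≡ majFrom _<c_ (suc a) (keys a w) ℕ.+ excAux (suc a) w ℕ.+ headTerm a w
    maj-keys-from a [] _ _ _ = refl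
    maj-keys-from a ((v , suc e) ∷ []) _ _ _ = refl
    -- The letter at the last position is no excedance, because no value exceeds the length;
    -- otherwise its weight would have no right neighbour to cancel against.
    maj-keys-from a ((v , zero) ∷ []) _ _ (p ∷ _) rewrite <ᵇ-false (subst (v ≤_) (ℕ.+-comm a 1) p) = refl
    maj-keys-from a (x ∷ y ∷ w) ((ne ∷ _) ∷ dis) (c ∷ cs@(c′ ∷ _)) (_ ∷ ps) = begin
      (if y <c x then suc a else 0) ℕ.+ majAux (suc (suc a)) (y ∷ w)
        ≡⟨ cong ((if y <c x then suc a else 0) ℕ.+_) (maj-keys-from (suc a) (y ∷ w) dis cs (subst (λ n → All (_≤ n)
            (values (y ∷ w))) (ℕ.+-suc a _) ps)) ⟩
      d ℕ.+ (m ℕ.+ ex ℕ.+ hd) ≡⟨ shuffle₁ d m ex hd ⟩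
      (d ℕ.+ hd) ℕ.+ (m ℕ.+ ex) ≡⟨ cong (ℕ._+ (m ℕ.+ ex)) (pair a x y ne c c′) ⟩
      (d′ ℕ.+ (if exc? (suc a) x then suc a else 0)) ℕ.+ (m ℕ.+ ex)
          ≡⟨ cong (λ z → (d′ ℕ.+ z) ℕ.+ (m ℕ.+ ex)) (headExc (exc? (suc a) x)) ⟩
      (d′ ℕ.+ (b ℕ.+ headTerm a (x ∷ y ∷ w))) ℕ.+ (m ℕ.+ ex) ≡⟨ shuffle₂ d′ b (headTerm a (x ∷ y ∷ w)) m ex ⟩
      d′ ℕ.+ m ℕ.+ (b ℕ.+ ex) ℕ.+ headTerm a (x ∷ y ∷ w) ∎
      where
      d = if y <c x then suc a else 0
      d′ = if key (suc a) x <c key (suc (suc a)) y then 0 else suc a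
      m = majFrom _<c_ (suc (suc a)) (keys (suc a) (y ∷ w))
      ex = excAux (suc (suc a)) (y ∷ w)
      hd = headTerm (suc a) (y ∷ w)
      b = if exc? (suc a) x then 1 else 0
      headExc : ∀ c → (if c then suc a else 0) ≡ (if c then 1 else 0) ℕ.+ (if c then a else 0)
      headExc true = refl
      headExc false = refl
      shuffle₁ : ∀ d m ex hd → d ℕ.+ (m ℕ.+ ex ℕ.+ hd) ≡ (d ℕ.+ hd) ℕ.+ (m ℕ.+ ex)
      shuffle₁ = solveℕ-∀
      shuffle₂ : ∀ d b hd m ex → (d ℕ.+ (b ℕ.+ hd)) ℕ.+ (m ℕ.+ ex) ≡ d ℕ.+ m ℕ.+ (b ℕ.+ ex) ℕ.+ hd
      shuffle₂ = solveℕ-∀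

  maj-keys : ∀ w → AllPairs _≢_ (values w) → All (λ x → col x < l) w → All (_≤ length w) (values w) →
    maj w ≡ majFrom _<c_ 1 (keys 0 w) ℕ.+ exc w
  maj-keys w p q r = trans (maj-keys-from 0 w p q r) (trans (cong (majFrom _<c_ 1 (keys 0 w) ℕ.+ exc w ℕ.+_)
      (noHead w)) (ℕ.+-identityʳ _))
    where
    noHead : ∀ w → headTerm 0 w ≡ 0
    noHead [] = refl
    noHead (x ∷ w) with exc? 1 x
    ... | true = refl
    ... | false = refl

perms-colors : ∀ l R → All (All (λ x → col x < l)) (perms l R)
perms-colors l [] = [] ∷ []
perms-colors l (x ∷ R) = All.concat⁺ (All.map⁺ (All.map (λ {π} p →
    All.concat⁺ (All.map⁺ (All.map (λ {(α , γ)} e →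
      All.map⁺ (All.map (λ c → insert α γ (subst (All (λ x → col x < l)) (sym e) p) c) (All.applyUpTo⁺₁ id l id)))
          (cuts-++ π)))) (perms-colors l R)))
  where
  insert : ∀ α γ → All (λ x → col x < l) (α ++ γ) → ∀ {c} → c < l → All (λ x → col x < l) (α ++ (x , c) ∷ γ)
  insert [] γ p c = c ∷ p
  insert (_ ∷ α) γ (q ∷ p) c = q ∷ insert α γ p c

-- Block decompositions with one weight per letter

module _ (q : ℤ) where

  QL : Vec ℤ M → List Letter → ℤ
  QL [] w = ⟦ null? w ⟧
  QL (x ∷ xs) w = ∑ (cuts w) (λ (u , v) → x ^ length u * (⟦ sorted? _<c_ u ⟧ * QL xs v))

  private
    null-left : ∀ (w : List Letter) (f : List Letter → ℤ) → ∑ (cuts w) (λ (u , v) → q ^ length u * (⟦ null? u ⟧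
        * f v)) ≡ f w
    null-left [] f = trans (+-identityʳ _) (trans (*-identityˡ _) (*-identityˡ _))
    null-left (x ∷ w) f = trans (∑-cuts x w (λ (u , v) → q ^ length u * (⟦ null? u ⟧ * f v)))
      (trans (cong₂ _+_ (trans (*-identityˡ _) (*-identityˡ _)) (trans (∑-cong (cuts w) (λ (u , v) → trans (cong
          (q ^ suc (length u) *_) (*-zeroˡ _)) (*-zeroʳ _))) (∑-zero (cuts w)))) (+-identityʳ _))

    null-right : ∀ (w : List Letter) (f : List Letter → ℤ) → ∑ (cuts w) (λ (u , v) → 1ℤ ^ length u * (f u
        * ⟦ null? v ⟧)) ≡ f w
    null-right [] f = trans (+-identityʳ _) (trans (*-identityˡ _) (*-identityʳ _))
    null-right (x ∷ w) f = trans (∑-cuts x w (λ (u , v) → 1ℤ ^ length u * (f u * ⟦ null? v ⟧)))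
      (trans (cong₂ _+_ (trans (*-identityˡ _) (*-zeroʳ _)) (trans (∑-cong (cuts w) (λ (u , v) → cong (_* (f (x ∷ u)
          * ⟦ null? v ⟧)) (*-identityˡ (1ℤ ^ length u)))) (null-right w (f ∘ (x ∷_))))) (+-identityˡ _))

  -- The weight q^position of a cut assigns one factor q to every letter in front of it, so a letter
  -- with m blocks after its own has the weight q^m. `QL` peels blocks from the left and `Q` from
  -- the right; the step exchanges the two outer cuts.
  QL≡Q : ∀ M w → QL (powers q M) w ≡ Q q _<c_ M w
  QL≡Q zero w = refl
  QL≡Q (suc zero) w = trans (null-right w (λ u → ⟦ sorted? _<c_ u ⟧)) (sym (null-left w (λ u → ⟦ sorted? _<c_ u ⟧)))
  QL≡Q (suc (suc M)) w = begin
    ∑ (cuts w) (λ (u , v) → (q ^ suc M) ^ length u * (⟦ sorted? _<c_ u ⟧ * QL (powers q (suc M)) v))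
      ≡⟨ ∑-cong (cuts w) (λ (u , v) → trans (cong (λ z → (q ^ suc M) ^ length u * (⟦ sorted? _<c_ u ⟧ * z)) (QL≡Q
          (suc M) v))
           (trans (sym (*-assoc _ _ _)) (sym (∑-*ˡ _ (cuts v) _)))) ⟩
    ∑ (cuts w) (λ (u , v) → ∑ (cuts v) (λ (b , c) → (q ^ suc M) ^ length u * ⟦ sorted? _<c_ u ⟧ * (q ^ length b *
        (Q q _<c_ M b * ⟦ sorted? _<c_ c ⟧))))
      ≡⟨ ∑-cuts-assoc w (λ u b c → (q ^ suc M) ^ length u * ⟦ sorted? _<c_ u ⟧ * (q ^ length b * (Q q _<c_ M b
          * ⟦ sorted? _<c_ c ⟧))) ⟨
    ∑ (cuts w) (λ (r , c) → ∑ (cuts r) (λ (u , b) → (q ^ suc M) ^ length u * ⟦ sorted? _<c_ u ⟧ * (q ^ length b *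
        (Q q _<c_ M b * ⟦ sorted? _<c_ c ⟧))))
      ≡⟨ ∑-cong (cuts w) (λ (r , c) → ∑-cong-All (cuts-++ r) (λ {(u , b)} e → term r c u b e)) ⟩
    ∑ (cuts w) (λ (r , c) → ∑ (cuts r) (λ (u , b) → (q ^ M) ^ length u * (⟦ sorted? _<c_ u ⟧ * QL (powers q M) b) *
        (q ^ length r * ⟦ sorted? _<c_ c ⟧)))
      ≡⟨ ∑-cong (cuts w) (λ (r , c) → trans (∑-*ʳ _ (cuts r) _) (trans (cong (_* (q ^ length r * ⟦ sorted? _<c_ c ⟧))
          (QL≡Q (suc M) r)) (*-exchange _ _ _))) ⟩
    ∑ (cuts w) (λ (r , c) → q ^ length r * (Q q _<c_ (suc M) r * ⟦ sorted? _<c_ c ⟧)) ∎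
    where
    opaque
      unfolding _+_
      eq₁ : ∀ a b s Q B s′ → a * b * s * (B * (Q * s′)) ≡ b * (s * Q) * (a * B * s′)
      eq₁ = solve-∀
    term : ∀ r c u b → u ++ b ≡ r → (q ^ suc M) ^ length u * ⟦ sorted? _<c_ u ⟧ * (q ^ length b * (Q q _<c_ M b
        * ⟦ sorted? _<c_ c ⟧))
      ≡ (q ^ M) ^ length u * (⟦ sorted? _<c_ u ⟧ * QL (powers q M) b) * (q ^ length r * ⟦ sorted? _<c_ c ⟧)
    term r c u b e rewrite QL≡Q M b | *-^ q (q ^ M) (length u) | sym (∣cut∣ {u = u} e) | ^-+ q (length u)
        (length b) = eq₁ _ _ _ _ _ _

eqUp : ℕ → List ℕ → Bool
eqUp a [] = true
eqUp a (u ∷ U) = (u ≡ᵇ suc a) ∧ eqUp (suc a) U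

-- Weights of increasing blocks and their final fixed points

module Blocks (k : ℕ) (t r : ℤ) where

  open Keys k

  fixed? : ℕ → Letter → Bool
  fixed? p x = (proj₁ x ≡ᵇ p) ∧ (col x ≡ᵇ 0)

  allFixed? : ℕ → List Letter → Bool
  allFixed? a [] = true
  allFixed? a (x ∷ w) = fixed? (suc a) x ∧ allFixed? (suc a) w

  letterWeight : ℤ → ℕ → Letter → ℤ
  letterWeight r p x = ⟦ valid? p x ⟧ * (t ^ col x * (if fixed? p x then r else 1ℤ))

  weight : ℤ → ℕ → List Letter → ℤ
  weight r a [] = 1ℤ
  weight r a (x ∷ w) = letterWeight r (suc a) x * weight r (suc a) w

  weight-++ : ∀ r a u v → weight r a (u ++ v) ≡ weight r a u * weight r (a ℕ.+ length u) v
  weight-++ r a [] v rewrite ℕ.+-identityʳ a = sym (*-identityˡ _)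
  weight-++ r a (x ∷ u) v rewrite ℕ.+-suc a (length u) = trans (cong (letterWeight r (suc a) x *_) (weight-++ r
      (suc a) u v)) (sym (*-assoc _ _ _))

  weight-stats : ∀ a w → weight r a w ≡ validity a w * (t ^ colsum w * r ^ fixAux (suc a) w)
  weight-stats a [] = sym (trans (*-identityˡ _) (*-identityˡ _))
  weight-stats a (x ∷ w) rewrite weight-stats (suc a) w | ^-+ t (col x) (colsum w) with fixed? (suc a) x
  ... | true = eq _ _ r _ _ _
    where opaque
      unfolding _+_
      eq : ∀ v c f V C F → v * (c * f) * (V * (C * F)) ≡ v * V * (c * C * (f * F))
      eq = solve-∀
  ... | false = eq _ _ _ _ _
    where opaque
      unfolding _+_
      eq : ∀ v c V C F → v * (c * 1ℤ) * (V * (C * F)) ≡ v * V * (c * C * F)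
      eq = solve-∀

  weight-1 : ∀ a w → weight 1ℤ a w ≡ validity a w * ∏ w (λ x → t ^ col x)
  weight-1 a [] = sym (*-identityˡ _)
  weight-1 a (x ∷ w) rewrite weight-1 (suc a) w = trans (cong (λ z → ⟦ valid? (suc a) x ⟧ * (t ^ col x * z) *
      (validity (suc a) w * ∏ w (λ x → t ^ col x))) (if-same (fixed? (suc a) x)))
    (trans (cong (λ z → ⟦ valid? (suc a) x ⟧ * z * (validity (suc a) w * ∏ w (λ x → t ^ col x))) (*-identityʳ _))
        (*-interchange _ _ _ _))
    where
    if-same : ∀ b → (if b then 1ℤ else 1ℤ) ≡ 1ℤ
    if-same true = refl
    if-same false = refl

  -- on sorted blocks occupying the positions a+1,...,b, validity is a condition on each letter separately
  local? : ℕ → ℕ → Letter → Bool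
  local? a b (v , e) = if e ≡ᵇ l then suc a <ᵇ v else (if e ≡ᵇ 0 then not (b <ᵇ v) else true)

  -- In a sorted block the letters of color l come first and those of color 0 last, each group with
  -- increasing values. Values grow at least as fast as positions, so for color l it suffices that
  -- the values exceed the first position, and for color 0 that they do not exceed the last one.
  validity-local : ∀ a b w → a ℕ.+ length w ≡ b → All (λ x → col x < suc l) w → sorted? _<c_ w ≡ true →
    validity a w ≡ ∏ w (λ x → ⟦ local? a b x ⟧)
  validity-local a b [] _ _ _ = refl
  validity-local a b ((v , e) ∷ w) s (c ∷ cs) srt with sorted-head (v , e) w srt | e ℕ.≟ l
  ... | x<w , srt′ | yes refl rewrite ≡ᵇ-refl k with suc a <ᵇ v in p
  ...   | false = trans (*-zeroˡ _) (sym (*-zeroˡ _))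
  ...   | true = cong (1ℤ *_) (trans (validity-local (suc a) b w (trans (sym (ℕ.+-suc a _)) s) cs srt′)
      (∏-cong-All x<w (λ {y} → same y)))
    where
    same : ∀ y → ((v , l) <c y) ≡ true → ⟦ local? (suc a) b y ⟧ ≡ ⟦ local? a b y ⟧
    same (v′ , e′) q with e′ ≡ᵇ l in e″
    ... | false = refl
    ... | true with ≡ᵇ-true {e′} {l} e″
    ... | refl with <c-true {v} {l} {v′} {l} q
    ... | inj₁ z = contradiction z (ℕ.<-irrefl refl)
    ... | inj₂ (_ , v<v′) rewrite <ᵇ-true (ℕ.≤-<-trans (<ᵇ⇒< {suc a} {v} p) v<v′) | <ᵇ-true (ℕ.<-trans
        (<ᵇ⇒< {suc a} {v} p) v<v′) = refl
  validity-local a b ((v , e) ∷ w) s (c ∷ cs) srt | x<w , srt′ | no ne = begin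
    ⟦ valid? (suc a) (v , e) ⟧ * validity (suc a) w ≡⟨ head e w ne s x<w ⟩
    ⟦ local? a b (v , e) ⟧ * validity (suc a) w
      ≡⟨ cong (⟦ local? a b (v , e) ⟧ *_) (trans (validity-local (suc a) b w (trans (sym (ℕ.+-suc a _)) s) cs srt′)
          (∏-cong-All x<w (λ {y} → same y))) ⟩
    ⟦ local? a b (v , e) ⟧ * ∏ w (λ x → ⟦ local? a b x ⟧) ∎
    where
    same : ∀ y → ((v , e) <c y) ≡ true → ⟦ local? (suc a) b y ⟧ ≡ ⟦ local? a b y ⟧
    same (v′ , e′) q with e′ ≡ᵇ l in e″
    ... | false = refl
    ... | true with ≡ᵇ-true {e′} {l} e″
    ... | refl with <c-true {v} {e} {v′} {l} q
    ... | inj₁ l<e = contradiction (ℕ.≤-trans (ℕ.s≤s l<e) c) (ℕ.<-irrefl refl)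
    ... | inj₂ (e≡l , _) = contradiction e≡l ne
    -- After a letter of color 0 only larger letters of color 0 follow. If it exceeds its position,
    -- so does its successor, and both sides vanish; only at the last position does the condition
    -- stand alone.
    head : ∀ e w → e ≢ l → a ℕ.+ suc (length w) ≡ b → All (λ y → ((v , e) <c y) ≡ true) w →
      ⟦ valid? (suc a) (v , e) ⟧ * validity (suc a) w ≡ ⟦ local? a b (v , e) ⟧ * validity (suc a) w
    head (suc e) w ne s x<w rewrite ≡ᵇ-false ne = refl
    head zero [] ne s x<w rewrite ℕ.+-comm a 1 | s = refl
    head zero ((v′ , e′) ∷ w) ne s (q ∷ _) with <c-true {v} {0} {v′} {e′} q
    ... | inj₂ (refl , v<v′) with suc a <ᵇ v in p
    ...   | false rewrite <ᵇ-false (ℕ.≤-trans (<ᵇ⇒≥ {suc a} {v} p) (subst (suc a ≤_) s (subst (suc a ≤_) (sym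
        (ℕ.+-suc a _)) (ℕ.s≤s (ℕ.m≤m+n a _))))) = refl
    ...   | true rewrite <ᵇ-true (ℕ.≤-<-trans (<ᵇ⇒< {suc a} {v} p) v<v′) = trans (*-zeroˡ _) (sym (trans (cong (⟦ not
        (b <ᵇ v) ⟧ *_) (*-zeroˡ _)) (*-zeroʳ _)))

  -- Chosen so that ρ 0 + ... + ρ m = r^m; its generating function is (1 - y) / (1 - r y).
  ρ : ℕ → ℤ
  ρ zero = 1ℤ
  ρ (suc f) = (r - 1ℤ) * r ^ f

  private
    sortedAfter? : Maybe Letter → List Letter → Bool
    sortedAfter? nothing w = sorted? _<c_ w
    sortedAfter? (just x) w = sorted? _<c_ (x ∷ w)

    link? : Maybe Letter → Letter → Bool
    link? nothing y = true
    link? (just x) y = x <c y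

    sortedAfter-∷ : ∀ m y w → sortedAfter? m (y ∷ w) ≡ link? m y ∧ sorted? _<c_ (y ∷ w)
    sortedAfter-∷ nothing y w = refl
    sortedAfter-∷ (just x) y w = refl

    sortedAfter-[] : ∀ m → sortedAfter? m [] ≡ true
    sortedAfter-[] nothing = refl
    sortedAfter-[] (just x) = refl

    fixed-letter : ∀ p x → fixed? p x ≡ true → x ≡ (p , 0)
    fixed-letter p (v , e) h with v ≡ᵇ p in e₁ | e ≡ᵇ 0 in e₂
    ... | true | true = cong₂ _,_ (≡ᵇ-true e₁) (≡ᵇ-true e₂)

    valid-fixed : ∀ p → valid? p (p , 0) ≡ true
    valid-fixed p rewrite <ᵇ-false (ℕ.≤-refl {p}) = refl

    sorted-after-fixed : ∀ a w → ⟦ sorted? _<c_ ((a , 0) ∷ w) ⟧ * weight r a w ≡ ⟦ allFixed? a w ⟧ * r ^ length w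
    sorted-after-fixed a [] = refl
    sorted-after-fixed a (y ∷ w) with fixed? (suc a) y in e
    ... | true with fixed-letter (suc a) y e
    ...   | refl rewrite <ᵇ-true (ℕ.n<1+n a) = trans (cong (λ z → ⟦ sorted? _<c_ ((suc a , 0) ∷ w) ⟧ * (z * weight r
        (suc a) w)) letterWeight-fixed)
              (trans (*-exchange _ r _) (trans (cong (r *_) (sorted-after-fixed (suc a) w)) (*-exchange r _ _)))
      where
      letterWeight-fixed : ⟦ valid? (suc a) (suc a , 0) ⟧ * (t ^ 0 * r) ≡ r
      letterWeight-fixed rewrite valid-fixed (suc a) = trans (*-identityˡ _) (*-identityˡ _)
    sorted-after-fixed a ((v , suc c) ∷ w) | false = trans (*-zeroˡ _) (sym (*-zeroˡ _))
    sorted-after-fixed a ((v , zero) ∷ w) | false with a <ᵇ v in p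
    ... | false = trans (*-zeroˡ _) (sym (*-zeroˡ _))
    ... | true with suc a <ᵇ v in p′
    ...   | true = trans (cong (⟦ sorted? _<c_ ((v , 0) ∷ w) ⟧ *_) (trans (cong (_* weight r (suc a) w) (*-zeroˡ _))
        (*-zeroˡ _))) (trans (*-zeroʳ _) (sym (*-zeroˡ _)))
    ...   | false with () ← trans (sym e) (trans (cong (λ z → (z ≡ᵇ suc a) ∧ true) (ℕ.≤-antisym (<ᵇ⇒≥ {suc a} {v} p′)
        (<ᵇ⇒< {a} {v} p))) (cong (_∧ true) (≡ᵇ-refl a)))

    -- The induction carries the preceding letter m. The link condition survives because every valid
    -- letter is smaller than the fixed letter of the next position (`valid-link`); hence a sorted
    -- front part followed by a run of fixed points is again sorted.
    fixed-tail : ∀ m a w → link? m (suc a , 0) ≡ true →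
      ⟦ sortedAfter? m w ⟧ * weight r a w
      ≡ ∑ (cuts w) (λ (u , v) → ⟦ sortedAfter? m u ⟧ * weight 1ℤ a u * (ρ (length v) * ⟦ allFixed?
          (a ℕ.+ length u) v ⟧))
    fixed-tail m a [] _ rewrite sortedAfter-[] m = sym (trans (+-identityʳ _) (trans (cong (1ℤ * 1ℤ *_)
        (*-identityˡ _)) (*-identityʳ _)))
    fixed-tail m a (y ∷ w) ok = begin
      ⟦ sortedAfter? m (y ∷ w) ⟧ * (letterWeight r (suc a) y * weight r (suc a) w)
        ≡⟨ cong (_* (letterWeight r (suc a) y * weight r (suc a) w)) (trans (cong ⟦_⟧ (sortedAfter-∷ m y w)) (⟦∧⟧
            (link? m y) _)) ⟩
      ⟦ link? m y ⟧ * ⟦ sorted? _<c_ (y ∷ w) ⟧ * (letterWeight r (suc a) y * weight r (suc a) w) ≡⟨ core ⟩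
      1ℤ * 1ℤ * (ρ (suc (length w)) * ⟦ fixed? (suc a) y ∧ allFixed? (suc a) w ⟧) + ⟦ link? m y ⟧ * letterWeight 1ℤ
          (suc a) y * S
        ≡⟨ cong₂ _+_ (cong₂ (λ b z → ⟦ b ⟧ * 1ℤ * (ρ (suc (length w)) * ⟦ allFixed? z (y ∷ w) ⟧)) (sym
            (sortedAfter-[] m)) (sym (ℕ.+-identityʳ a))) rest ⟩
      ⟦ sortedAfter? m [] ⟧ * 1ℤ * (ρ (suc (length w)) * ⟦ allFixed? (a ℕ.+ 0) (y ∷ w) ⟧)
        + ∑ (cuts w) (λ (u , v) → ⟦ sortedAfter? m (y ∷ u) ⟧ * weight 1ℤ a (y ∷ u) * (ρ (length v) * ⟦ allFixed?
            (a ℕ.+ suc (length u)) v ⟧))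
        ≡⟨ ∑-cuts y w (λ (u , v) → ⟦ sortedAfter? m u ⟧ * weight 1ℤ a u * (ρ (length v) * ⟦ allFixed?
            (a ℕ.+ length u) v ⟧)) ⟨
      ∑ (cuts (y ∷ w)) (λ (u , v) → ⟦ sortedAfter? m u ⟧ * weight 1ℤ a u * (ρ (length v) * ⟦ allFixed?
          (a ℕ.+ length u) v ⟧)) ∎
      where
      S = ∑ (cuts w) (λ (u , v) → ⟦ sorted? _<c_ (y ∷ u) ⟧ * weight 1ℤ (suc a) u * (ρ (length v) * ⟦ allFixed?
          (suc a ℕ.+ length u) v ⟧))
      opaque
        unfolding _+_
        eq₁ : ∀ k s lw W z → k * s * (lw * W) * z ≡ k * lw * (s * W * z)
        eq₁ = solve-∀
        zero₁ : ∀ a b c x → a * b * (0ℤ * x * c) ≡ 0ℤ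
        zero₁ = solve-∀
        zero₂ : ∀ p k x S → 1ℤ * 1ℤ * (p * 0ℤ) + k * (0ℤ * x) * S ≡ 0ℤ
        zero₂ = solve-∀
        eq₂ : ∀ k s T W p → k * s * (1ℤ * (T * 1ℤ) * W) ≡ 1ℤ * 1ℤ * (p * 0ℤ) + k * (1ℤ * (T * 1ℤ)) * (s * W)
        eq₂ = solve-∀
        eq₃ : ∀ r b R → r * (b * R) ≡ 1ℤ * 1ℤ * ((r - 1ℤ) * R * b) + 1ℤ * 1ℤ * (b * R)
        eq₃ = solve-∀
        eq₄ : ∀ s W r → 1ℤ * s * (r * W) ≡ r * (s * W)
        eq₄ = solve-∀
      rest : ⟦ link? m y ⟧ * letterWeight 1ℤ (suc a) y * S
        ≡ ∑ (cuts w) (λ (u , v) → ⟦ sortedAfter? m (y ∷ u) ⟧ * weight 1ℤ a (y ∷ u) * (ρ (length v) * ⟦ allFixed?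
            (a ℕ.+ suc (length u)) v ⟧))
      rest = trans (sym (∑-*ˡ _ (cuts w) _)) (∑-cong (cuts w) (λ (u , v) → sym (trans (cong₂ (λ b n → b * weight 1ℤ a
          (y ∷ u) * (ρ (length v) * ⟦ allFixed? n v ⟧)) (trans (cong ⟦_⟧ (sortedAfter-∷ m y u)) (⟦∧⟧ (link? m y) _))
          (ℕ.+-suc a (length u))) (eq₁ _ _ _ _ _))))
      ih : link? (just y) (suc (suc a) , 0) ≡ true → S ≡ ⟦ sorted? _<c_ (y ∷ w) ⟧ * weight r (suc a) w
      ih ok′ = sym (fixed-tail (just y) (suc a) w ok′)
      valid-link : ∀ y → valid? (suc a) y ≡ true → link? (just y) (suc (suc a) , 0) ≡ true
      valid-link (v , suc e) h = refl
      valid-link (v , zero) h with suc a <ᵇ v in p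
      ... | false = <ᵇ-true (ℕ.s≤s (<ᵇ⇒≥ {suc a} {v} p))
      core : ⟦ link? m y ⟧ * ⟦ sorted? _<c_ (y ∷ w) ⟧ * (letterWeight r (suc a) y * weight r (suc a) w)
        ≡ 1ℤ * 1ℤ * (ρ (suc (length w)) * ⟦ fixed? (suc a) y ∧ allFixed? (suc a) w ⟧) + ⟦ link? m y ⟧
            * letterWeight 1ℤ (suc a) y * S
      core with fixed? (suc a) y in e
      ... | true with fixed-letter (suc a) y e
      ...   | refl rewrite valid-fixed (suc a) | ok | ih (valid-link (suc a , 0) (valid-fixed
          (suc a))) | sorted-after-fixed (suc a) w =
                trans (cong (1ℤ * ⟦ sorted? _<c_ ((suc a , 0) ∷ w) ⟧ *_) (cong (_* weight r (suc a) w) (trans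
                    (*-identityˡ _) (*-identityˡ r))))
                  (trans (eq₄ _ _ r) (trans (cong (r *_) (sorted-after-fixed (suc a) w)) (trans (eq₃ r _ _)
                    (cong (λ z → 1ℤ * 1ℤ * ((r - 1ℤ) * r ^ length w * ⟦ allFixed? (suc a) w ⟧) + 1ℤ * z * (⟦ allFixed?
                        (suc a) w ⟧ * r ^ length w)) (sym (trans (*-identityˡ _) (*-identityˡ _)))))))
      core | false with valid? (suc a) y in e′
      ... | true rewrite ih (valid-link y e′) = eq₂ _ _ _ _ _
      ... | false = trans (zero₁ _ _ _ _) (sym (zero₂ _ _ _ _))

  -- In a sorted valid block a fixed point at p can only be followed by a letter of color 0 with a
  -- value above p and at most p + 1, hence by a fixed point. So the fixed points form a final run,
  -- and the factor r^m of a run of length m is distributed by `ρ` over the suffixes of the run;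
  -- fixed points left in the front part have weight 1.
  fixed-suffix : ∀ a w → ⟦ sorted? _<c_ w ⟧ * weight r a w
    ≡ ∑ (cuts w) (λ (u , v) → ⟦ sorted? _<c_ u ⟧ * weight 1ℤ a u * (ρ (length v) * ⟦ allFixed? (a ℕ.+ length u) v ⟧))
  fixed-suffix a w = fixed-tail nothing a w refl

  block : ℤ → ℕ → List Letter → ℤ
  block x a u = x ^ length u * (⟦ sorted? _<c_ u ⟧ * weight 1ℤ a u)

  fixBlock : ℤ → ℕ → List Letter → ℤ
  fixBlock x a u = x ^ length u * (ρ (length u) * ⟦ allFixed? a u ⟧)

  -- Each block consists of a sorted part and a marked run of fixed points. The offset a is carried
  -- along because excedances and fixed points refer to absolute positions.
  CW : Vec ℤ M → ℕ → List Letter → ℤ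
  CW [] a w = ⟦ null? w ⟧
  CW (x ∷ xs) a w = ∑ (cuts w) (λ (u , v) → ∑ (cuts v) (λ (φ , v′) →
    block x a u * (fixBlock x (a ℕ.+ length u) φ * CW xs (a ℕ.+ length u ℕ.+ length φ) v′)))

  weight*QL : ∀ (q : ℤ) (xs : Vec ℤ M) a w → weight r a w * QL q xs w ≡ CW xs a w
  weight*QL q [] a [] = *-identityˡ _
  weight*QL q [] a (x ∷ w) = *-zeroʳ _
  weight*QL q (x ∷ xs) a w = begin
    weight r a w * QL q (x ∷ xs) w ≡⟨ ∑-*ˡ _ (cuts w) _ ⟨
    ∑ (cuts w) (λ (u , v) → weight r a w * (x ^ length u * (⟦ sorted? _<c_ u ⟧ * QL q xs v)))
      ≡⟨ ∑-cong-All (cuts-++ w) (λ {(u , v)} e → first u v e) ⟩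
    ∑ (cuts w) (λ (s , v′) → ∑ (cuts s) (λ (u , φ) → block x a u * (fixBlock x (a ℕ.+ length u) φ * CW xs
        (a ℕ.+ length u ℕ.+ length φ) v′)))
      ≡⟨ ∑-cuts-assoc w (λ u φ v′ → block x a u * (fixBlock x (a ℕ.+ length u) φ * CW xs
          (a ℕ.+ length u ℕ.+ length φ) v′)) ⟩
    CW (x ∷ xs) a w ∎
    where
    opaque
      unfolding _+_
      eq₁ : ∀ W V x s Q → W * V * (x * (s * Q)) ≡ x * (V * Q) * (s * W)
      eq₁ = solve-∀
      eq₂ : ∀ x y C s W z → x * y * C * (s * W * z) ≡ x * (s * W) * (y * z * C)
      eq₂ = solve-∀
    first : ∀ s v → s ++ v ≡ w → weight r a w * (x ^ length s * (⟦ sorted? _<c_ s ⟧ * QL q xs v))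
      ≡ ∑ (cuts s) (λ (u , φ) → block x a u * (fixBlock x (a ℕ.+ length u) φ * CW xs (a ℕ.+ length u ℕ.+ length φ) v))
    first s v e = begin
      weight r a w * (x ^ length s * (⟦ sorted? _<c_ s ⟧ * QL q xs v))
        ≡⟨ cong (_* (x ^ length s * (⟦ sorted? _<c_ s ⟧ * QL q xs v))) (trans (cong (weight r a) (sym e))
            (weight-++ r a s v)) ⟩
      weight r a s * weight r (a ℕ.+ length s) v * (x ^ length s * (⟦ sorted? _<c_ s ⟧ * QL q xs v))
          ≡⟨ eq₁ _ _ _ _ _ ⟩
      x ^ length s * (weight r (a ℕ.+ length s) v * QL q xs v) * (⟦ sorted? _<c_ s ⟧ * weight r a s)
        ≡⟨ cong₂ (λ y z → x ^ length s * y * z) (weight*QL q xs (a ℕ.+ length s) v) (fixed-suffix a s) ⟩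
      x ^ length s * CW xs (a ℕ.+ length s) v * ∑ (cuts s) (λ (u , φ) → ⟦ sorted? _<c_ u ⟧ * weight 1ℤ a u * (ρ
          (length φ) * ⟦ allFixed? (a ℕ.+ length u) φ ⟧))
        ≡⟨ ∑-*ˡ _ (cuts s) _ ⟨
      ∑ (cuts s) (λ (u , φ) → x ^ length s * CW xs (a ℕ.+ length s) v * (⟦ sorted? _<c_ u ⟧ * weight 1ℤ a u * (ρ
          (length φ) * ⟦ allFixed? (a ℕ.+ length u) φ ⟧)))
        ≡⟨ ∑-cong-All (cuts-++ s) (λ {(u , φ)} e′ → trans (cong₂ (λ n m → n * CW xs m v * (⟦ sorted? _<c_ u ⟧
            * weight 1ℤ a u * (ρ (length φ) * ⟦ allFixed? (a ℕ.+ length u) φ ⟧)))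
              (trans (cong (x ^_) (sym (∣cut∣ {u = u} e′))) (^-+ x (length u) (length φ))) (trans (cong (a ℕ.+_) (sym
                  (∣cut∣ {u = u} e′))) (sym (ℕ.+-assoc a (length u) (length φ))))) (eq₂ _ _ _ _ _ _)) ⟩
      ∑ (cuts s) (λ (u , φ) → block x a u * (fixBlock x (a ℕ.+ length u) φ * CW xs (a ℕ.+ length u ℕ.+ length φ) v)) ∎

  valueWeight : ℕ → ℕ → ℕ → ℤ
  valueWeight a b v = ∑ (upTo (suc l)) (λ e → ⟦ local? a b (v , e) ⟧ * t ^ e)

  ∑-block : ∀ x a {U} → Sorted U → ∑ (perms (suc l) U) (block x a) ≡ x ^ length U * ∏ U (valueWeight a
      (a ℕ.+ length U))
  ∑-block x a {U} s = begin
    ∑ (perms (suc l) U) (block x a)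
        ≡⟨ ∑-cong-All (All.zip (perms-length (suc l) U , perms-colors (suc l) U)) (λ {π} (e , c) → local π e c) ⟩
    ∑ (perms (suc l) U) (λ π → x ^ length U * (⟦ sorted? _<c_ π ⟧ * ∏ π f)) ≡⟨ ∑-*ˡ _ (perms (suc l) U) _ ⟩
    x ^ length U * ∑ (perms (suc l) U) (λ π → ⟦ sorted? _<c_ π ⟧ * ∏ π f)
        ≡⟨ cong (x ^ length U *_) (∑-perms-sorted (suc l) s f) ⟩
    x ^ length U * ∏ U (valueWeight a (a ℕ.+ length U)) ∎
    where
    f : Letter → ℤ
    f y = ⟦ local? a (a ℕ.+ length U) y ⟧ * t ^ col y
    local : ∀ π → length π ≡ length U → All (λ x → col x < suc l) π → block x a π ≡ x ^ length U * (⟦ sorted? _<c_ π ⟧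
        * ∏ π f)
    local π e c with sorted? _<c_ π in srt
    ... | false = cong₂ (λ n z → x ^ n * z) e (trans (*-zeroˡ _) (sym (*-zeroˡ _)))
    ... | true = cong₂ (λ n z → x ^ n * (1ℤ * z)) e (trans (weight-1 a π) (trans (cong (_* ∏ π (λ x → t ^ col x))
        (validity-local a (a ℕ.+ length U) π (cong (a ℕ.+_) e) c srt)) (sym (∏-* π _ _))))

  ∑-allFixed : ∀ a {U} → Sorted U → ∑ (perms (suc l) U) (λ π → ⟦ allFixed? a π ⟧) ≡ ⟦ eqUp a U ⟧
  ∑-allFixed a [] = +-identityʳ _
  ∑-allFixed a {x ∷ U} (x< ∷ s) = begin
    ∑ (perms (suc l) (x ∷ U)) (λ π → ⟦ allFixed? a π ⟧) ≡⟨ ∑-perms (suc l) x U _ ⟩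
    ∑ (perms (suc l) U) (ins (suc l) x (λ π → ⟦ allFixed? a π ⟧))
        ≡⟨ ∑-cong-All (perms-All (suc l) x<) (λ {π} p → step π p) ⟩
    ∑ (perms (suc l) U) (λ π → ⟦ x ≡ᵇ suc a ⟧ * ⟦ allFixed? (suc a) π ⟧) ≡⟨ ∑-*ˡ _ (perms (suc l) U) _ ⟩
    ⟦ x ≡ᵇ suc a ⟧ * ∑ (perms (suc l) U) (λ π → ⟦ allFixed? (suc a) π ⟧)
        ≡⟨ cong (⟦ x ≡ᵇ suc a ⟧ *_) (∑-allFixed (suc a) s) ⟩
    ⟦ x ≡ᵇ suc a ⟧ * ⟦ eqUp (suc a) U ⟧ ≡⟨ ⟦∧⟧ (x ≡ᵇ suc a) _ ⟨
    ⟦ eqUp a (x ∷ U) ⟧ ∎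
    where
    first : ∀ π → ∑ (upTo (suc l)) (λ e → ⟦ allFixed? a ((x , e) ∷ π) ⟧) ≡ ⟦ x ≡ᵇ suc a ⟧ * ⟦ allFixed? (suc a) π ⟧
    first π = trans (∑-upTo-∷ l (λ e → ⟦ allFixed? a ((x , e) ∷ π) ⟧)) (trans (cong₂ _+_ (zeroColor (x ≡ᵇ suc a))
        (trans (∑-cong (upTo l) (λ e → positive (x ≡ᵇ suc a))) (∑-zero (upTo l)))) (+-identityʳ _))
      where
      zeroColor : ∀ b → ⟦ (b ∧ true) ∧ allFixed? (suc a) π ⟧ ≡ ⟦ b ⟧ * ⟦ allFixed? (suc a) π ⟧
      zeroColor true = sym (*-identityˡ _)
      zeroColor false = sym (*-zeroˡ _)
      positive : ∀ b → ⟦ (b ∧ false) ∧ allFixed? (suc a) π ⟧ ≡ 0ℤ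
      positive true = refl
      positive false = refl
    position : ∀ a α {e} γ → allFixed? a (α ++ (x , e) ∷ γ) ≡ true → x ≡ suc (a ℕ.+ length α)
    position a [] {e} γ h with fixed? (suc a) (x , e) in f
    ... | true = trans (cong proj₁ (fixed-letter (suc a) (x , e) f)) (cong suc (sym (ℕ.+-identityʳ a)))
    position a (y ∷ α) γ h with fixed? (suc a) y
    ... | true = trans (position (suc a) α γ h) (cong suc (sym (ℕ.+-suc a (length α))))
    later : ∀ y α e γ → x < proj₁ y → ⟦ allFixed? a (y ∷ α ++ (x , e) ∷ γ) ⟧ ≡ 0ℤ
    later y α e γ x<y with allFixed? a (y ∷ α ++ (x , e) ∷ γ) in h
    ... | false = refl
    ... | true with fixed? (suc a) y in f
    ... | true with fixed-letter (suc a) y f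
    ... | refl = contradiction (subst (_< suc a) (position (suc a) α γ h) x<y) (ℕ.≤⇒≯ (ℕ.s≤s (ℕ.≤-trans (ℕ.n≤1+n a)
        (ℕ.m≤m+n (suc a) (length α)))))
    step : ∀ π → All (x <_) (values π) → ins (suc l) x (λ π → ⟦ allFixed? a π ⟧) π ≡ ⟦ x ≡ᵇ suc a ⟧ * ⟦ allFixed?
        (suc a) π ⟧
    step [] _ = trans (+-identityʳ _) (first [])
    step (y ∷ π) (x<y ∷ _) = trans (∑-cuts y π (λ (α , γ) → ∑ (upTo (suc l)) (λ e → ⟦ allFixed? a (α ++
        (x , e) ∷ γ) ⟧)))
      (trans (cong₂ _+_ (first (y ∷ π)) (trans (∑-cong (cuts π) (λ (α , γ) → trans (∑-cong (upTo (suc l)) (λ e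
          → later y α e γ x<y)) (∑-zero (upTo (suc l))))) (∑-zero (cuts π)))) (+-identityʳ _))

  ∑-fixBlock : ∀ x a {U} → Sorted U → ∑ (perms (suc l) U) (fixBlock x a) ≡ x ^ length U * (ρ (length U)
      * ⟦ eqUp a U ⟧)
  ∑-fixBlock x a {U} s = begin
    ∑ (perms (suc l) U) (fixBlock x a)
        ≡⟨ ∑-cong-All (perms-length (suc l) U) (λ {π} e → trans (cong (λ n → x ^ n * (ρ n * ⟦ allFixed? a π ⟧)) e)
        (sym (*-assoc _ _ _))) ⟩
    ∑ (perms (suc l) U) (λ π → x ^ length U * ρ (length U) * ⟦ allFixed? a π ⟧) ≡⟨ ∑-*ˡ _ (perms (suc l) U) _ ⟩
    x ^ length U * ρ (length U) * ∑ (perms (suc l) U) (λ π → ⟦ allFixed? a π ⟧)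
        ≡⟨ cong (x ^ length U * ρ (length U) *_) (∑-allFixed a s) ⟩
    x ^ length U * ρ (length U) * ⟦ eqUp a U ⟧ ≡⟨ *-assoc _ _ _ ⟩
    x ^ length U * (ρ (length U) * ⟦ eqUp a U ⟧) ∎

  -- What remains of `CW` after summation over the arrangements and colors: only the sets of values
  -- of the parts.
  CS : Vec ℤ M → ℕ → List ℕ → ℤ
  CS [] a R = ⟦ null? R ⟧
  CS (x ∷ xs) a R = ∑ (splits R) (λ (U , V) → ∑ (splits V) (λ (J , V′) →
    (x ^ length U * ∏ U (valueWeight a (a ℕ.+ length U)))
    * ((x ^ length J * (ρ (length J) * ⟦ eqUp (a ℕ.+ length U) J ⟧)) * CS xs (a ℕ.+ length U ℕ.+ length J) V′)))

  ∑-CW : ∀ (xs : Vec ℤ M) a {R} → Sorted R → ∑ (perms (suc l) R) (CW xs a) ≡ CS xs a R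
  ∑-CW [] a {R} s = ∑-perms-null (suc l) R
  ∑-CW (x ∷ xs) a {R} s = begin
    ∑ (perms (suc l) R) (CW (x ∷ xs) a)
      ≡⟨ ∑-perms-cuts₁ (suc l) s (λ u v → ∑ (cuts v) (λ (φ , v′) → block x a u * (fixBlock x (a ℕ.+ length u) φ
          * CW xs (a ℕ.+ length u ℕ.+ length φ) v′))) ⟩
    ∑ (splits R) (λ (U , V) → ∑ (perms (suc l) U) (λ u → ∑ (perms (suc l) V) (λ v → ∑ (cuts v) (λ (φ , v′)
        → block x a u * (fixBlock x (a ℕ.+ length u) φ * CW xs (a ℕ.+ length u ℕ.+ length φ) v′)))))
      ≡⟨ ∑-cong-All (splits-sorted s) (λ {(U , V)} (sU , sV) → outer U V sU sV) ⟩
    CS (x ∷ xs) a R ∎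
    where
    inner : ∀ a′ V → Sorted V → ∑ (perms (suc l) V) (λ v → ∑ (cuts v) (λ (φ , v′) → fixBlock x a′ φ * CW xs
        (a′ ℕ.+ length φ) v′))
      ≡ ∑ (splits V) (λ (J , V′) → (x ^ length J * (ρ (length J) * ⟦ eqUp a′ J ⟧)) * CS xs (a′ ℕ.+ length J) V′)
    inner a′ V s = trans (∑-perms-cuts₁ (suc l) s (λ φ v′ → fixBlock x a′ φ * CW xs (a′ ℕ.+ length φ) v′))
      (∑-cong-All (splits-sorted s) (λ {(J , V′)} (sJ , sV′) → begin
        ∑ (perms (suc l) J) (λ φ → ∑ (perms (suc l) V′) (λ v′ → fixBlock x a′ φ * CW xs (a′ ℕ.+ length φ) v′))
          ≡⟨ ∑-cong-All (perms-length (suc l) J) (λ {φ} e → trans (∑-*ˡ _ (perms (suc l) V′) _) (cong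
              (fixBlock x a′ φ *_) (trans (cong (λ n → ∑ (perms (suc l) V′) (CW xs (a′ ℕ.+ n))) e)
              (∑-CW xs _ sV′)))) ⟩
        ∑ (perms (suc l) J) (λ φ → fixBlock x a′ φ * CS xs (a′ ℕ.+ length J) V′) ≡⟨ ∑-*ʳ _ (perms (suc l) J) _ ⟩
        ∑ (perms (suc l) J) (fixBlock x a′) * CS xs (a′ ℕ.+ length J) V′
            ≡⟨ cong (_* CS xs (a′ ℕ.+ length J) V′) (∑-fixBlock x a′ sJ) ⟩
        (x ^ length J * (ρ (length J) * ⟦ eqUp a′ J ⟧)) * CS xs (a′ ℕ.+ length J) V′ ∎))
    outer : ∀ U V → Sorted U → Sorted V →
      ∑ (perms (suc l) U) (λ u → ∑ (perms (suc l) V) (λ v → ∑ (cuts v) (λ (φ , v′) → block x a u * (fixBlock x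
          (a ℕ.+ length u) φ * CW xs (a ℕ.+ length u ℕ.+ length φ) v′))))
      ≡ ∑ (splits V) (λ (J , V′) → (x ^ length U * ∏ U (valueWeight a (a ℕ.+ length U))) * ((x ^ length J * (ρ
          (length J) * ⟦ eqUp (a ℕ.+ length U) J ⟧)) * CS xs (a ℕ.+ length U ℕ.+ length J) V′))
    outer U V sU sV = begin
      ∑ (perms (suc l) U) (λ u → ∑ (perms (suc l) V) (λ v → ∑ (cuts v) (λ (φ , v′) → block x a u * (fixBlock x
          (a ℕ.+ length u) φ * CW xs (a ℕ.+ length u ℕ.+ length φ) v′))))
        ≡⟨ ∑-cong-All (perms-length (suc l) U) (λ {u} e → trans (∑-cong (perms (suc l) V) (λ v → ∑-*ˡ _ (cuts v) _))
            (trans (∑-*ˡ _ (perms (suc l) V) _)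
             (cong (block x a u *_) (trans (cong (λ n → ∑ (perms (suc l) V) (λ v → ∑ (cuts v) (λ (φ , v′) → fixBlock x
                 (a ℕ.+ n) φ * CW xs (a ℕ.+ n ℕ.+ length φ) v′))) e) (inner (a ℕ.+ length U) V sV))))) ⟩
      ∑ (perms (suc l) U) (λ u → block x a u * C) ≡⟨ ∑-*ʳ C (perms (suc l) U) _ ⟩
      ∑ (perms (suc l) U) (block x a) * C ≡⟨ cong (_* C) (∑-block x a sU) ⟩
      (x ^ length U * ∏ U (valueWeight a (a ℕ.+ length U))) * C ≡⟨ ∑-*ˡ _ (splits V) _ ⟨
      ∑ (splits V) (λ (J , V′) → (x ^ length U * ∏ U (valueWeight a (a ℕ.+ length U))) * ((x ^ length J * (ρ
          (length J) * ⟦ eqUp (a ℕ.+ length U) J ⟧)) * CS xs (a ℕ.+ length U ℕ.+ length J) V′)) ∎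
      where
      C = ∑ (splits V) (λ (J , V′) → (x ^ length J * (ρ (length J) * ⟦ eqUp (a ℕ.+ length U) J ⟧)) * CS xs
          (a ℕ.+ length U ℕ.+ length J) V′)

-- Blocks as linear forms

∑-antidiag-exchange : ∀ n (f : ℕ → ℕ → ℕ → ℤ) →
  ∑ (antidiag n) (λ (a , i) → ∑ (antidiag i) (λ (b , c) → f a b c))
  ≡ ∑ (antidiag n) (λ (b , i) → ∑ (antidiag i) (λ (a , c) → f a b c))
∑-antidiag-exchange n f = begin
  ∑ (antidiag n) (λ (a , i) → ∑ (antidiag i) (λ (b , c) → f a b c)) ≡⟨ ∑-antidiag-assoc n f ⟨
  ∑ (antidiag n) (λ (s , c) → ∑ (antidiag s) (λ (a , b) → f a b c))
      ≡⟨ ∑-cong (antidiag n) (λ (s , c) → ∑-antidiag-comm s (λ a b → f a b c)) ⟩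
  ∑ (antidiag n) (λ (s , c) → ∑ (antidiag s) (λ (b , a) → f a b c)) ≡⟨ ∑-antidiag-assoc n (λ b a c → f a b c) ⟩
  ∑ (antidiag n) (λ (b , i) → ∑ (antidiag i) (λ (a , c) → f a b c)) ∎

∑-antidiag-δ : ∀ a b {n} → a ℕ.+ b ≡ n → (f : ℕ → ℕ → ℤ) → ∑ (antidiag n) (λ (i , j) → ⟦ a ≡ᵇ i ⟧ * f i j) ≡ f a b
∑-antidiag-δ zero zero refl f = trans (+-identityʳ _) (*-identityˡ _)
∑-antidiag-δ zero (suc b) refl f = trans (∑-antidiag b (λ (i , j) → ⟦ 0 ≡ᵇ i ⟧ * f i j))
  (trans (cong₂ _+_ (*-identityˡ _) (trans (∑-cong (antidiag b) (λ (i , j) → *-zeroˡ _)) (∑-zero (antidiag b))))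
      (+-identityʳ _))
∑-antidiag-δ (suc a) b refl f = trans (∑-antidiag (a ℕ.+ b) (λ (i , j) → ⟦ suc a ≡ᵇ i ⟧ * f i j))
  (trans (cong₂ _+_ (*-zeroˡ _) (∑-antidiag-δ a b refl (f ∘ suc))) (+-identityˡ _))

∑-splits-comm : (R : List A) (f : List A → List A → List A → ℤ) →
  ∑ (splits R) (λ (u , v) → ∑ (splits v) (λ (u′ , v′) → f u u′ v′))
  ≡ ∑ (splits R) (λ (u′ , v) → ∑ (splits v) (λ (u , v′) → f u u′ v′))
∑-splits-comm [] f = refl
∑-splits-comm (x ∷ R) f = begin
  ∑ (splits (x ∷ R)) (λ (u , v) → ∑ (splits v) (λ (u′ , v′) → f u u′ v′)) ≡⟨ unfold f ⟩
  S (λ u u′ v′ → f (x ∷ u) u′ v′) + (S (λ u u′ v′ → f u (x ∷ u′) v′) + S (λ u u′ v′ → f u u′ (x ∷ v′)))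
    ≡⟨ cong₂ _+_ (∑-splits-comm R (λ u u′ v′ → f (x ∷ u) u′ v′)) (cong₂ _+_ (∑-splits-comm R (λ u u′ v′ → f u
        (x ∷ u′) v′)) (∑-splits-comm R (λ u u′ v′ → f u u′ (x ∷ v′)))) ⟩
  S (λ u′ u v′ → f (x ∷ u) u′ v′) + (S (λ u′ u v′ → f u (x ∷ u′) v′) + S (λ u′ u v′ → f u u′ (x ∷ v′))) ≡⟨ eq _ _ _ ⟩
  S (λ u′ u v′ → f u (x ∷ u′) v′) + (S (λ u′ u v′ → f (x ∷ u) u′ v′) + S (λ u′ u v′ → f u u′ (x ∷ v′)))
      ≡⟨ unfold (λ u′ u v′ → f u u′ v′) ⟨
  ∑ (splits (x ∷ R)) (λ (u′ , v) → ∑ (splits v) (λ (u , v′) → f u u′ v′)) ∎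
  where
  opaque
    unfolding _+_
    eq : ∀ a b c → a + (b + c) ≡ b + (a + c)
    eq = solve-∀
  S : (List _ → List _ → List _ → ℤ) → ℤ
  S g = ∑ (splits R) (λ (u , v) → ∑ (splits v) (λ (u′ , v′) → g u u′ v′))
  unfold : ∀ g → ∑ (splits (x ∷ R)) (λ (u , v) → ∑ (splits v) (λ (u′ , v′) → g u u′ v′))
    ≡ S (λ u u′ v′ → g (x ∷ u) u′ v′) + (S (λ u u′ v′ → g u (x ∷ u′) v′) + S (λ u u′ v′ → g u u′ (x ∷ v′)))
  unfold g = trans (∑-splits x R (λ (u , v) → ∑ (splits v) (λ (u′ , v′) → g u u′ v′)))
    (cong (S (λ u u′ v′ → g (x ∷ u) u′ v′) +_) (trans (∑-cong (splits R) (λ (u , v) → ∑-splits x v (λ (u′ , v′)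
        → g u u′ v′))) (∑-+ (splits R) _ _)))

-- sum over the ordered partitions of R with the given weights of the parts
MS : List (List ℕ → ℤ) → List ℕ → ℤ
MS [] R = ⟦ null? R ⟧
MS (w ∷ ws) R = ∑ (splits R) (λ (u , v) → w u * MS ws v)

MS-swap : ∀ w w′ ws R → MS (w ∷ w′ ∷ ws) R ≡ MS (w′ ∷ w ∷ ws) R
MS-swap w w′ ws R = begin
  MS (w ∷ w′ ∷ ws) R ≡⟨ ∑-cong (splits R) (λ (u , v) → sym (∑-*ˡ (w u) (splits v) _)) ⟩
  ∑ (splits R) (λ (u , v) → ∑ (splits v) (λ (u′ , v′) → w u * (w′ u′ * MS ws v′)))
      ≡⟨ ∑-splits-comm R (λ u u′ v′ → w u * (w′ u′ * MS ws v′)) ⟩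
  ∑ (splits R) (λ (u′ , v) → ∑ (splits v) (λ (u , v′) → w u * (w′ u′ * MS ws v′)))
    ≡⟨ ∑-cong (splits R) (λ (u′ , v) → trans (∑-cong (splits v) (λ (u , v′) → *-exchange _ _ _)) (∑-*ˡ (w′ u′)
        (splits v) _)) ⟩
  MS (w′ ∷ w ∷ ws) R ∎

MS-front : ∀ bs w cs R → MS (bs ++ w ∷ cs) R ≡ MS (w ∷ bs ++ cs) R
MS-front [] w cs R = refl
MS-front (b ∷ bs) w cs R = trans (∑-cong (splits R) (λ (u , v) → cong (b u *_) (MS-front bs w cs v))) (MS-swap b w
    (bs ++ cs) R)

up : ℕ → ℕ → List ℕ
up a zero = []
up a (suc n) = suc a ∷ up (suc a) n

up-++ : ∀ a m n → up a (m ℕ.+ n) ≡ up a m ++ up (a ℕ.+ m) n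
up-++ a zero n = cong (λ z → up z n) (sym (ℕ.+-identityʳ a))
up-++ a (suc m) n = cong (suc a ∷_) (trans (up-++ (suc a) m n) (cong (λ z → up (suc a) m ++ up z n) (sym
    (ℕ.+-suc a m))))

up-> : ∀ a n → All (a <_) (up a n)
up-> a zero = []
up-> a (suc n) = ℕ.n<1+n a ∷ All.map (ℕ.<-trans (ℕ.n<1+n a)) (up-> (suc a) n)

up-≤ : ∀ a n → All (_≤ a ℕ.+ n) (up a n)
up-≤ a zero = []
up-≤ a (suc n) = subst (suc a ≤_) (sym (ℕ.+-suc a n)) (ℕ.s≤s (ℕ.m≤m+n a n)) ∷ subst (λ z → All (_≤ z) (up (suc a) n))
    (sym (ℕ.+-suc a n)) (up-≤ (suc a) n)

length-up : ∀ a n → length (up a n) ≡ n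
length-up a zero = refl
length-up a (suc n) = cong suc (length-up (suc a) n)

upTo≡up : ∀ n → map suc (upTo n) ≡ up 0 n
upTo≡up n = trans (List.map-upTo suc n) (apply suc 0 n (λ _ → refl))
  where
  apply : ∀ f a n → (∀ i → f i ≡ suc a ℕ.+ i) → applyUpTo f n ≡ up a n
  apply f a zero e = refl
  apply f a (suc n) e = cong₂ _∷_ (trans (e 0) (ℕ.+-identityʳ _)) (apply (f ∘ suc) (suc a) n (λ i → trans (e (suc i))
      (ℕ.+-suc (suc a) i)))

isUp : ℕ → ℕ → List ℕ → Bool
isUp a zero [] = true
isUp a zero (_ ∷ _) = false
isUp a (suc n) [] = false
isUp a (suc n) (u ∷ U) = (u ≡ᵇ suc a) ∧ isUp (suc a) n U

isUp-eqUp : ∀ a n U → ⟦ isUp a n U ⟧ ≡ ⟦ length U ≡ᵇ n ⟧ * ⟦ eqUp a U ⟧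
isUp-eqUp a zero [] = sym (*-identityˡ _)
isUp-eqUp a zero (_ ∷ _) = sym (*-zeroˡ _)
isUp-eqUp a (suc n) [] = sym (*-zeroˡ _)
isUp-eqUp a (suc n) (u ∷ U) with u ≡ᵇ suc a
... | true = isUp-eqUp (suc a) n U
... | false = sym (*-zeroʳ _)

extract : ∀ a n (A B : List ℕ) → All (_≤ a) A → All (a ℕ.+ n <_) B → (H : List ℕ → ℤ) →
  ∑ (splits (A ++ up a n ++ B)) (λ (u , v) → ⟦ isUp a n u ⟧ * H v) ≡ H (A ++ B)
extract a n (x ∷ A) B (p ∷ ps) q H = trans (∑-splits x (A ++ up a n ++ B) (λ (u , v) → ⟦ isUp a n u ⟧ * H v))
  (trans (cong₂ _+_ (trans (∑-cong (splits (A ++ up a n ++ B)) (λ (u , v) → vanish n u v)) (∑-zero (splits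
      (A ++ up a n ++ B)))) (extract a n A B ps q (H ∘ (x ∷_)))) (+-identityˡ _))
  where
  vanish : ∀ n u v → ⟦ isUp a n (x ∷ u) ⟧ * H v ≡ 0ℤ
  vanish zero u v = *-zeroˡ _
  vanish (suc n) u v rewrite ≡ᵇ-false (ℕ.<⇒≢ (ℕ.s≤s p)) = *-zeroˡ _
extract a zero [] [] _ q H = trans (+-identityʳ _) (*-identityˡ _)
extract a zero [] (y ∷ B) _ (_ ∷ q) H = trans (∑-splits y B (λ (u , v) → ⟦ isUp a 0 u ⟧ * H v))
  (trans (cong₂ _+_ (trans (∑-cong (splits B) (λ (u , v) → *-zeroˡ _)) (∑-zero (splits B))) (extract a zero [] B [] q
      (H ∘ (y ∷_)))) (+-identityˡ _))
extract a (suc n) [] B _ q H = trans (∑-splits (suc a) (up (suc a) n ++ B) (λ (u , v) → ⟦ isUp a (suc n) u ⟧ * H v))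
  (trans (cong₂ _+_ (trans (∑-cong (splits (up (suc a) n ++ B)) (λ (u , v) → cong (λ b → ⟦ b ∧ isUp (suc a) n u ⟧
      * H v) (≡ᵇ-refl a))) (extract (suc a) n [] B [] (subst (λ z → All (z <_) B) (ℕ.+-suc a n) q) H))
    (trans (∑-cong-All (splits-All {P = suc a <_} (All.++⁺ (up-> (suc a) n) (All.map (ℕ.≤-<-trans (subst (suc a ≤_)
        (sym (ℕ.+-suc a n)) (ℕ.s≤s (ℕ.m≤m+n a n)))) q))) (λ {(u , v)} (p , _) → vanish u (H (suc a ∷ v)) p)) (∑-zero
        (splits (up (suc a) n ++ B))))) (+-identityʳ _))
  where
  vanish : ∀ u z → All (suc a <_) u → ⟦ isUp a (suc n) u ⟧ * z ≡ 0ℤ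
  vanish [] z _ = *-zeroˡ _
  vanish (x ∷ u) z (p ∷ _) rewrite ≡ᵇ-false (ℕ.>⇒≢ p) = *-zeroˡ _

infixr 5 _∷ᶠ_
_∷ᶠ_ : ℤ → Form M → Form (suc M)
(y ∷ᶠ ℓ) zero = y
(y ∷ᶠ ℓ) (suc j) = ℓ j

-- Expands the product with respect to its first variable: the first part of a split collects the
-- values whose forms contribute this variable.
Co-splits : (y : ℕ → ℤ) (ℓ : ℕ → Form M) (R : List ℕ) (d : ℕ) (c : Vec ℕ M) →
  Co (map (λ v → y v ∷ᶠ ℓ v) R) (d ∷ c) ≡ ∑ (splits R) (λ (u , v) → ⟦ length u ≡ᵇ d ⟧ * ∏ u y * Co (map ℓ v) c)
Co-splits y ℓ [] zero c = sym (trans (+-identityʳ _) (trans (cong (_* ⟦ allZero c ⟧) (*-identityˡ _))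
    (*-identityˡ _)))
Co-splits y ℓ [] (suc d) c = sym (trans (+-identityʳ _) (trans (cong (_* ⟦ allZero c ⟧) (*-zeroˡ _)) (*-zeroˡ _)))
Co-splits {M} y ℓ (x ∷ R) d c = begin
  Co (map (λ v → y v ∷ᶠ ℓ v) (x ∷ R)) (d ∷ c)
      ≡⟨ ∑-allFin M (λ j → (y x ∷ᶠ ℓ x) j * at (Co (map (λ v → y v ∷ᶠ ℓ v) R)) (dec j (d ∷ c))) ⟩
  y x * at (Co (map (λ v → y v ∷ᶠ ℓ v) R)) (dec zero (d ∷ c)) + ∑ (allFin M) (λ j → ℓ x j * at (Co (map (λ v
      → y v ∷ᶠ ℓ v) R)) (dec (suc j) (d ∷ c)))
    ≡⟨ cong₂ _+_ (first d) (∑-cong (allFin M) (λ j → cong (ℓ x j *_) (trans (at-map (d ∷_) _ (dec j c)) (trans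
        (at-cong (dec j c) (λ {c′} _ → Co-splits y ℓ R d c′))
         (trans (at-∑ (splits R) (λ (u , v) c′ → ⟦ length u ≡ᵇ d ⟧ * ∏ u y * Co (map ℓ v) c′) (dec j c)) (∑-cong
             (splits R) (λ (u , v) → at-* (⟦ length u ≡ᵇ d ⟧ * ∏ u y) _ (dec j c)))))))) ⟩
  ∑ (splits R) (λ (u , v) → ⟦ suc (length u) ≡ᵇ d ⟧ * (y x * ∏ u y) * Co (map ℓ v) c)
    + ∑ (allFin M) (λ j → ℓ x j * ∑ (splits R) (λ (u , v) → ⟦ length u ≡ᵇ d ⟧ * ∏ u y * at (Co (map ℓ v)) (dec j c)))
    ≡⟨ cong (∑ (splits R) (λ (u , v) → ⟦ suc (length u) ≡ᵇ d ⟧ * (y x * ∏ u y) * Co (map ℓ v) c) +_) second ⟩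
  ∑ (splits R) (λ (u , v) → ⟦ suc (length u) ≡ᵇ d ⟧ * (y x * ∏ u y) * Co (map ℓ v) c)
    + ∑ (splits R) (λ (u , v) → ⟦ length u ≡ᵇ d ⟧ * ∏ u y * Co (map ℓ (x ∷ v)) c)
        ≡⟨ ∑-splits x R (λ (u , v) → ⟦ length u ≡ᵇ d ⟧ * ∏ u y * Co (map ℓ v) c) ⟨
  ∑ (splits (x ∷ R)) (λ (u , v) → ⟦ length u ≡ᵇ d ⟧ * ∏ u y * Co (map ℓ v) c) ∎
  where
  opaque
    unfolding _+_
    eq₁ : ∀ y b p C → y * (b * p * C) ≡ b * (y * p) * C
    eq₁ = solve-∀
  first : ∀ d → y x * at (Co (map (λ v → y v ∷ᶠ ℓ v) R)) (dec zero (d ∷ c)) ≡ ∑ (splits R) (λ (u , v) → ⟦ suc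
      (length u) ≡ᵇ d ⟧ * (y x * ∏ u y) * Co (map ℓ v) c)
  first zero = trans (*-zeroʳ _) (sym (trans (∑-cong (splits R) (λ (u , v) → trans (cong (_* Co (map ℓ v) c)
      (*-zeroˡ _)) (*-zeroˡ _))) (∑-zero (splits R))))
  first (suc d) = trans (cong (y x *_) (Co-splits y ℓ R d c)) (trans (sym (∑-*ˡ (y x) (splits R) _)) (∑-cong
      (splits R) (λ (u , v) → eq₁ _ _ _ _)))
  second : ∑ (allFin M) (λ j → ℓ x j * ∑ (splits R) (λ (u , v) → ⟦ length u ≡ᵇ d ⟧ * ∏ u y * at (Co (map ℓ v))
      (dec j c)))
    ≡ ∑ (splits R) (λ (u , v) → ⟦ length u ≡ᵇ d ⟧ * ∏ u y * Co (map ℓ (x ∷ v)) c)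
  second = trans (∑-cong (allFin M) (λ j → sym (∑-*ˡ (ℓ x j) (splits R) _))) (trans (∑-swap (allFin M) (splits R) _)
    (∑-cong (splits R) (λ (u , v) → trans (∑-cong (allFin M) (λ j → *-exchange _ _ _)) (∑-*ˡ _ (allFin M) _))))

infix 4 _≐_
_≐_ : List (Form M) → List (Form M) → Set
_≐_ = Pointwise (λ ℓ ℓ′ → ∀ j → ℓ j ≡ ℓ′ j)

Co-cong : ∀ {ℓs ℓs′ : List (Form M)} → ℓs ≐ ℓs′ → Co ℓs ≗ Co ℓs′
Co-cong [] c = refl
Co-cong {M} (e ∷ es) c = ∑-cong (allFin M) (λ j → cong₂ _*_ (e j) (at-cong (dec j c) (λ {d} _ → Co-cong es d)))

-- From block decompositions to coefficients of linear forms

module Extraction (k : ℕ) (t r : ℤ) where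

  open Keys k
  open Blocks k t r

  T g : ℤ
  T = t ^ l
  g = ∑ (upTo l) (t ^_)

  open Walk t g T

  -- the weight with which the value v can be placed in a block on the positions a+1,...,a+d
  site : ℕ → ℕ → ℕ → ℤ
  site a d v = if a <ᵇ v then (if a ℕ.+ d <ᵇ v then t * g else (if suc a <ᵇ v then g + T * 1ℤ else g)) else g

  -- Values up to a + 1 allow the colors 0, ..., l-1, values above the block the colors 1, ..., l,
  -- and those in between all l + 1 colors. The length is a successor because for an empty block the
  -- two descriptions disagree at v = a + 1; an empty block has no values to compare.
  valueWeight-site : ∀ a d v → valueWeight a (a ℕ.+ suc d) v ≡ site a (suc d) v
  valueWeight-site a d v = begin
    valueWeight a b v ≡⟨ ∑-upTo-∷ l f ⟩
    f 0 + ∑ (upTo l) (f ∘ suc) ≡⟨ cong (f 0 +_) (∑-upTo-∷ʳ k (f ∘ suc)) ⟩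
    f 0 + (∑ (upTo k) (f ∘ suc) + f l)
        ≡⟨ cong₂ (λ x y → f 0 + (x + y)) (∑-cong-All (All.applyUpTo⁺₁ id k id) (λ {e} → middle e)) last ⟩
    ⟦ not (b <ᵇ v) ⟧ * 1ℤ + (S + ⟦ suc a <ᵇ v ⟧ * T) ≡⟨ cases ⟩
    site a (suc d) v ∎
    where
    b = a ℕ.+ suc d
    f : ℕ → ℤ
    f e = ⟦ local? a b (v , e) ⟧ * t ^ e
    S = ∑ (upTo k) (λ e → t ^ suc e)
    a<b : suc a ≤ b
    a<b = subst (suc a ≤_) (sym (ℕ.+-suc a d)) (ℕ.s≤s (ℕ.m≤m+n a d))
    middle : ∀ e → e < k → f (suc e) ≡ t ^ suc e
    middle e e<k rewrite ≡ᵇ-false (ℕ.<⇒≢ e<k) = *-identityˡ _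
    last : f l ≡ ⟦ suc a <ᵇ v ⟧ * T
    last rewrite ≡ᵇ-refl k = refl
    g-∷ : g ≡ 1ℤ + S
    g-∷ = ∑-upTo-∷ k (t ^_)
    t*g : t * g ≡ S + T
    t*g = trans (sym (∑-*ˡ t (upTo l) _)) (∑-upTo-∷ʳ k (λ e → t ^ suc e))
    opaque
      unfolding _+_
      eq₁ : ∀ S T → 0ℤ * 1ℤ + (S + 1ℤ * T) ≡ S + T
      eq₁ = solve-∀
      eq₂ : ∀ S T → 1ℤ * 1ℤ + (S + 1ℤ * T) ≡ (1ℤ + S) + T * 1ℤ
      eq₂ = solve-∀
      eq₃ : ∀ S T → 1ℤ * 1ℤ + (S + 0ℤ * T) ≡ 1ℤ + S
      eq₃ = solve-∀
    cases : ⟦ not (b <ᵇ v) ⟧ * 1ℤ + (S + ⟦ suc a <ᵇ v ⟧ * T) ≡ site a (suc d) v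
    cases with b <ᵇ v in p
    ... | true rewrite <ᵇ-true (ℕ.≤-<-trans a<b (<ᵇ⇒< {b} {v} p)) | <ᵇ-true (ℕ.<-trans a<b (<ᵇ⇒< {b} {v} p)) = trans
        (eq₁ S T) (sym t*g)
    ... | false with suc a <ᵇ v in p′
    ...   | true rewrite <ᵇ-true (ℕ.<-trans (ℕ.n<1+n a) (<ᵇ⇒< {suc a} {v} p′)) = trans (eq₂ S T) (cong (_+ T * 1ℤ)
        (sym g-∷))
    ...   | false with a <ᵇ v
    ...     | true = trans (eq₃ S T) (sym g-∷)
    ...     | false = trans (eq₃ S T) (sym g-∷)

  ∏-site : ∀ a U → ∏ U (valueWeight a (a ℕ.+ length U)) ≡ ∏ U (site a (length U))
  ∏-site a [] = refl
  ∏-site a U@(_ ∷ U′) = ∏-cong-All (All.universal (λ v → valueWeight-site a (length U′) v) U) id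

  N : ℕ → ℕ → List ℕ → ℤ
  N a d U = ⟦ length U ≡ᵇ d ⟧ * ∏ U (site a d)

  -- `NFs` has an extra part for each run of fixed points. `Ns` drops these parts but keeps the
  -- offsets, so the remaining values are still compared with the original positions.
  Ns NFs : Vec ℕ M → Vec ℕ M → ℕ → List (List ℕ → ℤ)
  Ns [] [] a = []
  Ns (d ∷ ds) (f ∷ fs) a = N a d ∷ Ns ds fs (a ℕ.+ d ℕ.+ f)
  NFs [] [] a = []
  NFs (d ∷ ds) (f ∷ fs) a = N a d ∷ (λ J → ⟦ isUp (a ℕ.+ d) f J ⟧) ∷ NFs ds fs (a ℕ.+ d ℕ.+ f)

  ϱ : Vec ℕ M → ℤ
  ϱ [] = 1ℤ
  ϱ (f ∷ fs) = ρ f * ϱ fs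

  sized : Vec ℤ M → ℕ → List ℕ → ℕ → ℕ → ℤ
  sized {M} xs a R m n = ∑ (comps M m) (λ ds → ∑ (comps M n) (λ fs → mono xs ds * (mono xs fs * ϱ fs) * MS
      (NFs ds fs a) R))

  -- Once the sizes of all parts are prescribed, the offsets are constants and the weight of a value
  -- no longer depends on the rest of the split. Only then does a value define a linear form.
  CS-sized : ∀ (xs : Vec ℤ M) a R → CS xs a R ≡ ∑ (antidiag (length R)) (λ (m , n) → sized xs a R m n)
  CS-sized [] a [] = sym (trans (+-identityʳ _) (trans (+-identityʳ _) (trans (+-identityʳ _) (trans (cong (_* 1ℤ)
      (trans (*-identityˡ _) (*-identityˡ _))) (*-identityˡ _)))))
  CS-sized [] a (x ∷ R) = sym (trans (∑-cong (antidiag (suc (length R))) zeros) (∑-zero (antidiag (suc (length R)))))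
    where
    zeros : ∀ p → sized [] a (x ∷ R) (proj₁ p) (proj₂ p) ≡ 0ℤ
    zeros (zero , zero) = trans (+-identityʳ _) (trans (+-identityʳ _) (*-zeroʳ _))
    zeros (zero , suc n) = +-identityʳ _
    zeros (suc m , n) = refl
  CS-sized {suc M} (x ∷ xs) a R = sym (begin
    ∑ (antidiag n) (λ (m , k) → sized (x ∷ xs) a R m k) ≡⟨ ∑-cong (antidiag n) (λ (m , k) → expand m k) ⟩
    ∑ (antidiag n) (λ (m , k) → ∑ (antidiag m) (λ (d , m′) → ∑ (antidiag k) (λ (f , k′) → K d m′ f k′)))
      ≡⟨ ∑-antidiag-assoc n (λ d m′ k → ∑ (antidiag k) (λ (f , k′) → K d m′ f k′)) ⟩
    ∑ (antidiag n) (λ (d , j) → ∑ (antidiag j) (λ (m′ , k) → ∑ (antidiag k) (λ (f , k′) → K d m′ f k′)))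
      ≡⟨ ∑-cong (antidiag n) (λ (d , j) → ∑-antidiag-exchange j (K d)) ⟩
    ∑ (antidiag n) (λ (d , j) → ∑ (antidiag j) (λ (f , i) → ∑ (antidiag i) (λ (m′ , k′) → K d m′ f k′)))
      ≡⟨ ∑-cong (antidiag n) (λ (d , j) → trans (∑-cong (antidiag j) (λ (f , i) → pull d f i)) (trans (∑-swap
          (antidiag j) (splits R) _) (∑-cong (splits R) (λ (U , V) → ∑-swap (antidiag j) (splits V) _)))) ⟩
    ∑ (antidiag n) (λ (d , j) → ∑ (splits R) (λ (U , V) → ∑ (splits V) (λ (J , V′) → ∑ (antidiag j) (λ (f , i)
        → G U J V′ d f i))))
      ≡⟨ trans (∑-swap (antidiag n) (splits R) _) (∑-cong (splits R) (λ (U , V) → ∑-swap (antidiag n) (splits V) _)) ⟩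
    ∑ (splits R) (λ (U , V) → ∑ (splits V) (λ (J , V′) → ∑ (antidiag n) (λ (d , j) → ∑ (antidiag j) (λ (f , i)
        → G U J V′ d f i))))
      ≡⟨ ∑-cong-All (splits-length R) (λ {(U , V)} e → ∑-cong-All (splits-length V) (λ {(J , V′)} e′
          → collapse U V J V′ e e′)) ⟩
    CS (x ∷ xs) a R ∎)
    where
    n = length R
    K : ℕ → ℕ → ℕ → ℕ → ℤ
    K d m′ f k′ = ∑ (comps M m′) (λ ds → ∑ (comps M k′) (λ fs → x ^ d * mono xs ds * (x ^ f * mono xs fs * (ρ f
        * ϱ fs)) * MS (NFs (d ∷ ds) (f ∷ fs) a) R))
    G : List ℕ → List ℕ → List ℕ → ℕ → ℕ → ℕ → ℤ
    G U J V′ d f i = ⟦ length U ≡ᵇ d ⟧ * (⟦ length J ≡ᵇ f ⟧ * (⟦ eqUp (a ℕ.+ d) J ⟧ * (x ^ d * ∏ U (site a d) * (x ^ f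
        * ρ f * ∑ (antidiag i) (λ (m′ , k′) → sized xs (a ℕ.+ d ℕ.+ f) V′ m′ k′)))))
    expand : ∀ m k → sized (x ∷ xs) a R m k ≡ ∑ (antidiag m) (λ (d , m′) → ∑ (antidiag k) (λ (f , k′) → K d m′ f k′))
    expand m k = trans (∑-comps M m _) (∑-cong (antidiag m) (λ (d , m′) → trans (∑-cong (comps M m′) (λ ds
        → ∑-comps M k _)) (∑-swap (comps M m′) (antidiag k) _)))
    opaque
      unfolding _+_
      eq₁ : ∀ X m Y n r ϱ b P c Z → X * m * (Y * n * (r * ϱ)) * (b * P * (c * Z)) ≡ b * (c * (X * P * (Y * r))) * (m *
          (n * ϱ) * Z)
      eq₁ = solve-∀
      eq₂ : ∀ b c e X P Y r Z → b * (c * e * (X * P * (Y * r))) * Z ≡ b * (c * (e * (X * P * (Y * r * Z))))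
      eq₂ = solve-∀
      eq₃ : ∀ e XP Y r C → e * (XP * (Y * r * C)) ≡ XP * (Y * (r * e) * C)
      eq₃ = solve-∀
    pull : ∀ d f i → ∑ (antidiag i) (λ (m′ , k′) → K d m′ f k′) ≡ ∑ (splits R) (λ (U , V) → ∑ (splits V) (λ (J , V′)
        → G U J V′ d f i))
    pull d f i = begin
      ∑ (antidiag i) (λ (m′ , k′) → K d m′ f k′)
        ≡⟨ ∑-cong (antidiag i) (λ (m′ , k′) → ∑-cong (comps M m′) (λ ds → ∑-cong (comps M k′) (λ fs
            → inside ds fs))) ⟩
      ∑ (antidiag i) (λ (m′ , k′) → ∑ (comps M m′) (λ ds → ∑ (comps M k′) (λ fs → ∑ (splits R) (λ (U , V) → ∑
          (splits V) (λ (J , V′) → c U J * (mono xs ds * (mono xs fs * ϱ fs) * MS (NFs ds fs (a ℕ.+ d ℕ.+ f)) V′))))))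
        ≡⟨ outward ⟩
      ∑ (splits R) (λ (U , V) → ∑ (splits V) (λ (J , V′) → ∑ (antidiag i) (λ (m′ , k′) → ∑ (comps M m′) (λ ds → ∑
          (comps M k′) (λ fs → c U J * (mono xs ds * (mono xs fs * ϱ fs) * MS (NFs ds fs (a ℕ.+ d ℕ.+ f)) V′))))))
        ≡⟨ ∑-cong (splits R) (λ (U , V) → ∑-cong (splits V) (λ (J , V′) → trans (∑-cong (antidiag i) (λ (m′ , k′)
            → trans (∑-cong (comps M m′) (λ ds → ∑-*ˡ (c U J) (comps M k′) _)) (∑-*ˡ (c U J) (comps M m′) _))) (trans
            (∑-*ˡ (c U J) (antidiag i) _)
             (trans (cong (λ z → ⟦ length U ≡ᵇ d ⟧ * (z * (x ^ d * ∏ U (site a d) * (x ^ f * ρ f))) * ∑ (antidiag i)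
                 (λ (m′ , k′) → sized xs (a ℕ.+ d ℕ.+ f) V′ m′ k′)) (isUp-eqUp (a ℕ.+ d) f J))
                 (eq₂ _ _ _ _ _ _ _ _))))) ⟩
      ∑ (splits R) (λ (U , V) → ∑ (splits V) (λ (J , V′) → G U J V′ d f i)) ∎
      where
      c : List ℕ → List ℕ → ℤ
      c U J = ⟦ length U ≡ᵇ d ⟧ * (⟦ isUp (a ℕ.+ d) f J ⟧ * (x ^ d * ∏ U (site a d) * (x ^ f * ρ f)))
      inside : ∀ ds fs → x ^ d * mono xs ds * (x ^ f * mono xs fs * (ρ f * ϱ fs)) * MS (NFs (d ∷ ds) (f ∷ fs) a) R
        ≡ ∑ (splits R) (λ (U , V) → ∑ (splits V) (λ (J , V′) → c U J * (mono xs ds * (mono xs fs * ϱ fs) * MS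
            (NFs ds fs (a ℕ.+ d ℕ.+ f)) V′)))
      inside ds fs = trans (sym (∑-*ˡ _ (splits R) _)) (∑-cong (splits R) (λ (U , V) → trans (cong (x ^ d * mono xs ds
          * (x ^ f * mono xs fs * (ρ f * ϱ fs)) *_) (sym (∑-*ˡ (N a d U) (splits V) _)))
        (trans (sym (∑-*ˡ _ (splits V) _)) (∑-cong (splits V) (λ (J , V′) → eq₁ _ _ _ _ _ _ _ _ _ _)))))
      outward : ∀ {g : Vec ℕ M → Vec ℕ M → List ℕ → List ℕ → List ℕ → ℤ} →
        ∑ (antidiag i) (λ (m′ , k′) → ∑ (comps M m′) (λ ds → ∑ (comps M k′) (λ fs → ∑ (splits R) (λ (U , V) → ∑
            (splits V) (λ (J , V′) → g ds fs U J V′)))))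
        ≡ ∑ (splits R) (λ (U , V) → ∑ (splits V) (λ (J , V′) → ∑ (antidiag i) (λ (m′ , k′) → ∑ (comps M m′) (λ ds → ∑
            (comps M k′) (λ fs → g ds fs U J V′)))))
      outward {g} = begin
        ∑ (antidiag i) (λ (m′ , k′) → ∑ (comps M m′) (λ ds → ∑ (comps M k′) (λ fs → ∑ (splits R) (λ (U , V) → ∑
            (splits V) (λ (J , V′) → g ds fs U J V′)))))
          ≡⟨ ∑-cong (antidiag i) (λ (m′ , k′) → trans (∑-cong (comps M m′) (λ ds → ∑-swap (comps M k′) (splits R) _))
              (∑-swap (comps M m′) (splits R) _)) ⟩
        ∑ (antidiag i) (λ (m′ , k′) → ∑ (splits R) (λ (U , V) → ∑ (comps M m′) (λ ds → ∑ (comps M k′) (λ fs → ∑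
            (splits V) (λ (J , V′) → g ds fs U J V′)))))
          ≡⟨ ∑-swap (antidiag i) (splits R) _ ⟩
        ∑ (splits R) (λ (U , V) → ∑ (antidiag i) (λ (m′ , k′) → ∑ (comps M m′) (λ ds → ∑ (comps M k′) (λ fs → ∑
            (splits V) (λ (J , V′) → g ds fs U J V′)))))
          ≡⟨ ∑-cong (splits R) (λ (U , V) → trans (∑-cong (antidiag i) (λ (m′ , k′) → trans (∑-cong (comps M m′) (λ ds
              → ∑-swap (comps M k′) (splits V) _)) (∑-swap (comps M m′) (splits V) _))) (∑-swap (antidiag i)
              (splits V) _)) ⟩
        ∑ (splits R) (λ (U , V) → ∑ (splits V) (λ (J , V′) → ∑ (antidiag i) (λ (m′ , k′) → ∑ (comps M m′) (λ ds → ∑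
            (comps M k′) (λ fs → g ds fs U J V′))))) ∎
    collapse : ∀ U V J V′ → length U ℕ.+ length V ≡ n → length J ℕ.+ length V′ ≡ length V →
      ∑ (antidiag n) (λ (d , j) → ∑ (antidiag j) (λ (f , i) → G U J V′ d f i))
      ≡ x ^ length U * ∏ U (valueWeight a (a ℕ.+ length U)) * (x ^ length J * (ρ (length J) * ⟦ eqUp
          (a ℕ.+ length U) J ⟧) * CS xs (a ℕ.+ length U ℕ.+ length J) V′)
    collapse U V J V′ e e′ = begin
      ∑ (antidiag n) (λ (d , j) → ∑ (antidiag j) (λ (f , i) → G U J V′ d f i))
          ≡⟨ ∑-cong (antidiag n) (λ (d , j) → ∑-*ˡ ⟦ length U ≡ᵇ d ⟧ (antidiag j) _) ⟩
      ∑ (antidiag n) (λ (d , j) → ⟦ length U ≡ᵇ d ⟧ * ∑ (antidiag j) (λ (f , i) → ⟦ length J ≡ᵇ f ⟧ * (⟦ eqUp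
          (a ℕ.+ d) J ⟧ * (x ^ d * ∏ U (site a d) * (x ^ f * ρ f * ∑ (antidiag i) (λ (m′ , k′) → sized xs
          (a ℕ.+ d ℕ.+ f) V′ m′ k′))))))
        ≡⟨ ∑-antidiag-δ (length U) (length V) e _ ⟩
      ∑ (antidiag (length V)) (λ (f , i) → ⟦ length J ≡ᵇ f ⟧ * (⟦ eqUp (a ℕ.+ length U) J ⟧ * (x ^ length U * ∏ U
          (site a (length U)) * (x ^ f * ρ f * ∑ (antidiag i) (λ (m′ , k′) → sized xs
          (a ℕ.+ length U ℕ.+ f) V′ m′ k′)))))
        ≡⟨ ∑-antidiag-δ (length J) (length V′) e′ _ ⟩
      ⟦ eqUp (a ℕ.+ length U) J ⟧ * (x ^ length U * ∏ U (site a (length U)) * (x ^ length J * ρ (length J) * ∑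
          (antidiag (length V′)) (λ (m′ , k′) → sized xs (a ℕ.+ length U ℕ.+ length J) V′ m′ k′)))
        ≡⟨ cong₂ (λ y z → ⟦ eqUp (a ℕ.+ length U) J ⟧ * (x ^ length U * y * (x ^ length J * ρ (length J) * z))) (sym
            (∏-site a U)) (sym (CS-sized xs _ V′)) ⟩
      ⟦ eqUp (a ℕ.+ length U) J ⟧ * (x ^ length U * ∏ U (valueWeight a (a ℕ.+ length U)) * (x ^ length J * ρ
          (length J) * CS xs (a ℕ.+ length U ℕ.+ length J) V′)) ≡⟨ eq₃ _ _ _ _ _ ⟩
      x ^ length U * ∏ U (valueWeight a (a ℕ.+ length U)) * (x ^ length J * (ρ (length J) * ⟦ eqUp
          (a ℕ.+ length U) J ⟧) * CS xs (a ℕ.+ length U ℕ.+ length J) V′) ∎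

  ivNs ivNFs : Vec ℕ M → Vec ℕ M → ℕ → List ℕ
  ivNs [] [] a = []
  ivNs (d ∷ ds) (f ∷ fs) a = up a d ++ ivNs ds fs (a ℕ.+ d ℕ.+ f)
  ivNFs [] [] a = []
  ivNFs (d ∷ ds) (f ∷ fs) a = up a d ++ (up (a ℕ.+ d) f ++ ivNFs ds fs (a ℕ.+ d ℕ.+ f))

  ivNFs≡up : ∀ (ds fs : Vec ℕ M) a → ivNFs ds fs a ≡ up a (Vec.sum ds ℕ.+ Vec.sum fs)
  ivNFs≡up [] [] a = refl
  ivNFs≡up (d ∷ ds) (f ∷ fs) a rewrite ivNFs≡up ds fs (a ℕ.+ d ℕ.+ f) = begin
    up a d ++ (up (a ℕ.+ d) f ++ up (a ℕ.+ d ℕ.+ f) (sd ℕ.+ sf))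
        ≡⟨ cong (up a d ++_) (up-++ (a ℕ.+ d) f (sd ℕ.+ sf)) ⟨
    up a d ++ up (a ℕ.+ d) (f ℕ.+ (sd ℕ.+ sf)) ≡⟨ up-++ a d _ ⟨
    up a (d ℕ.+ (f ℕ.+ (sd ℕ.+ sf))) ≡⟨ cong (up a) (shuffle d f sd sf) ⟩
    up a (d ℕ.+ sd ℕ.+ (f ℕ.+ sf)) ∎
    where
    sd = Vec.sum ds
    sf = Vec.sum fs
    shuffle : ∀ d f m n → d ℕ.+ (f ℕ.+ (m ℕ.+ n)) ≡ d ℕ.+ m ℕ.+ (f ℕ.+ n)
    shuffle = solveℕ-∀

  ivNFs-> : ∀ (ds fs : Vec ℕ M) a → All (a <_) (ivNFs ds fs a)
  ivNFs-> ds fs a = subst (All (a <_)) (sym (ivNFs≡up ds fs a)) (up-> a _)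

  -- A run of fixed points has to take the values equal to its positions, so the part and its values
  -- can be deleted together. `ws` and `A` collect the weights and values of the blocks already
  -- treated.
  removeFixed : ∀ (ds fs : Vec ℕ M) a ws A → All (_≤ a) A → MS (ws ++ NFs ds fs a) (A ++ ivNFs ds fs a) ≡ MS
      (ws ++ Ns ds fs a) (A ++ ivNs ds fs a)
  removeFixed [] [] a ws A p = refl
  removeFixed (d ∷ ds) (f ∷ fs) a ws A p = begin
    MS (ws ++ N a d ∷ fx ∷ NFs ds fs a′) (A ++ (up a d ++ (up (a ℕ.+ d) f ++ ivNFs ds fs a′)))
      ≡⟨ cong₂ MS (sym (List.++-assoc ws (N a d ∷ []) (fx ∷ NFs ds fs a′))) (sym (List.++-assoc A (up a d) _)) ⟩
    MS ((ws ++ N a d ∷ []) ++ fx ∷ NFs ds fs a′) ((A ++ up a d) ++ (up (a ℕ.+ d) f ++ ivNFs ds fs a′))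
        ≡⟨ MS-front (ws ++ N a d ∷ []) fx (NFs ds fs a′) _ ⟩
    MS (fx ∷ (ws ++ N a d ∷ []) ++ NFs ds fs a′) ((A ++ up a d) ++ (up (a ℕ.+ d) f ++ ivNFs ds fs a′))
      ≡⟨ extract (a ℕ.+ d) f (A ++ up a d) (ivNFs ds fs a′) A≤ (ivNFs-> ds fs a′) (MS
          ((ws ++ N a d ∷ []) ++ NFs ds fs a′)) ⟩
    MS ((ws ++ N a d ∷ []) ++ NFs ds fs a′) ((A ++ up a d) ++ ivNFs ds fs a′)
        ≡⟨ removeFixed ds fs a′ (ws ++ N a d ∷ []) (A ++ up a d) (All.map (λ q → ℕ.≤-trans q (ℕ.m≤m+n
        (a ℕ.+ d) f)) A≤) ⟩
    MS ((ws ++ N a d ∷ []) ++ Ns ds fs a′) ((A ++ up a d) ++ ivNs ds fs a′)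
        ≡⟨ cong₂ MS (List.++-assoc ws (N a d ∷ []) (Ns ds fs a′)) (List.++-assoc A (up a d) _) ⟩
    MS (ws ++ Ns (d ∷ ds) (f ∷ fs) a) (A ++ ivNs (d ∷ ds) (f ∷ fs) a) ∎
    where
    a′ = a ℕ.+ d ℕ.+ f
    fx : List ℕ → ℤ
    fx J = ⟦ isUp (a ℕ.+ d) f J ⟧
    A≤ : All (_≤ a ℕ.+ d) (A ++ up a d)
    A≤ = All.++⁺ (All.map (λ q → ℕ.≤-trans q (ℕ.m≤m+n a d)) p) (up-≤ a d)

  formAt : Vec ℕ M → Vec ℕ M → ℕ → ℕ → Form M
  formAt [] [] a v ()
  formAt (d ∷ ds) (f ∷ fs) a v = site a d v ∷ᶠ formAt ds fs (a ℕ.+ d ℕ.+ f) v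

  MS-Co : ∀ (ds fs : Vec ℕ M) a R → MS (Ns ds fs a) R ≡ Co (map (formAt ds fs a) R) ds
  MS-Co [] [] a [] = refl
  MS-Co [] [] a (x ∷ R) = refl
  MS-Co (d ∷ ds) (f ∷ fs) a R = trans (∑-cong (splits R) (λ (u , v) → cong (N a d u *_) (MS-Co ds fs _ v))) (sym
      (Co-splits (site a d) (formAt ds fs (a ℕ.+ d ℕ.+ f)) R d ds))

  offset : Vec ℕ M → Vec ℕ M → ℕ → Fin M → ℕ
  offset (d ∷ ds) (f ∷ fs) a zero = a
  offset (d ∷ ds) (f ∷ fs) a (suc i) = offset ds fs (a ℕ.+ d ℕ.+ f) i

  private
    offset-≥ : ∀ (ds fs : Vec ℕ M) a i → a ≤ offset ds fs a i
    offset-≥ (d ∷ ds) (f ∷ fs) a zero = ℕ.≤-refl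
    offset-≥ (d ∷ ds) (f ∷ fs) a (suc i) = ℕ.≤-trans (ℕ.≤-trans (ℕ.m≤m+n a d) (ℕ.m≤m+n (a ℕ.+ d) f))
        (offset-≥ ds fs _ i)

    formAt-below : ∀ (ds fs : Vec ℕ M) a v → v ≤ a → ∀ j → formAt ds fs a v j ≡ g
    formAt-below (d ∷ ds) (f ∷ fs) a v p zero rewrite <ᵇ-false p = refl
    formAt-below (d ∷ ds) (f ∷ fs) a v p (suc j) = formAt-below ds fs _ v (ℕ.≤-trans p (ℕ.≤-trans (ℕ.m≤m+n a d)
        (ℕ.m≤m+n (a ℕ.+ d) f))) j

    site-above : ∀ a d v → a ℕ.+ d < v → site a d v ≡ t * g
    site-above a d v p rewrite <ᵇ-true (ℕ.≤-<-trans (ℕ.m≤m+n a d) p) | <ᵇ-true p = refl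

    formAt-first : ∀ (ds fs : Vec ℕ M) a i {k} → lookup ds i ≡ suc k → ∀ j → formAt ds fs a (suc (offset ds fs a i)) j
        ≡ L i j
    formAt-first (suc d ∷ ds) (f ∷ fs) a zero e zero rewrite <ᵇ-true (ℕ.n<1+n a) | <ᵇ-false (subst (suc a ≤_) (sym
        (ℕ.+-suc a d)) (ℕ.s≤s (ℕ.m≤m+n a d))) | <ᵇ-false (ℕ.≤-refl {suc a}) = refl
    formAt-first (suc d ∷ ds) (f ∷ fs) a zero e (suc j) = formAt-below ds fs _ (suc a) (ℕ.≤-trans (subst (suc a ≤_)
        (sym (ℕ.+-suc a d)) (ℕ.s≤s (ℕ.m≤m+n a d))) (ℕ.m≤m+n _ f)) j
    formAt-first (d ∷ ds) (f ∷ fs) a (suc i) e zero = site-above a d _ (ℕ.s≤s (ℕ.≤-trans (ℕ.m≤m+n (a ℕ.+ d) f)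
        (offset-≥ ds fs _ i)))
    formAt-first (d ∷ ds) (f ∷ fs) a (suc i) e (suc j) = formAt-first ds fs _ i e j

    formAt-later : ∀ (ds fs : Vec ℕ M) a i v → suc (offset ds fs a i) < v → v ≤ offset ds fs a i ℕ.+ lookup ds i → ∀ j
        → formAt ds fs a v j ≡ L+ i j
    formAt-later (d ∷ ds) (f ∷ fs) a zero v p q zero rewrite <ᵇ-true (ℕ.<-trans
        (ℕ.n<1+n a) p) | <ᵇ-false q | <ᵇ-true p = refl
    formAt-later (d ∷ ds) (f ∷ fs) a zero v p q (suc j) = trans (formAt-below ds fs _ v (ℕ.≤-trans q (ℕ.m≤m+n _ f)) j)
        (sym (trans (cong (g +_) (*-zeroʳ T)) (+-identityʳ _)))
    formAt-later (d ∷ ds) (f ∷ fs) a (suc i) v p q zero = trans (site-above a d v (ℕ.<-trans (ℕ.s≤s (ℕ.≤-trans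
        (ℕ.m≤m+n (a ℕ.+ d) f) (offset-≥ ds fs _ i))) p)) (sym (trans (cong (t * g +_) (*-zeroʳ T)) (+-identityʳ _)))
    formAt-later (d ∷ ds) (f ∷ fs) a (suc i) v p q (suc j) = formAt-later ds fs _ i v p q j

    ≐-replicate : ∀ {form : ℕ → Form M} {ℓ : Form M} {o n} → All (λ v → ∀ j → form v j ≡ ℓ j) (up o n) → map form
        (up o n) ≐ replicate n ℓ
    ≐-replicate {n = zero} [] = []
    ≐-replicate {n = suc n} (e ∷ es) = e ∷ ≐-replicate es

    ≐-bag : ∀ {M′} (ds fs : Vec ℕ M) a (form : ℕ → Form M′) (b : Fin M → ℕ → List (Form M′)) →
      (∀ i → map form (up (offset ds fs a i) (lookup ds i)) ≐ b i (lookup ds i)) → map form (ivNs ds fs a) ≐ bag b ds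
    ≐-bag [] [] a form b e = []
    ≐-bag (d ∷ ds) (f ∷ fs) a form b e = subst (_≐ (b zero d ++ bag (b ∘ suc) ds)) (sym (List.map-++ form (up a d)
        (ivNs ds fs (a ℕ.+ d ℕ.+ f)))) (Pointwise.++⁺ (e zero) (≐-bag ds fs _ form (b ∘ suc) (e ∘ suc)))

    -- A value that is a position of block i lies above all earlier blocks and below all later ones,
    -- which gives the threshold; in block i itself only the first value is barred from the color l.
    ≐-closed : ∀ (ds fs : Vec ℕ M) a i → map (formAt ds fs a) (up (offset ds fs a i) (lookup ds i)) ≐ closed i
        (lookup ds i)
    ≐-closed ds fs a i with lookup ds i in e
    ... | zero = []
    ... | suc n = formAt-first ds fs a i e ∷ ≐-replicate (All.map (λ {v} (p , q) → formAt-later ds fs a i v p (subst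
        (λ z → v ≤ o ℕ.+ z) (sym e) (subst (v ≤_) (sym (ℕ.+-suc o n)) q))) (All.zip (up-> (suc o) n , up-≤
        (suc o) n)))
      where o = offset ds fs a i

  -- The result is the same for all `fs`: lengthening the runs shifts positions and values alike.
  -- This is why the fixed points split off as the factor `K`.
  MS-bag : ∀ (ds fs : Vec ℕ M) → MS (NFs ds fs 0) (up 0 (Vec.sum ds ℕ.+ Vec.sum fs)) ≡ Co (bag closed ds) ds
  MS-bag ds fs = begin
    MS (NFs ds fs 0) (up 0 (Vec.sum ds ℕ.+ Vec.sum fs)) ≡⟨ cong (MS (NFs ds fs 0)) (ivNFs≡up ds fs 0) ⟨
    MS (NFs ds fs 0) (ivNFs ds fs 0) ≡⟨ removeFixed ds fs 0 [] [] [] ⟩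
    MS (Ns ds fs 0) (ivNs ds fs 0) ≡⟨ MS-Co ds fs 0 (ivNs ds fs 0) ⟩
    Co (map (formAt ds fs 0) (ivNs ds fs 0)) ds
        ≡⟨ Co-cong (≐-bag ds fs 0 (formAt ds fs 0) closed (≐-closed ds fs 0)) ds ⟩
    Co (bag closed ds) ds ∎

  K : Vec ℤ M → PS
  K {M} xs n = ∑ (comps M n) (λ fs → mono xs fs * ϱ fs)

  CS≡F⊛K : ∀ (xs : Vec ℤ M) n → CS xs 0 (up 0 n) ≡ (F xs ⊛ K xs) n
  CS≡F⊛K {M} xs n = begin
    CS xs 0 (up 0 n) ≡⟨ CS-sized xs 0 (up 0 n) ⟩
    ∑ (antidiag (length (up 0 n))) (λ (i , j) → sized xs 0 (up 0 n) i j)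
        ≡⟨ cong (λ z → ∑ (antidiag z) (λ (i , j) → sized xs 0 (up 0 n) i j)) (length-up 0 n) ⟩
    ∑ (antidiag n) (λ (i , j) → sized xs 0 (up 0 n) i j)
      ≡⟨ ∑-cong-All (antidiag-sum n) (λ {(i , j)} e → trans (∑-cong-All (comps-sum M i) (λ {ds} e₁ → trans (∑-cong-All
          (comps-sum M j) (λ {fs} e₂ → term ds fs (trans (cong₂ ℕ._+_ e₁ e₂) e))) (∑-*ˡ _ (comps M j) _))) (∑-*ʳ _
          (comps M i) _)) ⟩
    (F xs ⊛ K xs) n ∎
    where
    opaque
      unfolding _+_
      eq : ∀ a b c → a * b * c ≡ a * c * b
      eq = solve-∀
    term : ∀ ds fs → Vec.sum ds ℕ.+ Vec.sum fs ≡ n → mono xs ds * (mono xs fs * ϱ fs) * MS (NFs ds fs 0) (up 0 n)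
        ≡ mono xs ds * Co (bag closed ds) ds * (mono xs fs * ϱ fs)
    term ds fs refl = trans (cong (mono xs ds * (mono xs fs * ϱ fs) *_) (MS-bag ds fs)) (eq _ _ _)

  private
    κ : ℤ → PS
    κ x n = x ^ n * ρ n

    lin-κ : ∀ x → lin (r * x) (κ x) ≗ lin (1ℤ * x) one
    lin-κ x zero = *-identityˡ _
    lin-κ x (suc zero) = eq x r
      where opaque
        unfolding _+_
        eq : ∀ x r → x * 1ℤ * ((r - 1ℤ) * 1ℤ) - r * x * (1ℤ * 1ℤ) ≡ 0ℤ - 1ℤ * x * 1ℤ
        eq = solve-∀
    lin-κ x (suc (suc n)) = eq x r (x ^ n) (r ^ n)
      where opaque
        unfolding _+_
        eq : ∀ x r X R → x * (x * X) * ((r - 1ℤ) * (r * R)) - r * x * (x * X * ((r - 1ℤ) * R)) ≡ 0ℤ - 1ℤ * x * 0ℤ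
        eq = solve-∀

    K-∷ : ∀ x (xs : Vec ℤ M) → K (x ∷ xs) ≗ κ x ⊛ K xs
    K-∷ {M} x xs n = trans (∑-comps M n _) (∑-cong (antidiag n) (λ (d , m) → trans (∑-cong (comps M m) (λ fs
        → *-interchange _ _ _ _)) (∑-*ˡ _ (comps M m) _)))

  -- `K` is the product of (1 - x z) / (1 - r x z) over the variables, by the generating function of
  -- `ρ`.
  E⊛K : ∀ (xs : Vec ℤ M) → E xs r ⊛ K xs ≗ E xs 1ℤ
  E⊛K [] n = trans (⊛-identityˡ (K []) n) (K-[] n)
    where
    K-[] : ∀ n → K [] n ≡ one n
    K-[] zero = trans (+-identityʳ _) (*-identityˡ _)
    K-[] (suc n) = refl
  E⊛K (x ∷ xs) n = begin
    (lin (r * x) (E xs r) ⊛ K (x ∷ xs)) n ≡⟨ ⊛-cong (λ _ → refl) (K-∷ x xs) n ⟩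
    (lin (r * x) (E xs r) ⊛ (κ x ⊛ K xs)) n ≡⟨ lin-⊛ _ (E xs r) _ n ⟩
    lin (r * x) (E xs r ⊛ (κ x ⊛ K xs)) n
        ≡⟨ lin-cong _ (λ i → trans (sym (⊛-assoc (E xs r) (κ x) (K xs) i)) (trans (⊛-cong (⊛-comm (E xs r) (κ x)) (λ _
        → refl) i) (⊛-assoc (κ x) (E xs r) (K xs) i))) n ⟩
    lin (r * x) (κ x ⊛ (E xs r ⊛ K xs)) n ≡⟨ lin-⊛ _ (κ x) _ n ⟨
    (lin (r * x) (κ x) ⊛ (E xs r ⊛ K xs)) n ≡⟨ ⊛-cong (lin-κ x) (E⊛K xs) n ⟩
    (lin (1ℤ * x) one ⊛ E xs 1ℤ) n ≡⟨ lin-⊛ _ one (E xs 1ℤ) n ⟩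
    lin (1ℤ * x) (one ⊛ E xs 1ℤ) n ≡⟨ lin-cong _ (⊛-identityˡ (E xs 1ℤ)) n ⟩
    E (x ∷ xs) 1ℤ n ∎

-- Hooks

guard : ∀ b {y z : ℤ} → (b ≡ true → y ≡ z) → ⟦ b ⟧ * y ≡ ⟦ b ⟧ * z
guard true e = cong (1ℤ *_) (e refl)
guard false e = trans (*-zeroˡ _) (sym (*-zeroˡ _))

-- `blocks` decides letter by letter whether to open a new block. Regrouping by the first block as a
-- whole is what a recurrence for hooks needs.
∑-blocks : ∀ (x : A) w (F : List (List A) → ℤ) →
  ∑ (blocks (x ∷ w)) F ≡ ∑ (cuts w) (λ (u , v) → ∑ (blocks v) (λ bs → F ((x ∷ u) ∷ bs)))
∑-blocks x [] F = sym (+-identityʳ _)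
∑-blocks x (y ∷ w) F = begin
  ∑ (blocks (x ∷ y ∷ w)) F ≡⟨ ∑-concatMap _ (blocks (y ∷ w)) F ⟩
  ∑ (blocks (y ∷ w)) _ ≡⟨ ∑-blocks y w _ ⟩
  ∑ (cuts w) (λ (u , v) → ∑ (blocks v) (λ bs → F ((x ∷ []) ∷ (y ∷ u) ∷ bs) + (F ((x ∷ y ∷ u) ∷ bs) + 0ℤ)))
    ≡⟨ ∑-cong (cuts w) (λ (u , v) → trans (∑-cong (blocks v) (λ bs → cong (F ((x ∷ []) ∷ (y ∷ u) ∷ bs) +_)
        (+-identityʳ _))) (∑-+ (blocks v) _ _)) ⟩
  ∑ (cuts w) (λ (u , v) → ∑ (blocks v) (λ bs → F ((x ∷ []) ∷ (y ∷ u) ∷ bs)) + ∑ (blocks v) (λ bs → F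
      ((x ∷ y ∷ u) ∷ bs)))
    ≡⟨ ∑-+ (cuts w) _ _ ⟩
  ∑ (cuts w) (λ (u , v) → ∑ (blocks v) (λ bs → F ((x ∷ []) ∷ (y ∷ u) ∷ bs))) + ∑ (cuts w) (λ (u , v) → ∑ (blocks v)
      (λ bs → F ((x ∷ y ∷ u) ∷ bs)))
    ≡⟨ cong₂ _+_ (∑-blocks y w (λ bs → F ((x ∷ []) ∷ bs))) refl ⟨
  ∑ (blocks (y ∷ w)) (λ bs → F ((x ∷ []) ∷ bs)) + ∑ (cuts w) (λ (u , v) → ∑ (blocks v) (λ bs → F ((x ∷ y ∷ u) ∷ bs)))
    ≡⟨ ∑-cuts y w (λ (u , v) → ∑ (blocks v) (λ bs → F ((x ∷ u) ∷ bs))) ⟨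
  ∑ (cuts (y ∷ w)) (λ (u , v) → ∑ (blocks v) (λ bs → F ((x ∷ u) ∷ bs))) ∎

blocks-concat : (w : List A) → All (λ bs → concat bs ≡ w) (blocks w)
blocks-concat [] = refl ∷ []
blocks-concat (x ∷ w) = All.concat⁺ (All.map⁺ (All.map (λ {bs} → extend bs) (blocks-concat w)))
  where
  extend : ∀ bs → concat bs ≡ w → All (λ bs → concat bs ≡ x ∷ w) _
  extend [] e = cong (x ∷_) e ∷ []
  extend (b ∷ bs) e = cong (x ∷_) e ∷ cong (x ∷_) e ∷ []

∑-take-drop : (w : List A) (F : List A → List A → ℤ) →
  ∑ (upTo (suc (length w))) (λ k → F (take k w) (drop k w)) ≡ ∑ (cuts w) (λ (u , v) → F u v)
∑-take-drop [] F = refl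
∑-take-drop (x ∷ w) F = trans (∑-upTo-∷ (suc (length w)) (λ k → F (take k (x ∷ w)) (drop k (x ∷ w))))
  (trans (cong (F [] (x ∷ w) +_) (∑-take-drop w (F ∘ (x ∷_)))) (sym (∑-cuts x w (λ (u , v) → F u v))))

∑-candidates : ∀ π (F : List Letter × List (List Letter) → ℤ) →
  ∑ (candidates π) F ≡ ∑ (cuts π) (λ (p , w) → ∑ (blocks w) (λ τs → F (p , τs)))
∑-candidates π F = trans (∑-concatMap (λ k → map (λ τs → (take k π , τs)) (blocks (drop k π))) (upTo (suc
    (length π))) F)
  (trans (∑-cong (upTo (suc (length π))) (λ k → ∑-map (λ τs → (take k π , τs)) (blocks (drop k π)) F)) (∑-take-drop π
      (λ p w → ∑ (blocks w) (λ τs → F (p , τs)))))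

incr-head : ∀ x w → incr (x ∷ w) ≡ true → All (x <_) w × incr w ≡ true
incr-head x [] e = [] , refl
incr-head x (y ∷ w) e with x <ᵇ y in p
... | true = (<ᵇ⇒< p ∷ All.map (ℕ.<-trans (<ᵇ⇒< p)) (proj₁ (incr-head y w e))) , e

invN-incr : ∀ w → incr w ≡ true → invN w ≡ 0
invN-incr [] e = refl
invN-incr (x ∷ w) e with incr-head x w e
... | x< , e′ = cong₂ ℕ._+_ (filterᵇ-<-none x<) (invN-incr w e′)

colsum-color0 : ∀ w → allᵇ color0 w ≡ true → colsum w ≡ 0
colsum-color0 [] e = refl
colsum-color0 ((v , zero) ∷ w) e = colsum-color0 w e

filterᵇ-++ : ∀ (p : A → Bool) u v → filterᵇ p (u ++ v) ≡ filterᵇ p u ++ filterᵇ p v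
filterᵇ-++ p [] v = refl
filterᵇ-++ p (x ∷ u) v with p x
... | true = cong (x ∷_) (filterᵇ-++ p u v)
... | false = filterᵇ-++ p u v

invN-++ : ∀ u v → invN (u ++ v) ≡ invN u ℕ.+ cross u v ℕ.+ invN v
invN-++ [] v = refl
invN-++ (x ∷ u) v rewrite invN-++ u v | filterᵇ-++ (_<ᵇ x) u v | List.length-++ (filterᵇ (_<ᵇ x) u) {filterᵇ
    (_<ᵇ x) v} =
  shuffle (length (filterᵇ (_<ᵇ x) u)) (length (filterᵇ (_<ᵇ x) v)) (invN u) (cross u v) (invN v)
  where
  shuffle : ∀ a b c d e → a ℕ.+ b ℕ.+ (c ℕ.+ d ℕ.+ e) ≡ a ℕ.+ c ℕ.+ (b ℕ.+ d) ℕ.+ e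
  shuffle = solveℕ-∀

colsum-++ : ∀ u v → colsum (u ++ v) ≡ colsum u ℕ.+ colsum v
colsum-++ [] v = refl
colsum-++ (x ∷ u) v = trans (cong (col x ℕ.+_) (colsum-++ u v)) (sym (ℕ.+-assoc (col x) _ _))

-- The inversions between different factors. When they cover the whole word this is inv - lec, and
-- in particular it is not negative.
crosses : List (List Letter) → ℕ
crosses [] = 0
crosses (τ ∷ τs) = cross (values τ) (values (concat τs)) ℕ.+ crosses τs

invN-concat : ∀ τs → invN (values (concat τs)) ≡ lecOf τs ℕ.+ crosses τs
invN-concat [] = refl
invN-concat (τ ∷ τs) rewrite List.map-++ proj₁ τ (concat τs) | invN-++ (values τ) (values
    (concat τs)) | invN-concat τs =
  shuffle (invN (values τ)) (cross (values τ) (values (concat τs))) (lecOf τs) (crosses τs)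
  where
  shuffle : ∀ a b c d → a ℕ.+ b ℕ.+ (c ℕ.+ d) ≡ a ℕ.+ c ℕ.+ (b ℕ.+ d)
  shuffle = solveℕ-∀

increasing? : List Letter → Bool
increasing? p = allᵇ color0 p ∧ incr (values p)

∧-true : ∀ a {b} → a ∧ b ≡ true → a ≡ true × b ≡ true
∧-true true e = refl , e

module Hooks (k : ℕ) (t q : ℤ) where

  private
    l = suc k

  T g s : ℤ
  T = t ^ l
  g = ∑ (upTo l) (t ^_)
  s = ∑ (upTo k) (λ e → t ^ suc e)

  hookWeight : List Letter → ℤ
  hookWeight τ = ⟦ isColoredHook τ ⟧ * t ^ (l ℕ.* invN (values τ) ℕ.+ colsum τ)

  hooksWeight : List (List Letter) → ℤ
  hooksWeight [] = 1ℤ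
  hooksWeight (τ ∷ τs) = q ^ cross (values τ) (values (concat τs)) * (hookWeight τ * hooksWeight τs)

  hookSum : List Letter → ℤ
  hookSum w = ∑ (blocks w) hooksWeight

  hookSum-∷ : ∀ x w → hookSum (x ∷ w) ≡ ∑ (cuts (x ∷ w)) (λ (u , v) → q ^ cross (values u) (values v) * (hookWeight u
      * hookSum v))
  hookSum-∷ x w = begin
    ∑ (blocks (x ∷ w)) hooksWeight ≡⟨ ∑-blocks x w hooksWeight ⟩
    ∑ (cuts w) (λ (u , v) → ∑ (blocks v) (λ bs → hooksWeight ((x ∷ u) ∷ bs)))
      ≡⟨ ∑-cong (cuts w) (λ (u , v) → trans (∑-cong-All (blocks-concat v) (λ {bs} e → trans (cong (λ z → q ^ cross
          (values (x ∷ u)) (values z) * (hookWeight (x ∷ u) * hooksWeight bs)) e) (sym (*-assoc _ _ _))))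
           (trans (∑-*ˡ _ (blocks v) hooksWeight) (*-assoc _ _ _))) ⟩
    ∑ (cuts w) (λ (u , v) → q ^ cross (values (x ∷ u)) (values v) * (hookWeight (x ∷ u) * hookSum v))
        -- The empty word is no hook. Its vanishing term completes the sum to all cuts of the word.
        ≡⟨ +-identityˡ _ ⟨
    0ℤ + ∑ (cuts w) (λ (u , v) → q ^ cross (values (x ∷ u)) (values v) * (hookWeight (x ∷ u) * hookSum v))
      ≡⟨ cong (_+ ∑ (cuts w) (λ (u , v) → q ^ cross (values (x ∷ u)) (values v) * (hookWeight (x ∷ u) * hookSum v)))
          (trans (cong (λ z → 1ℤ * (z * hookSum (x ∷ w))) (*-zeroˡ _)) (trans (cong (1ℤ *_) (*-zeroˡ _))
          (*-zeroʳ _))) ⟨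
    1ℤ * (hookWeight [] * hookSum (x ∷ w)) + ∑ (cuts w) (λ (u , v) → q ^ cross (values (x ∷ u)) (values v) *
        (hookWeight (x ∷ u) * hookSum v))
      ≡⟨ ∑-cuts x w (λ (u , v) → q ^ cross (values u) (values v) * (hookWeight u * hookSum v)) ⟨
    ∑ (cuts (x ∷ w)) (λ (u , v) → q ^ cross (values u) (values v) * (hookWeight u * hookSum v)) ∎

  hookSums : List ℕ → ℤ
  hookSums R = ∑ (perms l R) hookSum

  hookSums-∷ : ∀ {x R} → Sorted (x ∷ R) → hookSums (x ∷ R) ≡ ∑ (splits (x ∷ R)) (λ (U , V) → q ^ cross U V * (∑
      (perms l U) hookWeight * hookSums V))
  hookSums-∷ {x} {R} srt = begin
    ∑ (perms l (x ∷ R)) hookSum ≡⟨ ∑-cong-All (perms-length l (x ∷ R)) (λ {π} e → nonempty π e) ⟩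
    ∑ (perms l (x ∷ R)) (λ π → ∑ (cuts π) (λ (u , v) → q ^ cross (values u) (values v) * (hookWeight u * hookSum v)))
        ≡⟨ ∑-perms-cuts l q srt (λ u v → hookWeight u * hookSum v) ⟩
    ∑ (splits (x ∷ R)) (λ (U , V) → q ^ cross U V * ∑ (perms l U) (λ u → ∑ (perms l V) (λ v → hookWeight u
        * hookSum v)))
      ≡⟨ ∑-cong (splits (x ∷ R)) (λ (U , V) → cong (q ^ cross U V *_) (trans (∑-cong (perms l U) (λ u → ∑-*ˡ
          (hookWeight u) (perms l V) hookSum)) (∑-*ʳ (hookSums V) (perms l U) hookWeight))) ⟩
    ∑ (splits (x ∷ R)) (λ (U , V) → q ^ cross U V * (∑ (perms l U) hookWeight * hookSums V)) ∎
    where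
    nonempty : ∀ π → length π ≡ suc (length R) → hookSum π ≡ ∑ (cuts π) (λ (u , v) → q ^ cross (values u) (values v) *
        (hookWeight u * hookSum v))
    nonempty (y ∷ π) e = hookSum-∷ y π

  -- the same weight for words that become hooks once a new smallest letter is put in second position
  prehookWeight : List Letter → ℤ
  prehookWeight [] = 0ℤ
  prehookWeight (y ∷ γ) = ⟦ increasing? γ ⟧ * t ^ (l ℕ.* invN (values (y ∷ γ)) ℕ.+ colsum (y ∷ γ))

  -- For n ≥ 1 the prehooks have the weights 1, t, ..., t^(ln-1), according to the rank and the
  -- color of the first letter. Hooks miss only the weight 1, that of the increasing word without
  -- colors.
  prehookCount hookCount : ℕ → ℤ
  prehookCount zero = 0ℤ
  prehookCount (suc n) = g + T * prehookCount n
  hookCount zero = 0ℤ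
  hookCount (suc n) = s + T * prehookCount n

  private
    incr-min : ∀ x w → All (x <_) w → incr (x ∷ w) ≡ incr w
    incr-min x [] p = refl
    incr-min x (y ∷ w) (p ∷ _) rewrite <ᵇ-true p = refl

    not-incr : ∀ x e y α γ → x < proj₁ y → All (λ z → x < proj₁ z) α → incr (values (y ∷ α ++ (x , e) ∷ γ)) ≡ false
    not-incr x e y [] γ p _ rewrite <ᵇ-false (ℕ.<⇒≤ p) = refl
    not-incr x e y (z ∷ α) γ p (p′ ∷ ps) rewrite not-incr x e z α γ p′ ps = ∧-false (proj₁ y <ᵇ proj₁ z)
      where
      ∧-false : ∀ b → b ∧ false ≡ false
      ∧-false true = refl
      ∧-false false = refl

    All-prefix : ∀ {P : Letter → Set} α {γ π} → α ++ γ ≡ π → All P π → All P α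
    All-prefix α refl p = All.++⁻ˡ α p

    colorsum-∷ : ∀ (f : ℕ → ℤ) → ∑ (upTo l) f ≡ f 0 + ∑ (upTo k) (f ∘ suc)
    colorsum-∷ = ∑-upTo-∷ k

    color-zero-only : ∀ (b : ℕ → Bool) c → (∀ e → b (suc e) ≡ false) → (w : ℕ → ℤ) → b 0 ≡ c → ∑ (upTo l) (λ e
        → ⟦ b e ⟧ * w e) ≡ ⟦ c ⟧ * w 0
    color-zero-only b c h w refl = trans (colorsum-∷ (λ e → ⟦ b e ⟧ * w e)) (trans (cong₂ _+_ refl (trans (∑-cong
        (upTo k) (λ e → trans (cong (λ z → ⟦ z ⟧ * w (suc e)) (h e)) (*-zeroˡ _))) (∑-zero (upTo k))))
        (+-identityʳ _))

    -- The letters of a hook increase from the second one on, so a new smallest value can stand only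
    -- in first or second place.
    insert-cases : ∀ x (F : List Letter → ℤ) y π → All (λ z → x < proj₁ z) (y ∷ π) →
      (∀ z α e γ → x < proj₁ z → All (λ z → x < proj₁ z) α → F (y ∷ z ∷ α ++ (x , e) ∷ γ) ≡ 0ℤ) →
      ins l x F (y ∷ π) ≡ ∑ (upTo l) (λ e → F ((x , e) ∷ y ∷ π)) + ∑ (upTo l) (λ e → F (y ∷ (x , e) ∷ π))
    insert-cases x F y [] p h = cong (∑ (upTo l) (λ e → F ((x , e) ∷ y ∷ [])) +_) (+-identityʳ _)
    insert-cases x F y (z ∷ π) (_ ∷ p@(p′ ∷ ps)) h = trans (∑-cuts y (z ∷ π) (λ (α , γ) → ∑ (upTo l) (λ e → F (α ++
        (x , e) ∷ γ))))
      (cong (∑ (upTo l) (λ e → F ((x , e) ∷ y ∷ z ∷ π)) +_) (trans (∑-cuts z π (λ (α , γ) → ∑ (upTo l) (λ e → F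
          (y ∷ α ++ (x , e) ∷ γ))))
        (trans (cong₂ _+_ refl (trans (∑-cong-All (cuts-++ π) (λ {(α , γ)} eq → trans (∑-cong (upTo l) (λ e
            → h z α e γ p′ (All-prefix α eq ps))) (∑-zero (upTo l)))) (∑-zero (cuts π)))) (+-identityʳ _))))

    ∧-zeroʳ : ∀ b → b ∧ false ≡ false
    ∧-zeroʳ true = refl
    ∧-zeroʳ false = refl

    ins-increasing : ∀ x π → All (λ z → x < proj₁ z) π → ins l x (⟦_⟧ ∘ increasing?) π ≡ ⟦ increasing? π ⟧
    ins-increasing x [] p = trans (+-identityʳ _) (trans (∑-cong (upTo l) (λ e → sym (*-identityʳ _))) (trans
        (color-zero-only (λ e → increasing? ((x , e) ∷ [])) true (λ _ → refl) (λ _ → 1ℤ) refl) (*-identityˡ _)))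
    ins-increasing x (y ∷ π) p@(x<y ∷ ps) = begin
      ∑ (cuts (y ∷ π)) (λ (α , γ) → ∑ (upTo l) (λ e → ⟦ increasing? (α ++ (x , e) ∷ γ) ⟧))
          ≡⟨ ∑-cuts y π (λ (α , γ) → ∑ (upTo l) (λ e → ⟦ increasing? (α ++ (x , e) ∷ γ) ⟧)) ⟩
      ∑ (upTo l) (λ e → ⟦ increasing? ((x , e) ∷ y ∷ π) ⟧) + ∑ (cuts π) (λ (α , γ) → ∑ (upTo l) (λ e → ⟦ increasing?
          (y ∷ α ++ (x , e) ∷ γ) ⟧))
        ≡⟨ cong₂ _+_ (trans (∑-cong (upTo l) (λ e → sym (*-identityʳ _))) (trans (color-zero-only (λ e → increasing?
            ((x , e) ∷ y ∷ π)) (increasing? (y ∷ π)) (λ _ → refl) (λ _ → 1ℤ) front) (*-identityʳ _)))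
             (trans (∑-cong-All (cuts-++ π) (λ {(α , γ)} eq → trans (∑-cong (upTo l) (λ e → cong ⟦_⟧ (trans (cong
                 (allᵇ color0 (y ∷ α ++ (x , e) ∷ γ) ∧_) (not-incr x e y α γ x<y (All-prefix α eq ps))) (∧-zeroʳ _))))
                 (∑-zero (upTo l)))) (∑-zero (cuts π))) ⟩
      ⟦ increasing? (y ∷ π) ⟧ + 0ℤ ≡⟨ +-identityʳ _ ⟩
      ⟦ increasing? (y ∷ π) ⟧ ∎
      where
      front : increasing? ((x , 0) ∷ y ∷ π) ≡ increasing? (y ∷ π)
      front = cong (allᵇ color0 (y ∷ π) ∧_) (incr-min x (values (y ∷ π)) (All.map⁺ p))

    inv-front : ∀ x π → All (λ z → x < proj₁ z) π → invN (x ∷ values π) ≡ invN (values π)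
    inv-front x π p = cong (ℕ._+ invN (values π)) (filterᵇ-<-none (All.map⁺ p))

    inv-second : ∀ x y π → x < y → All (λ z → x < proj₁ z) π → invN (y ∷ x ∷ values π) ≡ suc (invN (y ∷ values π))
    inv-second x y π x<y p rewrite <ᵇ-true x<y | inv-front x π p = refl

    exponent-front : ∀ x e π → All (λ z → x < proj₁ z) π → increasing? π ≡ true →
      t ^ (l ℕ.* invN (values ((x , e) ∷ π)) ℕ.+ colsum ((x , e) ∷ π)) ≡ t ^ e
    exponent-front x e π p h with ∧-true (allᵇ color0 π) h
    ... | h₁ , h₂ rewrite inv-front x π p | invN-incr
        (values π) h₂ | colsum-color0 π h₁ | ℕ.*-zeroʳ k | ℕ.+-identityʳ e = refl

    exponent-second : ∀ x y π → x < proj₁ y → All (λ z → x < proj₁ z) π →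
      t ^ (l ℕ.* invN (values (y ∷ (x , 0) ∷ π)) ℕ.+ colsum (y ∷ (x , 0) ∷ π)) ≡ T * t ^ (l ℕ.* invN (values
          (y ∷ π)) ℕ.+ colsum (y ∷ π))
    exponent-second x y π x<y p rewrite inv-second x (proj₁ y) π x<y p = trans (cong (t ^_) (trans (cong (ℕ._+
        (col y ℕ.+ colsum π)) (ℕ.*-suc l i)) (ℕ.+-assoc l _ _))) (^-+ t l _)
      where i = invN (values (y ∷ π))

    ins-prehook : ∀ x π → All (λ z → x < proj₁ z) π → ins l x prehookWeight π ≡ g * ⟦ increasing? π ⟧ + T
        * prehookWeight π
    ins-prehook x [] p = begin
      ∑ (upTo l) (λ e → prehookWeight ((x , e) ∷ [])) + 0ℤ
          ≡⟨ cong (_+ 0ℤ) (∑-cong (upTo l) (λ e → trans (*-identityˡ _) (exponent-front x e [] [] refl))) ⟩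
      g + 0ℤ ≡⟨ cong₂ _+_ (*-identityʳ g) (*-zeroʳ T) ⟨
      g * 1ℤ + T * 0ℤ ∎
    ins-prehook x (y ∷ π) p@(x<y ∷ ps) = begin
      ins l x prehookWeight (y ∷ π)
          ≡⟨ insert-cases x prehookWeight y π p (λ z α e γ x<z q′ → trans (cong₂ _*_ (cong ⟦_⟧ (trans (cong
          (allᵇ color0 (z ∷ α ++ (x , e) ∷ γ) ∧_) (not-incr x e z α γ x<z q′)) (∧-zeroʳ _))) refl) (*-zeroˡ _)) ⟩
      ∑ (upTo l) (λ e → prehookWeight ((x , e) ∷ y ∷ π)) + ∑ (upTo l) (λ e → prehookWeight (y ∷ (x , e) ∷ π))
          ≡⟨ cong₂ _+_ front second ⟩
      g * ⟦ increasing? (y ∷ π) ⟧ + T * prehookWeight (y ∷ π) ∎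
      where
      front : ∑ (upTo l) (λ e → prehookWeight ((x , e) ∷ y ∷ π)) ≡ g * ⟦ increasing? (y ∷ π) ⟧
      front = trans (∑-cong (upTo l) (λ e → trans (guard (increasing? (y ∷ π)) (exponent-front x e (y ∷ π) p))
          (*-comm _ _))) (∑-*ʳ _ (upTo l) (t ^_))
      second : ∑ (upTo l) (λ e → prehookWeight (y ∷ (x , e) ∷ π)) ≡ T * prehookWeight (y ∷ π)
      second = trans (color-zero-only (λ e → increasing? ((x , e) ∷ π)) (increasing? π) (λ _ → refl) (λ e → t ^
          (l ℕ.* invN (values (y ∷ (x , e) ∷ π)) ℕ.+ colsum (y ∷ (x , e) ∷ π)))
          (cong (allᵇ color0 π ∧_) (incr-min x (values π) (All.map⁺ ps))))
        (trans (cong (⟦ increasing? π ⟧ *_) (exponent-second x y π x<y ps)) (trans (sym (*-assoc _ _ _)) (trans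
            (cong₂ _*_ (*-comm _ _) refl) (*-assoc _ _ _))))

    -- In front of an increasing rest, x causes no inversion and must have positive color, which
    -- gives s. In second place it has color 0 and adds one inversion with the first letter, which
    -- gives T; the first letter is then free, whence the prehooks.
    ins-hook : ∀ x π → All (λ z → x < proj₁ z) π → ins l x hookWeight π ≡ s * ⟦ increasing? π ⟧ + T * prehookWeight π
    ins-hook x π p = cases π p
      where
      front : ∀ π → All (λ z → x < proj₁ z) π → ∑ (upTo l) (λ e → hookWeight ((x , e) ∷ π)) ≡ s * ⟦ increasing? π ⟧
      front π p = trans (colorsum-∷ (λ e → hookWeight ((x , e) ∷ π))) (trans (cong₂ _+_ (trans (cong (λ b → ⟦ b ⟧
          * t ^ (l ℕ.* invN (values ((x , 0) ∷ π)) ℕ.+ colsum ((x , 0) ∷ π))) (zeroColor π p)) (*-zeroˡ _))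
          (trans (∑-cong (upTo k) (λ e → trans (cong (λ b → ⟦ b ⟧ * t ^ (l ℕ.* invN (values
              ((x , suc e) ∷ π)) ℕ.+ colsum ((x , suc e) ∷ π))) (positive e π p)) (trans (guard (increasing? π)
              (exponent-front x (suc e) π p)) (*-comm _ _)))) (∑-*ʳ _ (upTo k) _))) (+-identityˡ _))
        where
        notHook : ∀ π → All (λ z → x < proj₁ z) π → isHook (values ((x , 0) ∷ π)) ≡ false
        notHook [] p = refl
        notHook (z ∷ π) (x<z ∷ _) rewrite <ᵇ-false (ℕ.<⇒≤ x<z) = refl
        zeroColor : ∀ π → All (λ z → x < proj₁ z) π → isColoredHook ((x , 0) ∷ π) ≡ false
        zeroColor π p rewrite notHook π p = ∧-zeroʳ (incr (values ((x , 0) ∷ π)))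
        positive : ∀ e π → All (λ z → x < proj₁ z) π → isColoredHook ((x , suc e) ∷ π) ≡ increasing? π
        positive e π p rewrite notHook π p | incr-min x (values π) (All.map⁺ p) = Bool.∧-comm (incr (values π)) _
      cases : ∀ π → All (λ z → x < proj₁ z) π → ins l x hookWeight π ≡ s * ⟦ increasing? π ⟧ + T * prehookWeight π
      cases [] p = cong₂ _+_ (front [] []) (sym (*-zeroʳ T))
      cases (y ∷ π) p@(x<y ∷ ps) = trans (insert-cases x hookWeight y π p later) (cong₂ _+_ (front (y ∷ π) p) second)
        where
        later : ∀ z α e γ → x < proj₁ z → All (λ z → x < proj₁ z) α → hookWeight (y ∷ z ∷ α ++ (x , e) ∷ γ) ≡ 0ℤ
        later z α e γ x<z q′ rewrite not-incr x e z α γ x<z q′ | ∧-zeroʳ (proj₁ z <ᵇ proj₁ y) | ∧-zeroʳ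
            (proj₁ y <ᵇ proj₁ z) = *-zeroˡ _
        shape : ∀ e → isColoredHook (y ∷ (x , e) ∷ π) ≡ increasing? ((x , e) ∷ π)
        shape e rewrite <ᵇ-true x<y | <ᵇ-false (ℕ.<⇒≤ x<y) = trans (Bool.∨-identityʳ _) (Bool.∧-comm (incr (values
            ((x , e) ∷ π))) _)
        second : ∑ (upTo l) (λ e → hookWeight (y ∷ (x , e) ∷ π)) ≡ T * prehookWeight (y ∷ π)
        second = trans (color-zero-only (λ e → isColoredHook (y ∷ (x , e) ∷ π)) (increasing? π) (λ e → shape (suc e))
            (λ e → t ^ (l ℕ.* invN (values (y ∷ (x , e) ∷ π)) ℕ.+ colsum (y ∷ (x , e) ∷ π)))
            (trans (shape 0) (cong (allᵇ color0 π ∧_) (incr-min x (values π) (All.map⁺ ps)))))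
          (trans (cong (⟦ increasing? π ⟧ *_) (exponent-second x y π x<y ps)) (trans (sym (*-assoc _ _ _)) (trans
              (cong₂ _*_ (*-comm _ _) refl) (*-assoc _ _ _))))

    perms-above : ∀ {x R} → All (x <_) R → All (λ π → All (λ z → x < proj₁ z) π) (perms l R)
    perms-above p = All.map All.map⁻ (perms-All l p)

  ∑-increasing : ∀ {R} → Sorted R → ∑ (perms l R) (⟦_⟧ ∘ increasing?) ≡ 1ℤ
  ∑-increasing [] = +-identityʳ _
  ∑-increasing {x ∷ R} (x< ∷ srt) = trans (∑-perms l x R _) (trans (∑-cong-All (perms-above x<) (λ {π}
      → ins-increasing x π)) (∑-increasing srt))

  ∑-prehook : ∀ {R} → Sorted R → ∑ (perms l R) prehookWeight ≡ prehookCount (length R)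
  ∑-prehook [] = +-identityʳ _
  ∑-prehook {x ∷ R} (x< ∷ srt) = begin
    ∑ (perms l (x ∷ R)) prehookWeight ≡⟨ ∑-perms l x R _ ⟩
    ∑ (perms l R) (ins l x prehookWeight) ≡⟨ ∑-cong-All (perms-above x<) (λ {π} → ins-prehook x π) ⟩
    ∑ (perms l R) (λ π → g * ⟦ increasing? π ⟧ + T * prehookWeight π)
        ≡⟨ trans (∑-+ (perms l R) _ _) (cong₂ _+_ (∑-*ˡ g (perms l R) _) (∑-*ˡ T (perms l R) _)) ⟩
    g * ∑ (perms l R) (⟦_⟧ ∘ increasing?) + T * ∑ (perms l R) prehookWeight
        ≡⟨ cong₂ _+_ (trans (cong (g *_) (∑-increasing srt)) (*-identityʳ g)) (cong (T *_) (∑-prehook srt)) ⟩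
    g + T * prehookCount (length R) ∎

  ∑-hook : ∀ {R} → Sorted R → ∑ (perms l R) hookWeight ≡ hookCount (length R)
  ∑-hook [] = trans (+-identityʳ _) (*-zeroˡ _)
  ∑-hook {x ∷ R} (x< ∷ srt) = begin
    ∑ (perms l (x ∷ R)) hookWeight ≡⟨ ∑-perms l x R _ ⟩
    ∑ (perms l R) (ins l x hookWeight) ≡⟨ ∑-cong-All (perms-above x<) (λ {π} → ins-hook x π) ⟩
    ∑ (perms l R) (λ π → s * ⟦ increasing? π ⟧ + T * prehookWeight π)
        ≡⟨ trans (∑-+ (perms l R) _ _) (cong₂ _+_ (∑-*ˡ s (perms l R) _) (∑-*ˡ T (perms l R) _)) ⟩
    s * ∑ (perms l R) (⟦_⟧ ∘ increasing?) + T * ∑ (perms l R) prehookWeight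
        ≡⟨ cong₂ _+_ (trans (cong (s *_) (∑-increasing srt)) (*-identityʳ s)) (cong (T *_) (∑-prehook srt)) ⟩
    s + T * prehookCount (length R) ∎

  g≡1+s : g ≡ 1ℤ + s
  g≡1+s = ∑-upTo-∷ k (t ^_)

  [1-t]g : (1ℤ - t) * g ≡ 1ℤ - T
  [1-t]g = trans (eq₀ t g) (trans (cong₂ _-_ g≡1+s (trans (sym (∑-*ˡ t (upTo l) _)) (∑-upTo-∷ʳ k (λ e → t ^ suc e))))
      (eq₁ s T))
    where opaque
      unfolding _+_
      eq₀ : ∀ t g → (1ℤ - t) * g ≡ g - t * g
      eq₀ = solve-∀
      eq₁ : ∀ s T → (1ℤ + s) - (s + T) ≡ 1ℤ - T
      eq₁ = solve-∀

  [1-t]prehookCount : ∀ n → (1ℤ - t) * prehookCount n ≡ 1ℤ - T ^ n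
  [1-t]prehookCount zero = eq t
    where opaque
      unfolding _+_
      eq : ∀ t → (1ℤ - t) * 0ℤ ≡ 1ℤ - 1ℤ
      eq = solve-∀
  [1-t]prehookCount (suc n) = trans (eq₁ t g T (prehookCount n)) (trans (cong₂ (λ y z → y + T * z) [1-t]g
      ([1-t]prehookCount n)) (eq₂ T (T ^ n)))
    where opaque
      unfolding _+_
      eq₁ : ∀ t g T p → (1ℤ - t) * (g + T * p) ≡ (1ℤ - t) * g + T * ((1ℤ - t) * p)
      eq₁ = solve-∀
      eq₂ : ∀ T N → (1ℤ - T) + T * (1ℤ - N) ≡ 1ℤ - T * N
      eq₂ = solve-∀

  [1-t]hookCount : ∀ n → (1ℤ - t) * hookCount (suc n) ≡ t - T ^ suc n
  [1-t]hookCount n = trans (eq₁ t s T (prehookCount n)) (trans (cong₂ (λ y z → (1ℤ - t) * y + T * z - (1ℤ - t))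
      (sym g≡1+s) ([1-t]prehookCount n)) (trans (cong (λ z → z + T * (1ℤ - T ^ n) - (1ℤ - t)) [1-t]g) (eq₂ t T
      (T ^ n))))
    where opaque
      unfolding _+_
      eq₁ : ∀ t s T p → (1ℤ - t) * (s + T * p) ≡ (1ℤ - t) * (1ℤ + s) + T * ((1ℤ - t) * p) - (1ℤ - t)
      eq₁ = solve-∀
      eq₂ : ∀ t T N → (1ℤ - T) + T * (1ℤ - N) - (1ℤ - t) ≡ t - T * N
      eq₂ = solve-∀

-- From congruences to equality

opaque
  unfolding _+_
  ∣^∣ : ∀ m n → ℤ.∣ (ℤ.+ m) ^ n ∣ ≡ m ℕ.^ n
  ∣^∣ m zero = refl
  ∣^∣ m (suc n) = trans (ℤ.abs-* (ℤ.+ m) ((ℤ.+ m) ^ n)) (cong (m ℕ.*_) (∣^∣ m n))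

n<2^n : ∀ n → n < 2 ℕ.^ n
n<2^n zero = ℕ.s≤s ℕ.z≤n
n<2^n (suc n) = ℕ.≤-trans (ℕ.+-mono-≤ (ℕ.m^n>0 2 n) (n<2^n n)) (ℕ.+-monoʳ-≤ (2 ℕ.^ n) (ℕ.≤-reflexive (sym
    (ℕ.+-identityʳ _))))

opaque
  unfolding _+_
  -- The exponent d = |x - y| suffices: if x and y differ, q^d divides x - y and hence q^d ≤ d,
  -- whereas q^d ≥ 2^d > d.
  ≈-all⇒≡ : ∀ m {x y} → (∀ M → _≈[_]_ (ℤ.+ (2 ℕ.+ m)) x M y) → x ≡ y
  ≈-all⇒≡ m {x} {y} p with x ℤ.≟ y
  ... | yes e = e
  ... | no ne with p ℤ.∣ x ℤ.- y ∣
  ... | z , e = contradiction (ℕ.≤-<-trans bound (n<2^n d)) (ℕ.<-irrefl refl)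
    where
    d : ℕ
    d = ℤ.∣ x ℤ.- y ∣
    difference : x ℤ.- y ≡ (ℤ.+ (2 ℕ.+ m)) ^ d ℤ.* z
    difference = trans (cong (ℤ._- y) e) (eq y ((ℤ.+ (2 ℕ.+ m)) ^ d ℤ.* z))
      where
      eq : ∀ y z → y ℤ.+ z ℤ.- y ≡ z
      eq = solve-∀
    size : d ≡ (2 ℕ.+ m) ℕ.^ d ℕ.* ℤ.∣ z ∣
    size = trans (cong ℤ.∣_∣ difference) (trans (ℤ.abs-* ((ℤ.+ (2 ℕ.+ m)) ^ d) z) (cong (ℕ._* ℤ.∣ z ∣) (∣^∣
        (2 ℕ.+ m) d)))
    z≢0 : ∀ {n} → ℤ.∣ z ∣ ≡ n → 1 ≤ n
    z≢0 {zero} e′ = contradiction (trans size (trans (cong ((2 ℕ.+ m) ℕ.^ d ℕ.*_) e′) (ℕ.*-zeroʳ ((2 ℕ.+ m) ℕ.^ d))))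
        (λ d≡0 → ne (ℤ.i-j≡0⇒i≡j x y (ℤ.∣i∣≡0⇒i≡0 d≡0)))
    z≢0 {suc n} e′ = ℕ.s≤s ℕ.z≤n
    bound : 2 ℕ.^ d ≤ d
    bound = ℕ.≤-trans (ℕ.^-monoˡ-≤ d (ℕ.m≤m+n 2 m)) (ℕ.≤-trans (ℕ.≤-trans (ℕ.≤-reflexive (sym (ℕ.*-identityʳ _)))
        (ℕ.*-monoʳ-≤ ((2 ℕ.+ m) ℕ.^ d) (z≢0 refl))) (ℕ.≤-reflexive (sym size)))

  *-cancelˡ : ∀ {a x y} → a ≢ 0ℤ → a * x ≡ a * y → x ≡ y
  *-cancelˡ {a} {x} {y} a≢0 e = ℤ.*-cancelˡ-≡ a x y {{ℤ.≢-nonZero a≢0}} e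

-- Comparison of the two generating functions

module Compare (k : ℕ) (t r q : ℤ) (1-t≢0 : 1ℤ - t ≢ 0ℤ) where

  open Hooks k t q
  open Blocks k t r
  open Keys k
  open Walk using (F; F⊛E)
  open Extraction k t r using (K; CS≡F⊛K; E⊛K)

  firstSum : List ℕ → ℤ
  firstSum R = ∑ (perms (suc l) R) (λ w → weight r 0 w * q ^ majFrom _<c_ 1 w)

  secondSum : List ℕ → ℤ
  secondSum R = ∑ (perms l R) (λ π → ∑ (cuts π) (λ (p , w) → q ^ cross (values p) (values w) * (⟦ increasing? p ⟧
      * r ^ length p * hookSum w)))

  secondSum-splits : ∀ {R} → Sorted R → secondSum R ≡ ∑ (splits R) (λ (U , V) → q ^ cross U V * (r ^ length U
      * hookSums V))
  secondSum-splits {R} srt = trans (∑-perms-cuts l q srt (λ p w → ⟦ increasing? p ⟧ * r ^ length p * hookSum w))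
    (∑-cong-All (splits-sorted srt) (λ {(U , V)} (sU , sV) → cong (q ^ cross U V *_) (begin
      ∑ (perms l U) (λ p → ∑ (perms l V) (λ w → ⟦ increasing? p ⟧ * r ^ length p * hookSum w))
        ≡⟨ ∑-cong-All (perms-length l U) (λ {p} e → trans (∑-*ˡ _ (perms l V) hookSum) (cong (λ n → ⟦ increasing? p ⟧
            * r ^ n * hookSums V) e)) ⟩
      ∑ (perms l U) (λ p → ⟦ increasing? p ⟧ * r ^ length U * hookSums V)
          ≡⟨ trans (∑-*ʳ (hookSums V) (perms l U) _) (cong (_* hookSums V) (∑-*ʳ _ (perms l U) _)) ⟩
      ∑ (perms l U) (⟦_⟧ ∘ increasing?) * r ^ length U * hookSums V
          ≡⟨ cong (λ z → z * r ^ length U * hookSums V) (∑-increasing sU) ⟩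
      1ℤ * r ^ length U * hookSums V ≡⟨ cong (_* hookSums V) (*-identityˡ _) ⟩
      r ^ length U * hookSums V ∎)))

  module _ (M : ℕ) where

    private
      xs = powers q M
      -- `ĥ` represents a single hook and `Ĉ` a sequence of hooks, with `h q M i` in place of the
      -- reciprocal of `D q i`. That `Ĉ`, defined from the left-hand side of the theorem, really
      -- describes sequences of hooks is the content of the comparison.
      E₁ Eᵣ Eₜ H₁ Hᵣ Hₜ Ĉ ĥ Fˣ : PS
      E₁ = E xs 1ℤ
      Eᵣ = E xs r
      Eₜ = E xs T
      H₁ = H q M 1ℤ
      Hᵣ = H q M r
      Hₜ = H q M T
      Fˣ = F t g T xs
      Ĉ = Fˣ ⊛ E₁
      ĥ i = hookCount i * h q M i

      Ĉ⊛H₁ : Ĉ ⊛ H₁ ≗ Fˣ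
      Ĉ⊛H₁ n = begin
        (Fˣ ⊛ E₁ ⊛ H₁) n ≡⟨ ⊛-assoc Fˣ E₁ H₁ n ⟩
        (Fˣ ⊛ (E₁ ⊛ H₁)) n ≡⟨ ⊛-cong (λ _ → refl) (λ i → trans (⊛-comm E₁ H₁ i) (H⊛E q M 1ℤ i)) n ⟩
        (Fˣ ⊛ one) n ≡⟨ ⊛-identityʳ Fˣ n ⟩
        Fˣ n ∎

      Ĉ⊛Hₜ : Ĉ ⊛ Hₜ ≗ (λ n → (1ℤ - t) * one n + t * Fˣ n)
      Ĉ⊛Hₜ n = begin
        (Fˣ ⊛ E₁ ⊛ Hₜ) n ≡⟨ ⊛-cong (F⊛E t g T xs [1-t]g) (λ _ → refl) n ⟩
        (G ⊛ Eₜ ⊛ Hₜ) n ≡⟨ ⊛-assoc G Eₜ Hₜ n ⟩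
        (G ⊛ (Eₜ ⊛ Hₜ)) n ≡⟨ ⊛-cong {G} (λ _ → refl) (λ i → trans (⊛-comm Eₜ Hₜ i) (H⊛E q M T i)) n ⟩
        (G ⊛ one) n ≡⟨ ⊛-identityʳ G n ⟩
        G n ∎
        where
        G : PS
        G n = (1ℤ - t) * one n + t * Fˣ n

      -- The count of hooks is (t - T^i) / (1 - t) for i ≥ 1 but 0 for i = 0; the summand with `one`
      -- corrects the constant term.
      [1-t]ĥ : ∀ i → (1ℤ - t) * ĥ i ≡ t * H₁ i + (- 1ℤ) * Hₜ i + (1ℤ - t) * one i
      [1-t]ĥ zero = eq t
        where opaque
          unfolding _+_
          eq : ∀ t → (1ℤ - t) * (0ℤ * 1ℤ) ≡ t * (1ℤ * 1ℤ) + (- 1ℤ) * (1ℤ * 1ℤ) + (1ℤ - t) * 1ℤ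
          eq = solve-∀
      [1-t]ĥ (suc i) = trans (sym (*-assoc _ _ _)) (trans (cong (_* h q M (suc i)) ([1-t]hookCount i)) (trans (eq t
          (T ^ suc i) (h q M (suc i)))
          (cong (λ z → t * (z * h q M (suc i)) + (- 1ℤ) * (T ^ suc i * h q M (suc i)) + (1ℤ - t) * 0ℤ) (sym (1^
              (suc i))))))
        where opaque
          unfolding _+_
          eq : ∀ t T h → (t - T) * h ≡ t * (1ℤ * h) + (- 1ℤ) * (T * h) + (1ℤ - t) * 0ℤ
          eq = solve-∀

      -- Says that Ĉ = 1 / (1 - ĥ). Multiplied by H(1) and by H(T), the product F E(1) gives both
      -- sides of the functional equation of F, whose difference leaves only multiples of 1 - t.
      ĥ⊛Ĉ : ∀ n → (ĥ ⊛ Ĉ) n ≡ Ĉ n - one n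
      ĥ⊛Ĉ n = *-cancelˡ 1-t≢0 (begin
        (1ℤ - t) * (ĥ ⊛ Ĉ) n ≡⟨ ⊛-scaleˡ (1ℤ - t) ĥ Ĉ n ⟨
        ((λ i → (1ℤ - t) * ĥ i) ⊛ Ĉ) n ≡⟨ ⊛-cong [1-t]ĥ (λ _ → refl) n ⟩
        ((λ i → t * H₁ i + (- 1ℤ) * Hₜ i + (1ℤ - t) * one i) ⊛ Ĉ) n
            ≡⟨ ⊛-distribʳ (λ i → t * H₁ i + (- 1ℤ) * Hₜ i) (λ i → (1ℤ - t) * one i) Ĉ n ⟩
        ((λ i → t * H₁ i + (- 1ℤ) * Hₜ i) ⊛ Ĉ) n + ((λ i → (1ℤ - t) * one i) ⊛ Ĉ) n
          ≡⟨ cong₂ _+_ (trans (⊛-distribʳ (λ i → t * H₁ i) (λ i → (- 1ℤ) * Hₜ i) Ĉ n) (cong₂ _+_ (⊛-scaleˡ t H₁ Ĉ n)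
              (⊛-scaleˡ (- 1ℤ) Hₜ Ĉ n))) (⊛-scaleˡ (1ℤ - t) one Ĉ n) ⟩
        t * (H₁ ⊛ Ĉ) n + (- 1ℤ) * (Hₜ ⊛ Ĉ) n + (1ℤ - t) * (one ⊛ Ĉ) n
          ≡⟨ cong₂ _+_ (cong₂ (λ y z → t * y + (- 1ℤ) * z) (trans (⊛-comm H₁ Ĉ n) (Ĉ⊛H₁ n)) (trans (⊛-comm Hₜ Ĉ n)
              (Ĉ⊛Hₜ n))) (cong ((1ℤ - t) *_) (⊛-identityˡ Ĉ n)) ⟩
        t * Fˣ n + (- 1ℤ) * ((1ℤ - t) * one n + t * Fˣ n) + (1ℤ - t) * Ĉ n ≡⟨ eq t (Fˣ n) (one n) (Ĉ n) ⟩
        (1ℤ - t) * (Ĉ n - one n) ∎)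
        where opaque
          unfolding _+_
          eq : ∀ t F o C → t * F + (- 1ℤ) * ((1ℤ - t) * o + t * F) + (1ℤ - t) * C ≡ (1ℤ - t) * (C - o)
          eq = solve-∀

      Ĉ-0 : Ĉ 0 ≡ 1ℤ
      Ĉ-0 = trans (eq₁ (Ĉ 0)) (trans (cong (_+ 1ℤ) (trans (sym (ĥ⊛Ĉ 0)) (eq₂ (h q M 0) (Ĉ 0)))) (+-identityˡ 1ℤ))
        where opaque
          unfolding _+_
          eq₁ : ∀ c → c ≡ (c - 1ℤ) + 1ℤ
          eq₁ = solve-∀
          eq₂ : ∀ h c → 0ℤ * h * c + 0ℤ ≡ 0ℤ
          eq₂ = solve-∀

      Ĉ-suc : ∀ n → Ĉ (suc n) ≡ (ĥ ⊛ Ĉ) (suc n)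
      Ĉ-suc n = trans (eq _) (sym (ĥ⊛Ĉ (suc n)))
        where opaque
          unfolding _+_
          eq : ∀ c → c ≡ c - 0ℤ
          eq = solve-∀

      F⊛K : Fˣ ⊛ K xs ≗ Hᵣ ⊛ Ĉ
      F⊛K n = sym (begin
        (Hᵣ ⊛ (Fˣ ⊛ E₁)) n ≡⟨ ⊛-cong {Hᵣ} (λ _ → refl) (⊛-cong {Fˣ} (λ _ → refl) (λ i → sym (E⊛K xs i))) n ⟩
        (Hᵣ ⊛ (Fˣ ⊛ (Eᵣ ⊛ K xs))) n
            ≡⟨ ⊛-cong {Hᵣ} (λ _ → refl) (λ i → trans (sym (⊛-assoc Fˣ Eᵣ (K xs) i)) (trans (⊛-cong (⊛-comm Fˣ Eᵣ) (λ _
            → refl) i) (⊛-assoc Eᵣ Fˣ (K xs) i))) n ⟩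
        (Hᵣ ⊛ (Eᵣ ⊛ (Fˣ ⊛ K xs))) n ≡⟨ ⊛-assoc Hᵣ Eᵣ (Fˣ ⊛ K xs) n ⟨
        (Hᵣ ⊛ Eᵣ ⊛ (Fˣ ⊛ K xs)) n ≡⟨ ⊛-cong (H⊛E q M r) (λ _ → refl) n ⟩
        (one ⊛ (Fˣ ⊛ K xs)) n ≡⟨ ⊛-identityˡ (Fˣ ⊛ K xs) n ⟩
        (Fˣ ⊛ K xs) n ∎)

      opaque
        unfolding _+_
        shuffle : ∀ d e c h C → d * e * (c * h * C) ≡ c * (d * h) * (e * C)
        shuffle = solve-∀
        trim : ∀ c C → c * 1ℤ * C ≡ c * C
        trim = solve-∀

      product≈ : ∀ c i j C → _≈[_]_ q (D q j * Ĉ j) M C → _≈[_]_ q (D q i * D q j * (c * h q M i * Ĉ j)) M (c * C)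
      product≈ c i j C p = ≈-trans q (≡⇒≈ q (shuffle (D q i) (D q j) c (h q M i) (Ĉ j)))
        (≈-trans q (≈-* q (≈-*ˡ q c (D*h≈1 q M i)) p) (≡⇒≈ q (trim c C)))

      -- Both sides obey the recurrence that splits off the first hook, on the left by
      -- `∑-splits-cross` and on the right by `hookSums-∷`; they match because D(i) h_i is 1 modulo
      -- q^M. The bound m makes the recursion on the shorter part structural.
      hookSums≈ : ∀ m {R} → length R ≤ m → Sorted R → _≈[_]_ q (D q (length R) * Ĉ (length R)) M (hookSums R)
      hookSums≈ m {[]} _ _ = ≡⇒≈ q (trans (cong (1ℤ *_) Ĉ-0) (trans (*-identityˡ _) (sym (trans (+-identityʳ _)
          (+-identityʳ _)))))
      hookSums≈ (suc m) {R@(x ∷ R′)} (ℕ.s≤s len) srt =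
        ≈-trans q (≡⇒≈ q (trans (cong (D q (length R) *_) (Ĉ-suc (length R′))) (sym (∑-splits-cross q srt (λ i j → ĥ i
            * Ĉ j)))))
          (≈-trans q (≈-∑ q (All.zip (splits-length R , splits-sorted srt)) (λ {(U , V)} (e , sU , sV) → ≈-*ˡ q
              (q ^ cross U V) (term U V e sV)))
            (≡⇒≈ q (trans (∑-cong-All (splits-sorted srt) (λ {(U , V)} (sU , sV) → cong (λ z → q ^ cross U V * (z
                * hookSums V)) (sym (∑-hook sU)))) (sym (hookSums-∷ srt)))))
        where
        opaque
          unfolding _+_
          vanish : ∀ d h c z → d * (0ℤ * h * c) ≡ 0ℤ * z
          vanish = solve-∀
        term : ∀ U V → length U ℕ.+ length V ≡ suc (length R′) → Sorted V →
          _≈[_]_ q (D q (length U) * D q (length V) * (ĥ (length U) * Ĉ (length V))) M (hookCount (length U)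
              * hookSums V)
        -- For an empty first part V is not shorter and no induction hypothesis is available; the
        -- hook count 0 takes care of it.
        term [] V e sV = ≡⇒≈ q (vanish _ _ _ _)
        term (u ∷ U) V e sV = product≈ (hookCount (suc (length U))) (suc (length U)) (length V) (hookSums V)
          (hookSums≈ m (ℕ.≤-trans (ℕ.m≤n+m (length V) (length U)) (ℕ.≤-trans (ℕ.≤-reflexive
              (ℕ.suc-injective e)) len)) sV)

      secondSum≈ : ∀ {R} → Sorted R → _≈[_]_ q (D q (length R) * (Hᵣ ⊛ Ĉ) (length R)) M (secondSum R)
      secondSum≈ {R} srt =
        ≈-trans q (≡⇒≈ q (sym (∑-splits-cross q srt (λ i j → Hᵣ i * Ĉ j))))
          (≈-trans q (≈-∑ q (splits-sorted srt) (λ {(U , V)} (sU , sV) → ≈-*ˡ q (q ^ cross U V) (product≈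
              (r ^ length U) (length U) (length V) (hookSums V) (hookSums≈ (length V) ℕ.≤-refl sV))))
            (≡⇒≈ q (sym (secondSum-splits srt))))

      firstSum≈ : ∀ n → _≈[_]_ q (D q n * (Fˣ ⊛ K xs) n) M (firstSum (up 0 n))
      firstSum≈ n = ≈-trans q (≡⇒≈ q (begin
          D q n * (Fˣ ⊛ K xs) n
              ≡⟨ cong (D q n *_) (trans (sym (CS≡F⊛K xs n)) (sym (∑-CW xs 0 (subst Sorted (upTo≡up n)
              (upTo-sorted n))))) ⟩
          D q n * ∑ (perms (suc l) (up 0 n)) (CW xs 0) ≡⟨ ∑-*ˡ (D q n) (perms (suc l) (up 0 n)) _ ⟨
          ∑ (perms (suc l) (up 0 n)) (λ w → D q n * CW xs 0 w)
            ≡⟨ ∑-cong-All (perms-length (suc l) (up 0 n)) (λ {w} e → trans (cong₂ (λ m z → D q m * z) (sym (trans e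
                (length-up 0 n))) (trans (sym (weight*QL q xs 0 w)) (cong (weight r 0 w *_) (QL≡Q q M w))))
                (*-exchange _ _ _)) ⟩
          ∑ (perms (suc l) (up 0 n)) (λ w → weight r 0 w * (D q (length w) * Q q _<c_ M w)) ∎))
        (≈-∑ q (All.universal (λ _ → refl) (perms (suc l) (up 0 n))) {λ w → weight r 0 w * (D q (length w)
            * Q q _<c_ M w)} (λ {w} (_ : 0 ≡ 0) → ≈-*ˡ q (weight r 0 w) (D*Q≈q^maj q _<c_ M w)))

    firstSum≈secondSum : ∀ n → _≈[_]_ q (firstSum (up 0 n)) M (secondSum (up 0 n))
    firstSum≈secondSum n = ≈-trans q (≈-sym q (firstSum≈ n)) (≈-trans q (≡⇒≈ q (cong (D q n *_) (F⊛K n)))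
      (subst (λ m → _≈[_]_ q (D q m * (Hᵣ ⊛ Ĉ) m) M (secondSum (up 0 n))) (length-up 0 n) (secondSum≈ (subst Sorted
          (upTo≡up n) (upTo-sorted n)))))

-- Uniqueness of the hook factorization

Distinct : List Letter → Set
Distinct w = AllPairs (λ x y → proj₁ x ≢ proj₁ y) w

private
  hooks : List Letter → ℤ
  hooks w = ∑ (blocks w) (λ τs → ⟦ allᵇ isColoredHook τs ⟧)

  hooks-∷ : ∀ x w → hooks (x ∷ w) ≡ ∑ (cuts w) (λ (u , v) → ⟦ isColoredHook (x ∷ u) ⟧ * hooks v)
  hooks-∷ x w = trans (∑-blocks x w _) (∑-cong (cuts w) (λ (u , v) → trans (∑-cong (blocks v) (λ τs → ⟦∧⟧
      (isColoredHook (x ∷ u)) _)) (∑-*ˡ _ (blocks v) _)))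

  -- The number of colored hook factorizations. `run b` below is the variant in which the increasing
  -- prefix continues a letter of value b.
  run₀ : List Letter → ℤ
  run₀ w = ∑ (cuts w) (λ (u , v) → ⟦ increasing? u ⟧ * hooks v)

  run : ℕ → List Letter → ℤ
  run b w = ∑ (cuts w) (λ (u , v) → ⟦ allᵇ color0 u ∧ incr (b ∷ values u) ⟧ * hooks v)

  run₀-∷ : ∀ y w → run₀ (y ∷ w) ≡ hooks (y ∷ w) + ⟦ color0 y ⟧ * run (proj₁ y) w
  run₀-∷ y w = trans (∑-cuts y w (λ (u , v) → ⟦ increasing? u ⟧ * hooks v)) (cong₂ _+_ (*-identityˡ _)
    (trans (∑-cong (cuts w) (λ (u , v) → factor (color0 y) _ _ (hooks v))) (∑-*ˡ _ (cuts w) _)))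
    where
    factor : ∀ a b c z → ⟦ (a ∧ b) ∧ c ⟧ * z ≡ ⟦ a ⟧ * (⟦ b ∧ c ⟧ * z)
    factor true b c z = sym (*-identityˡ _)
    factor false b c z = trans (*-zeroˡ _) (sym (*-zeroˡ _))

  run-∷ : ∀ b y w → run b (y ∷ w) ≡ hooks (y ∷ w) + ⟦ color0 y ∧ (b <ᵇ proj₁ y) ⟧ * run (proj₁ y) w
  run-∷ b y w = trans (∑-cuts y w (λ (u , v) → ⟦ allᵇ color0 u ∧ incr (b ∷ values u) ⟧ * hooks v)) (cong₂ _+_
      (*-identityˡ _)
    (trans (∑-cong (cuts w) (λ (u , v) → factor (color0 y) _ (b <ᵇ proj₁ y) _ (hooks v))) (∑-*ˡ _ (cuts w) _)))
    where
    factor : ∀ a b c d z → ⟦ (a ∧ b) ∧ (c ∧ d) ⟧ * z ≡ ⟦ a ∧ c ⟧ * (⟦ b ∧ d ⟧ * z)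
    factor true b true d z = sym (*-identityˡ _)
    factor true b false d z = trans (cong (λ c → ⟦ c ⟧ * z) (Bool.∧-zeroʳ b)) (trans (*-zeroˡ _) (sym (*-zeroˡ _)))
    factor false b c d z = trans (*-zeroˡ _) (sym (*-zeroˡ _))

  -- A letter of positive color heads a hook of the first kind if the next letter is smaller and of
  -- the second kind if it is larger. So the rest of the hook is an arbitrary increasing run of
  -- color 0.
  hooks-colored : ∀ v e w → Distinct ((v , suc e) ∷ w) → hooks ((v , suc e) ∷ w) ≡ run₀ w
  hooks-colored v e w (ne ∷ _) = trans (hooks-∷ (v , suc e) w) (∑-cong-All (cuts-++ w) (λ {(u , u′)} eq → cong (λ b
      → ⟦ b ⟧ * hooks u′) (shape u (subst (All _) (sym eq) ne))))
    where
    shape : ∀ u {u′} → All (λ y → v ≢ proj₁ y) (u ++ u′) → isColoredHook ((v , suc e) ∷ u) ≡ increasing? u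
    shape [] _ = refl
    shape (y ∷ u) (v≢y ∷ _) with v <ᵇ proj₁ y in p
    ... | true rewrite <ᵇ-false (ℕ.<⇒≤ (<ᵇ⇒< {v} {proj₁ y} p)) = Bool.∧-comm (incr (values (y ∷ u))) _
    ... | false rewrite <ᵇ-true (ℕ.≤∧≢⇒< (<ᵇ⇒≥ {v} {proj₁ y} p) (v≢y ∘ sym)) = trans (Bool.∨-identityʳ _) (Bool.∧-comm
        (incr (values (y ∷ u))) _)

  hooks-uncolored-[] : ∀ v → hooks ((v , 0) ∷ []) ≡ 0ℤ
  hooks-uncolored-[] v = +-identityʳ 0ℤ

  -- A letter of color 0 can only head a hook of the first kind: the second letter must have color 0
  -- and be smaller, and the hook then goes on increasing from there.
  hooks-uncolored : ∀ v y w → hooks ((v , 0) ∷ y ∷ w) ≡ ⟦ color0 y ∧ (proj₁ y <ᵇ v) ⟧ * run (proj₁ y) w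
  hooks-uncolored v y w = begin
    hooks ((v , 0) ∷ y ∷ w) ≡⟨ hooks-∷ (v , 0) (y ∷ w) ⟩
    ∑ (cuts (y ∷ w)) (λ (u , u′) → ⟦ isColoredHook ((v , 0) ∷ u) ⟧ * hooks u′)
        ≡⟨ ∑-cuts y w (λ (u , u′) → ⟦ isColoredHook ((v , 0) ∷ u) ⟧ * hooks u′) ⟩
    0ℤ * hooks (y ∷ w) + ∑ (cuts w) (λ (u , u′) → ⟦ isColoredHook ((v , 0) ∷ y ∷ u) ⟧ * hooks u′)
      ≡⟨ trans (cong₂ _+_ (*-zeroˡ _) (trans (∑-cong (cuts w) (λ (u , u′) → factor (proj₁ y <ᵇ v) (incr (values
          (y ∷ u))) (color0 y) _ _ (hooks u′))) (∑-*ˡ _ (cuts w) _))) (+-identityˡ _) ⟩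
    ⟦ color0 y ∧ (proj₁ y <ᵇ v) ⟧ * run (proj₁ y) w ∎
    where
    factor : ∀ a i c d j z → ⟦ ((a ∧ i) ∧ (c ∧ d)) ∨ (j ∧ false) ⟧ * z ≡ ⟦ c ∧ a ⟧ * (⟦ d ∧ i ⟧ * z)
    factor a i c d j z rewrite Bool.∧-zeroʳ j | Bool.∨-identityʳ ((a ∧ i) ∧ (c ∧ d)) = boolean a i c d
      where
      boolean : ∀ a i c d → ⟦ (a ∧ i) ∧ (c ∧ d) ⟧ * z ≡ ⟦ c ∧ a ⟧ * (⟦ d ∧ i ⟧ * z)
      boolean true i true d = trans (cong (λ b → ⟦ b ⟧ * z) (Bool.∧-comm i d)) (sym (*-identityˡ _))
      boolean true i false d = trans (cong (λ b → ⟦ b ⟧ * z) (Bool.∧-zeroʳ i)) (trans (*-zeroˡ _) (sym (*-zeroˡ _)))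
      boolean false i true d = trans (*-zeroˡ _) (sym (*-zeroˡ _))
      boolean false i false d = trans (*-zeroˡ _) (sym (*-zeroˡ _))

  -- For a 0-colored letter v in front of w, either w is a run increasing from v followed by hooks,
  -- or v w is a concatenation of hooks, in exactly one way altogether: this drives the induction.
  run-hooks : ∀ v w → Distinct ((v , 0) ∷ w) → run v w + hooks ((v , 0) ∷ w) ≡ 1ℤ
  run₀-1 : ∀ w → Distinct w → run₀ w ≡ 1ℤ

  run-hooks v [] _ = trans (cong (run v [] +_) (hooks-uncolored-[] v)) (trans (+-identityʳ _) (trans (+-identityʳ _)
      (trans (*-identityˡ _) (+-identityʳ _))))
  run-hooks v ((y , suc e) ∷ w) (_ ∷ dis@(_ ∷ dis′)) = begin
    run v ((y , suc e) ∷ w) + hooks ((v , 0) ∷ (y , suc e) ∷ w)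
        ≡⟨ cong₂ _+_ (run-∷ v (y , suc e) w) (hooks-uncolored v (y , suc e) w) ⟩
    hooks ((y , suc e) ∷ w) + 0ℤ * run y w + 0ℤ * run y w
        ≡⟨ cong₂ _+_ (trans (cong₂ _+_ (hooks-colored y e w dis) (*-zeroˡ _)) (+-identityʳ _)) (*-zeroˡ _) ⟩
    run₀ w + 0ℤ ≡⟨ trans (+-identityʳ _) (run₀-1 w dis′) ⟩
    1ℤ ∎
  run-hooks v ((y , zero) ∷ w) ((v≢y ∷ _) ∷ dis) = begin
    run v ((y , 0) ∷ w) + hooks ((v , 0) ∷ (y , 0) ∷ w)
        ≡⟨ cong₂ _+_ (run-∷ v (y , 0) w) (hooks-uncolored v (y , 0) w) ⟩
    hooks ((y , 0) ∷ w) + ⟦ v <ᵇ y ⟧ * run y w + ⟦ y <ᵇ v ⟧ * run y w ≡⟨ cases ⟩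
    run y w + hooks ((y , 0) ∷ w) ≡⟨ run-hooks y w dis ⟩
    1ℤ ∎
    where
    opaque
      unfolding _+_
      eq₁ : ∀ h r → h + 1ℤ * r + 0ℤ * r ≡ r + h
      eq₁ = solve-∀
      eq₂ : ∀ h r → h + 0ℤ * r + 1ℤ * r ≡ r + h
      eq₂ = solve-∀
    cases : hooks ((y , 0) ∷ w) + ⟦ v <ᵇ y ⟧ * run y w + ⟦ y <ᵇ v ⟧ * run y w ≡ run y w + hooks ((y , 0) ∷ w)
    cases with v <ᵇ y in p
    ... | true rewrite <ᵇ-false (ℕ.<⇒≤ (<ᵇ⇒< {v} {y} p)) = eq₁ _ _
    ... | false rewrite <ᵇ-true (ℕ.≤∧≢⇒< (<ᵇ⇒≥ {v} {y} p) (v≢y ∘ sym)) = eq₂ _ _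

  run₀-1 [] _ = trans (+-identityʳ _) (trans (*-identityˡ _) (+-identityʳ _))
  run₀-1 ((y , suc e) ∷ w) dis@(_ ∷ dis′) = trans (run₀-∷ (y , suc e) w) (trans (cong₂ _+_ (trans
      (hooks-colored y e w dis) (run₀-1 w dis′)) (*-zeroˡ _)) (+-identityʳ _))
  run₀-1 ((y , zero) ∷ w) dis = trans (run₀-∷ (y , 0) w) (trans (cong₂ _+_ refl (*-identityˡ _)) (trans (+-comm _ _)
      (run-hooks y w dis)))

∑-chfs : ∀ π (F : List Letter × List (List Letter) → ℤ) →
  ∑ (chfs π) F ≡ ∑ (cuts π) (λ (p , w) → ∑ (blocks w) (λ τs → ⟦ isCHF (p , τs) ⟧ * F (p , τs)))
∑-chfs π F = trans (∑-filterᵇ isCHF (candidates π) F) (∑-candidates π _)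

-- The factorizations are counted, and the count is 1. This is needed because the right-hand
-- coefficient tests membership once per permutation, while the sums run over all factorizations.
chfs-unique : ∀ π → Distinct π → ∃ λ c → chfs π ≡ c ∷ []
chfs-unique π dis = single (chfs π) (trans (∑-chfs π (λ _ → 1ℤ)) (trans (∑-cong (cuts π) (λ (p , w) →
    trans (∑-cong (blocks w) (λ τs → trans (*-identityʳ _) (⟦∧⟧ (increasing? p) _))) (∑-*ˡ _ (blocks w) _)))
        (run₀-1 π dis)))
  where
  opaque
    unfolding _+_
    single : (xs : List A) → ∑ xs (λ _ → 1ℤ) ≡ 1ℤ → ∃ λ c → xs ≡ c ∷ []
    single (c ∷ []) e = c , refl
    single (c ∷ c′ ∷ xs) e = contradiction (trans (cong (λ z → 1ℤ ℤ.+ (1ℤ ℤ.+ z)) (sym (count xs))) e) λ ()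
      where
      count : (xs : List A) → ∑ xs (λ _ → 1ℤ) ≡ ℤ.+ length xs
      count [] = refl
      count (x ∷ xs) = cong (ℤ._+_ 1ℤ) (count xs)

AllPairs-↭ : ∀ {R : A → A → Set} → (∀ {x y} → R x y → R y x) → ∀ {xs ys} → xs ↭ ys → AllPairs R xs → AllPairs R ys
AllPairs-↭ s Perm.refl p = p
AllPairs-↭ s (prep x e) (p ∷ ps) = Perm.All-resp-↭ e p ∷ AllPairs-↭ s e ps
AllPairs-↭ s (swap x y e) ((a ∷ b) ∷ c ∷ d) = (s a ∷ Perm.All-resp-↭ e c) ∷ Perm.All-resp-↭ e b ∷ AllPairs-↭ s e d
AllPairs-↭ s (Perm.trans e e′) p = AllPairs-↭ s e′ (AllPairs-↭ s e p)

perms-distinct : ∀ l {R} → Sorted R → All (λ π → AllPairs _≢_ (values π)) (perms l R)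
perms-distinct l s = All.map (λ p → AllPairs-↭ (λ ne → ne ∘ sym) (↭-sym p) (AllPairs.map ℕ.<⇒≢ s)) (perms-↭ l _)

-- Exponent triples of the two statistics

Exponents : Set
Exponents = ℕ × ℕ × ℕ

toTriple : Exponents → Triple
toTriple (a , b , c) = (a , b , ℤ.+ c)

eval : ℤ → ℤ → ℤ → Exponents → ℤ
eval t r q (a , b , c) = t ^ a * (r ^ b * q ^ c)

module Stats (k n : ℕ) where

  private
    l = suc k
    R = up 0 n
    sortedR : Sorted R
    sortedR = subst Sorted (upTo≡up n) (upTo-sorted n)

  open Keys k using (keys; maj-keys; colsum-keys; fix-keys; values-keys; ∑-keys; validity)

  -- All three exponents are natural numbers: the differences maj - exc and inv - lec are replaced
  -- by the major index of the recolored word and, for the second family, by the number of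
  -- inversions between different factors.
  exponents₁ : List Letter → Exponents
  exponents₁ π = (colsum (keys 0 π) , fixAux 1 (keys 0 π) , majFrom _<c_ 1 (keys 0 π))

  exponents₂ : List Letter × List (List Letter) → Exponents
  exponents₂ (p , τs) = (l ℕ.* lecOf τs ℕ.+ colsum (p ++ concat τs) , length p , cross (values p) (values
      (concat τs)) ℕ.+ crosses τs)

  first second : List Exponents
  first = map exponents₁ (perms l R)
  second = concatMap (λ π → map exponents₂ (chfs π)) (perms l R)

  ∑-perms-ColoredPerms : ∀ f → ∑ (ColoredPerms l n) f ≡ ∑ (perms l R) f
  ∑-perms-ColoredPerms f = trans (∑-ColoredPerms l n f) (trans (cong (λ V → ∑ (wordsOver l V n) (λ w → ⟦ distinct
      (values w) ⟧ * f w)) (upTo≡up n)) (∑-distinct l n sortedR (length-up 0 n) f))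

  module _ (t r q : ℤ) (1-t≢0 : 1ℤ - t ≢ 0ℤ) where

    open Blocks k t r using (weight; weight-stats)
    open Hooks k t q
    open Compare k t r q 1-t≢0

    -- A detour from permutations through words: the recoloring is defined letter by letter there,
    -- and afterwards the words with distinct values are again permutations, now with l + 1 colors.
    ∑-first : ∑ first (eval t r q) ≡ firstSum R
    ∑-first = begin
      ∑ first (eval t r q) ≡⟨ ∑-map exponents₁ (perms l R) (eval t r q) ⟩
      ∑ (perms l R) (λ π → G (keys 0 π)) ≡⟨ ∑-distinct l n sortedR (length-up 0 n) (G ∘ keys 0) ⟨
      ∑ (wordsOver l R n) (λ w → ⟦ distinct (values w) ⟧ * G (keys 0 w))
          ≡⟨ ∑-cong (wordsOver l R n) (λ w → cong (λ z → ⟦ distinct z ⟧ * G (keys 0 w)) (sym (values-keys 0 w))) ⟩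
      ∑ (wordsOver l R n) (λ w → ⟦ distinct (values (keys 0 w)) ⟧ * G (keys 0 w))
          ≡⟨ ∑-keys R n 0 (λ w → ⟦ distinct (values w) ⟧ * G w) ⟩
      ∑ (wordsOver (suc l) R n) (λ w → validity 0 w * (⟦ distinct (values w) ⟧ * G w))
          ≡⟨ ∑-cong (wordsOver (suc l) R n) (λ w → *-exchange _ _ _) ⟩
      ∑ (wordsOver (suc l) R n) (λ w → ⟦ distinct (values w) ⟧ * (validity 0 w * G w))
          ≡⟨ ∑-distinct (suc l) n sortedR (length-up 0 n) _ ⟩
      ∑ (perms (suc l) R) (λ w → validity 0 w * G w)
          ≡⟨ ∑-cong (perms (suc l) R) (λ w → trans (eq _ _ _ _) (cong (_* q ^ majFrom _<c_ 1 w) (sym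
          (weight-stats 0 w)))) ⟩
      firstSum R ∎
      where
      opaque
        unfolding _+_
        eq : ∀ v c f m → v * (c * (f * m)) ≡ v * (c * f) * m
        eq = solve-∀
      G : List Letter → ℤ
      G w = eval t r q (colsum w , fixAux 1 w , majFrom _<c_ 1 w)

    private
      hooksWeight-stats : ∀ τs → ⟦ allᵇ isColoredHook τs ⟧ * (t ^ (l ℕ.* lecOf τs ℕ.+ colsum (concat τs))
          * q ^ crosses τs) ≡ hooksWeight τs
      hooksWeight-stats [] rewrite ℕ.*-zeroʳ k = trans (*-identityˡ _) (*-identityˡ _)
      hooksWeight-stats (τ ∷ τs) = begin
        ⟦ isColoredHook τ ∧ allᵇ isColoredHook τs ⟧ * (t ^ (l ℕ.* (i ℕ.+ j) ℕ.+ colsum (τ ++ concat τs)) * q ^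
            (c ℕ.+ crosses τs))
          ≡⟨ cong₂ _*_ (⟦∧⟧ (isColoredHook τ) _) (cong₂ _*_ (trans (cong (t ^_) (trans (cong (l ℕ.* (i ℕ.+ j) ℕ.+_)
              (colsum-++ τ (concat τs))) (shuffle l i j (colsum τ) (colsum (concat τs))))) (^-+ t
              (l ℕ.* i ℕ.+ colsum τ) _)) (^-+ q c (crosses τs))) ⟩
        ⟦ isColoredHook τ ⟧ * ⟦ allᵇ isColoredHook τs ⟧ * (t ^ (l ℕ.* i ℕ.+ colsum τ) * t ^ (l ℕ.* j ℕ.+ colsum
            (concat τs)) * (q ^ c * q ^ crosses τs)) ≡⟨ eq _ _ _ _ _ _ ⟩
        q ^ c * (⟦ isColoredHook τ ⟧ * t ^ (l ℕ.* i ℕ.+ colsum τ) * (⟦ allᵇ isColoredHook τs ⟧ * (t ^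
            (l ℕ.* j ℕ.+ colsum (concat τs)) * q ^ crosses τs)))
          ≡⟨ cong (λ z → q ^ c * (hookWeight τ * z)) (hooksWeight-stats τs) ⟩
        hooksWeight (τ ∷ τs) ∎
        where
        i = invN (values τ)
        j = lecOf τs
        c = cross (values τ) (values (concat τs))
        shuffle : ∀ l i j a b → l ℕ.* (i ℕ.+ j) ℕ.+ (a ℕ.+ b) ≡ (l ℕ.* i ℕ.+ a) ℕ.+ (l ℕ.* j ℕ.+ b)
        shuffle = solveℕ-∀
        opaque
          unfolding _+_
          eq : ∀ a b x y z w → a * b * (x * y * (z * w)) ≡ z * (a * x * (b * (y * w)))
          eq = solve-∀

    ∑-second : ∑ second (eval t r q) ≡ secondSum R
    ∑-second = trans (∑-concatMap (λ π → map exponents₂ (chfs π)) (perms l R) (eval t r q)) (∑-cong (perms l R) (λ π →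
      trans (∑-map exponents₂ (chfs π) (eval t r q)) (trans (∑-chfs π (eval t r q ∘ exponents₂)) (∑-cong (cuts π) (λ
          (p , w) → pieces p w)))))
      where
      opaque
        unfolding _+_
        eq : ∀ I a t r c x → I * a * (t * (r * (c * x))) ≡ c * (I * r) * (a * (t * x))
        eq = solve-∀
      pieces : ∀ p w → ∑ (blocks w) (λ τs → ⟦ isCHF (p , τs) ⟧ * eval t r q (exponents₂ (p , τs))) ≡ q ^ cross
          (values p) (values w) * (⟦ increasing? p ⟧ * r ^ length p * hookSum w)
      pieces p w = trans (∑-cong-All (blocks-concat w) (λ {τs} e → piece τs e)) (trans (∑-*ˡ _ (blocks w) hooksWeight)
          (*-assoc _ _ _))
        where
        piece : ∀ τs → concat τs ≡ w → ⟦ isCHF (p , τs) ⟧ * eval t r q (exponents₂ (p , τs)) ≡ q ^ cross (values p)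
            (values w) * (⟦ increasing? p ⟧ * r ^ length p) * hooksWeight τs
        piece τs refl = begin
          ⟦ increasing? p ∧ allᵇ isColoredHook τs ⟧ * (t ^ (l ℕ.* lecOf τs ℕ.+ colsum (p ++ concat τs)) *
              (r ^ length p * q ^ (c ℕ.+ crosses τs)))
            ≡⟨ cong₂ _*_ (⟦∧⟧ (increasing? p) _) refl ⟩
          ⟦ increasing? p ⟧ * ⟦ allᵇ isColoredHook τs ⟧ * (t ^ (l ℕ.* lecOf τs ℕ.+ colsum (p ++ concat τs)) *
              (r ^ length p * q ^ (c ℕ.+ crosses τs)))
            ≡⟨ trans (*-assoc _ _ _) (trans (guard (increasing? p) (λ h → cong (λ m → ⟦ allᵇ isColoredHook τs ⟧ * (t ^
                (l ℕ.* lecOf τs ℕ.+ m) * (r ^ length p * q ^ (c ℕ.+ crosses τs))))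
                 (trans (colsum-++ p (concat τs)) (cong (ℕ._+ colsum (concat τs)) (colsum-color0 p (proj₁
                     (∧-true _ h))))))) (sym (*-assoc _ _ _))) ⟩
          ⟦ increasing? p ⟧ * ⟦ allᵇ isColoredHook τs ⟧ * (t ^ (l ℕ.* lecOf τs ℕ.+ colsum (concat τs)) * (r ^ length p
              * q ^ (c ℕ.+ crosses τs)))
            ≡⟨ cong (λ z → ⟦ increasing? p ⟧ * ⟦ allᵇ isColoredHook τs ⟧ * (t ^ (l ℕ.* lecOf τs ℕ.+ colsum
                (concat τs)) * (r ^ length p * z))) (^-+ q c (crosses τs)) ⟩
          ⟦ increasing? p ⟧ * ⟦ allᵇ isColoredHook τs ⟧ * (t ^ (l ℕ.* lecOf τs ℕ.+ colsum (concat τs)) * (r ^ length p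
              * (q ^ c * q ^ crosses τs))) ≡⟨ eq _ _ _ _ _ _ ⟩
          q ^ c * (⟦ increasing? p ⟧ * r ^ length p) * (⟦ allᵇ isColoredHook τs ⟧ * (t ^ (l ℕ.* lecOf τs ℕ.+ colsum
              (concat τs)) * q ^ crosses τs))
            ≡⟨ cong (q ^ c * (⟦ increasing? p ⟧ * r ^ length p) *_) (hooksWeight-stats τs) ⟩
          q ^ c * (⟦ increasing? p ⟧ * r ^ length p) * hooksWeight τs ∎
          where c = cross (values p) (values (concat τs))

  first≡second : ∀ t r q → ∑ first (eval (ℤ.+ (2 ℕ.+ t)) r (ℤ.+ (2 ℕ.+ q))) ≡ ∑ second (eval (ℤ.+ (2 ℕ.+ t)) r (ℤ.+
      (2 ℕ.+ q)))
  first≡second t r q = trans (∑-first t′ r q′ ne) (trans (≈-all⇒≡ q (λ M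
      → Compare.firstSum≈secondSum k t′ r q′ ne M n)) (sym (∑-second t′ r q′ ne)))
    where
    t′ q′ : ℤ
    t′ = ℤ.+ (2 ℕ.+ t)
    q′ = ℤ.+ (2 ℕ.+ q)
    opaque
      unfolding _+_
      ne : 1ℤ - ℤ.+ (2 ℕ.+ t) ≢ 0ℤ
      ne ()

  opaque
    unfolding _+_
    pos-- : ∀ m n → ℤ.+ (m ℕ.+ n) ℤ.- ℤ.+ n ≡ ℤ.+ m
    pos-- m n = trans (cong (ℤ._- ℤ.+ n) (ℤ.pos-+ m n)) (eq (ℤ.+ m) (ℤ.+ n))
      where
      eq : ∀ a b → a ℤ.+ b ℤ.- b ≡ a
      eq = solve-∀

  stat₁-exponents : ∀ π → AllPairs _≢_ (values π) → All (λ x → col x < l) π → All (_≤ length π) (values π) → stat₁ l π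
      ≡ toTriple (exponents₁ π)
  stat₁-exponents π dis cs vs = cong₂ _,_ (sym (colsum-keys 0 π)) (cong₂ _,_ (sym (fix-keys 0 π)) (trans (cong (λ m
      → ℤ.+ m ℤ.- ℤ.+ exc π) (maj-keys π dis cs vs)) (pos-- _ (exc π))))

  stat₂-exponents : ∀ π p τs → p ++ concat τs ≡ π → isCHF (p , τs) ≡ true → stat₂Of l π (p , τs) ≡ toTriple
      (exponents₂ (p , τs))
  stat₂-exponents _ p τs refl h = cong (λ z → (l ℕ.* lecOf τs ℕ.+ colsum (p ++ concat τs) , length p , z)) (trans
      (cong (λ m → ℤ.+ m ℤ.- ℤ.+ lecOf τs) inversions) (pos-- _ (lecOf τs)))
    where
    shuffle : ∀ c j x → c ℕ.+ (j ℕ.+ x) ≡ (c ℕ.+ x) ℕ.+ j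
    shuffle = solveℕ-∀
    inversions : inv (p ++ concat τs) ≡ cross (values p) (values (concat τs)) ℕ.+ crosses τs ℕ.+ lecOf τs
    inversions rewrite List.map-++ proj₁ p (concat τs) | invN-++ (values p) (values (concat τs)) | invN-concat τs
      | invN-incr (values p) (proj₂ (∧-true (allᵇ color0 p) (proj₁ (∧-true (increasing? p) h)))) = shuffle (cross
          (values p) (values (concat τs))) (lecOf τs) (crosses τs)

  private
    facts : All (λ π → AllPairs _≢_ (values π) × All (λ x → col x < l) π × All (_≤ length π) (values π)) (perms l R)
    facts = All.map (λ {π} (a , b , c , e) → a , b , subst (λ m → All (_≤ m) (values π)) (sym (trans e
        (length-up 0 n))) c)
      (All.zip (perms-distinct l sortedR , All.zip (perms-colors l R , All.zip (perms-All l
          (up-≤ 0 n) , perms-length l R))))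

    ∑-filter : ∀ {P : A → Set} (P? : ∀ x → Dec (P x)) xs → ∑ xs (λ x → ⟦ does (P? x) ⟧) ≡ ℤ.+ length (filter P? xs)
    ∑-filter P? [] = refl
    ∑-filter P? (x ∷ xs) with does (P? x)
    ... | true = trans (cong (1ℤ +_) (∑-filter P? xs)) (suc-+ _)
      where opaque
        unfolding _+_
        suc-+ : ∀ m → 1ℤ + ℤ.+ m ≡ ℤ.+ suc m
        suc-+ m = refl
    ... | false = trans (+-identityˡ _) (∑-filter P? xs)

  coeffLHS-first : ∀ s → ℤ.+ coeffLHS l n s ≡ ∑ first (λ x → ⟦ does (toTriple x ≟T s) ⟧)
  coeffLHS-first s = begin
    ℤ.+ coeffLHS l n s ≡⟨ ∑-filter (λ π → stat₁ l π ≟T s) (ColoredPerms l n) ⟨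
    ∑ (ColoredPerms l n) (λ π → ⟦ does (stat₁ l π ≟T s) ⟧) ≡⟨ ∑-perms-ColoredPerms _ ⟩
    ∑ (perms l R) (λ π → ⟦ does (stat₁ l π ≟T s) ⟧)
        ≡⟨ ∑-cong-All facts (λ {π} (a , b , c) → cong (λ z → ⟦ does (z ≟T s) ⟧) (stat₁-exponents π a b c)) ⟩
    ∑ (perms l R) (λ π → ⟦ does (toTriple (exponents₁ π) ≟T s) ⟧) ≡⟨ ∑-map exponents₁ (perms l R) _ ⟨
    ∑ first (λ x → ⟦ does (toTriple x ≟T s) ⟧) ∎

  coeffRHS-second : ∀ s → ℤ.+ coeffRHS l n s ≡ ∑ second (λ x → ⟦ does (toTriple x ≟T s) ⟧)
  coeffRHS-second s = begin
    ℤ.+ coeffRHS l n s ≡⟨ ∑-filter (λ π → s ∈? stats₂ l π) (ColoredPerms l n) ⟨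
    ∑ (ColoredPerms l n) (λ π → ⟦ does (s ∈? stats₂ l π) ⟧) ≡⟨ ∑-perms-ColoredPerms _ ⟩
    ∑ (perms l R) (λ π → ⟦ does (s ∈? stats₂ l π) ⟧) ≡⟨ ∑-cong-All facts (λ {π} (a , _) → member π a) ⟩
    ∑ (perms l R) (λ π → ∑ (map exponents₂ (chfs π)) (λ x → ⟦ does (toTriple x ≟T s) ⟧))
        ≡⟨ ∑-concatMap (λ π → map exponents₂ (chfs π)) (perms l R) _ ⟨
    ∑ second (λ x → ⟦ does (toTriple x ≟T s) ⟧) ∎
    where
    singleton : ∀ x → ⟦ does (s ∈? (x ∷ [])) ⟧ ≡ ⟦ does (x ≟T s) ⟧ + 0ℤ
    singleton x = trans (cong ⟦_⟧ (does-⇔ (mk⇔ (λ { (here e) → sym e ; (there ()) }) (λ e → here (sym e))) (s ∈?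
        (x ∷ [])) (x ≟T s))) (sym (+-identityʳ _))
    toSum : ∀ π c → chfs π ≡ c ∷ [] → ⟦ does (s ∈? stats₂ l π) ⟧ ≡ ∑ (chfs π) (λ c → ⟦ does (stat₂Of l π c ≟T s) ⟧)
    toSum π c e rewrite e = singleton (stat₂Of l π c)
    member : ∀ π → AllPairs _≢_ (values π) → ⟦ does (s ∈? stats₂ l π) ⟧ ≡ ∑ (map exponents₂ (chfs π)) (λ x → ⟦ does
        (toTriple x ≟T s) ⟧)
    member π dis = begin
      ⟦ does (s ∈? stats₂ l π) ⟧ ≡⟨ (let c , e = chfs-unique π (AllPairs-map⁻ dis) in toSum π c e) ⟩
      ∑ (chfs π) (λ c → ⟦ does (stat₂Of l π c ≟T s) ⟧) ≡⟨ ∑-chfs π _ ⟩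
      ∑ (cuts π) (λ (p , w) → ∑ (blocks w) (λ τs → ⟦ isCHF (p , τs) ⟧ * ⟦ does (stat₂Of l π (p , τs) ≟T s) ⟧))
        ≡⟨ ∑-cong-All (cuts-++ π) (λ {(p , w)} e → ∑-cong-All (blocks-concat w) (λ {τs} e′ → guard (isCHF (p , τs))
            (λ h → cong (λ z → ⟦ does (z ≟T s) ⟧) (stat₂-exponents π p τs (trans (cong (p ++_) e′) e) h)))) ⟩
      ∑ (cuts π) (λ (p , w) → ∑ (blocks w) (λ τs → ⟦ isCHF (p , τs) ⟧ * ⟦ does (toTriple (exponents₂
          (p , τs)) ≟T s) ⟧)) ≡⟨ ∑-chfs π _ ⟨
      ∑ (chfs π) (λ c → ⟦ does (toTriple (exponents₂ c) ≟T s) ⟧) ≡⟨ ∑-map exponents₂ (chfs π) _ ⟨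
      ∑ (map exponents₂ (chfs π)) (λ x → ⟦ does (toTriple x ≟T s) ⟧) ∎
      where
      AllPairs-map⁻ : ∀ {w} → AllPairs _≢_ (values w) → Distinct w
      AllPairs-map⁻ {[]} [] = []
      AllPairs-map⁻ {x ∷ w} (p ∷ ps) = All.map⁻ p ∷ AllPairs-map⁻ ps

-- Reading off coefficients

occurrences : ℕ → List ℕ → ℕ
occurrences v [] = 0
occurrences v (x ∷ xs) = (if v ≡ᵇ x then 1 else 0) ℕ.+ occurrences v xs

predecessors : List ℕ → List ℕ
predecessors [] = []
predecessors (zero ∷ xs) = predecessors xs
predecessors (suc x ∷ xs) = x ∷ predecessors xs

occurrences-suc : ∀ v xs → occurrences (suc v) xs ≡ occurrences v (predecessors xs)
occurrences-suc v [] = refl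
occurrences-suc v (zero ∷ xs) = occurrences-suc v xs
occurrences-suc v (suc x ∷ xs) = cong ((if v ≡ᵇ x then 1 else 0) ℕ.+_) (occurrences-suc v xs)

occurrences-≤ : ∀ v xs → occurrences v xs ≤ length xs
occurrences-≤ v [] = ℕ.z≤n
occurrences-≤ v (x ∷ xs) with v ≡ᵇ x
... | true = ℕ.s≤s (occurrences-≤ v xs)
... | false = ℕ.m≤n⇒m≤1+n (occurrences-≤ v xs)

predecessors-≤ : ∀ xs → length (predecessors xs) ≤ length xs
predecessors-≤ [] = ℕ.z≤n
predecessors-≤ (zero ∷ xs) = ℕ.m≤n⇒m≤1+n (predecessors-≤ xs)
predecessors-≤ (suc x ∷ xs) = ℕ.s≤s (predecessors-≤ xs)

powerSum : ℕ → List ℕ → ℕ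
powerSum b [] = 0
powerSum b (x ∷ xs) = b ℕ.^ x ℕ.+ powerSum b xs

powerSum-digits : ∀ b xs → powerSum b xs ≡ occurrences 0 xs ℕ.+ powerSum b (predecessors xs) ℕ.* b
powerSum-digits b [] = refl
powerSum-digits b (zero ∷ xs) = cong suc (powerSum-digits b xs)
powerSum-digits b (suc x ∷ xs) rewrite powerSum-digits b xs = shuffle b (b ℕ.^ x) (occurrences 0 xs) (powerSum b
    (predecessors xs))
  where
  shuffle : ∀ b y o s → b ℕ.* y ℕ.+ (o ℕ.+ s ℕ.* b) ≡ o ℕ.+ (y ℕ.+ s) ℕ.* b
  shuffle = solveℕ-∀

-- the numbers of occurrences are the digits of powerSum b xs in base b
powerSum-injective : ∀ b xs ys → length xs ≤ b → length ys ≤ b → powerSum (suc b) xs ≡ powerSum (suc b) ys → ∀ v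
    → occurrences v xs ≡ occurrences v ys
powerSum-injective b xs ys p p′ e v = digit v
  where
  expansion : occurrences 0 xs ℕ.+ powerSum (suc b) (predecessors xs) ℕ.* suc b ≡ occurrences 0 ys ℕ.+ powerSum
      (suc b) (predecessors ys) ℕ.* suc b
  expansion = trans (sym (powerSum-digits (suc b) xs)) (trans e (powerSum-digits (suc b) ys))
  mod : ∀ zs → length zs ≤ b → (occurrences 0 zs ℕ.+ powerSum (suc b) (predecessors zs) ℕ.* suc b) ℕ.% suc b
      ≡ occurrences 0 zs
  mod zs q = trans (ℕ.[m+kn]%n≡m%n (occurrences 0 zs) (powerSum (suc b) (predecessors zs)) (suc b)) (ℕ.m<n⇒m%n≡m
      (ℕ.s≤s (ℕ.≤-trans (occurrences-≤ 0 zs) q)))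
  zeros : occurrences 0 xs ≡ occurrences 0 ys
  zeros = trans (sym (mod xs p)) (trans (cong (ℕ._% suc b) expansion) (mod ys p′))
  rest : powerSum (suc b) (predecessors xs) ≡ powerSum (suc b) (predecessors ys)
  rest = ℕ.*-cancelʳ-≡ _ _ (suc b) (ℕ.+-cancelˡ-≡ (occurrences 0 ys) _ _ (trans (cong (ℕ._+ powerSum (suc b)
      (predecessors xs) ℕ.* suc b) (sym zeros)) expansion))
  digit : ∀ v → occurrences v xs ≡ occurrences v ys
  digit zero = zeros
  digit (suc v) = trans (occurrences-suc v xs) (trans (powerSum-injective b (predecessors xs) (predecessors ys)
      (ℕ.≤-trans (predecessors-≤ xs) p) (ℕ.≤-trans (predecessors-≤ ys) p′) rest v) (sym (occurrences-suc v ys)))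

private
  pos-^ : ∀ b n → (ℤ.+ b) ^ n ≡ ℤ.+ (b ℕ.^ n)
  pos-^ b zero = refl
  pos-^ b (suc n) = trans (cong (ℤ.+ b *_) (pos-^ b n)) (product b (b ℕ.^ n))
    where opaque
      unfolding _+_
      product : ∀ m n → ℤ.+ m * ℤ.+ n ≡ ℤ.+ (m ℕ.* n)
      product m n = sym (ℤ.pos-* m n)

  -- Only the two lower digits of `code` have to stay below the base; the third exponent is the
  -- leading part.
  Bounded : ℕ → Exponents → Set
  Bounded N (a , b , c) = a ≤ N × b ≤ N

  total : List Exponents → ℕ
  total [] = 0
  total ((a , b , c) ∷ xs) = a ℕ.+ b ℕ.+ total xs

  total-bounds : ∀ {N} xs → total xs ≤ N → All (Bounded N) xs
  total-bounds [] p = []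
  total-bounds ((a , b , c) ∷ xs) p =
    (ℕ.≤-trans (ℕ.m≤m+n a b) ab , ℕ.≤-trans (ℕ.m≤n+m b a) ab) ∷ total-bounds xs (ℕ.≤-trans (ℕ.m≤n+m (total xs)
        (a ℕ.+ b)) p)
    where ab = ℕ.≤-trans (ℕ.m≤m+n (a ℕ.+ b) (total xs)) p

  code : ℕ → Exponents → ℕ
  code N (a , b , c) = a ℕ.+ (b ℕ.+ c ℕ.* suc N) ℕ.* suc N

  digit-injective : ∀ {N a a′} x x′ → a ≤ N → a′ ≤ N → a ℕ.+ x ℕ.* suc N ≡ a′ ℕ.+ x′ ℕ.* suc N → a ≡ a′ × x ≡ x′
  digit-injective {N} {a} {a′} x x′ p p′ e = a≡a′ , ℕ.*-cancelʳ-≡ x x′ (suc N) (ℕ.+-cancelˡ-≡ a′ _ _ (trans (cong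
      (ℕ._+ x ℕ.* suc N) (sym a≡a′)) e))
    where
    a≡a′ : a ≡ a′
    a≡a′ = begin
      a ≡⟨ trans (ℕ.[m+kn]%n≡m%n a x (suc N)) (ℕ.m<n⇒m%n≡m (ℕ.s≤s p)) ⟨
      (a ℕ.+ x ℕ.* suc N) ℕ.% suc N ≡⟨ cong (ℕ._% suc N) e ⟩
      (a′ ℕ.+ x′ ℕ.* suc N) ℕ.% suc N ≡⟨ trans (ℕ.[m+kn]%n≡m%n a′ x′ (suc N)) (ℕ.m<n⇒m%n≡m (ℕ.s≤s p′)) ⟩
      a′ ∎

  code-injective : ∀ {N} x y → Bounded N x → Bounded N y → code N x ≡ code N y → x ≡ y
  code-injective (a , b , c) (a′ , b′ , c′) (p , q) (p′ , q′) e with digit-injective _ _ p p′ e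
  ... | refl , e′ with digit-injective c c′ q q′ e′
  ... | refl , refl = refl

  eval-code : ∀ N B x → eval (ℤ.+ B) ((ℤ.+ B) ^ suc N) ((ℤ.+ B) ^ (suc N ℕ.* suc N)) x ≡ ℤ.+ (B ℕ.^ code N x)
  eval-code N B (a , b , c) = begin
    β ^ a * ((β ^ suc N) ^ b * (β ^ (suc N ℕ.* suc N)) ^ c)
        ≡⟨ cong (β ^ a *_) (cong₂ _*_ (^-* β (suc N) b) (^-* β (suc N ℕ.* suc N) c)) ⟨
    β ^ a * (β ^ (suc N ℕ.* b) * β ^ (suc N ℕ.* suc N ℕ.* c)) ≡⟨ cong (β ^ a *_) (^-+ β (suc N ℕ.* b) _) ⟨
    β ^ a * β ^ (suc N ℕ.* b ℕ.+ suc N ℕ.* suc N ℕ.* c) ≡⟨ ^-+ β a _ ⟨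
    β ^ (a ℕ.+ (suc N ℕ.* b ℕ.+ suc N ℕ.* suc N ℕ.* c)) ≡⟨ cong (β ^_) (shuffle a b c (suc N)) ⟩
    β ^ code N (a , b , c) ≡⟨ pos-^ B (code N (a , b , c)) ⟩
    ℤ.+ (B ℕ.^ code N (a , b , c)) ∎
    where
    β : ℤ
    β = ℤ.+ B
    shuffle : ∀ a b c L → a ℕ.+ (L ℕ.* b ℕ.+ L ℕ.* L ℕ.* c) ≡ a ℕ.+ (b ℕ.+ c ℕ.* L) ℕ.* L
    shuffle = solveℕ-∀

  opaque
    unfolding _+_
    pos-+ : ∀ m n → ℤ.+ m + ℤ.+ n ≡ ℤ.+ (m ℕ.+ n)
    pos-+ m n = refl

  ∑-eval : ∀ N B xs → ∑ xs (eval (ℤ.+ B) ((ℤ.+ B) ^ suc N) ((ℤ.+ B) ^ (suc N ℕ.* suc N))) ≡ ℤ.+ powerSum B (map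
      (code N) xs)
  ∑-eval N B [] = refl
  ∑-eval N B (x ∷ xs) = trans (cong₂ _+_ (eval-code N B x) (∑-eval N B xs)) (pos-+ _ _)

  ∑-occurrences : ∀ {N} s xs → Bounded N s → All (Bounded N) xs → ∑ xs (λ x → ⟦ does (toTriple x ≟T toTriple s) ⟧)
      ≡ ℤ.+ occurrences (code N s) (map (code N) xs)
  ∑-occurrences s [] _ _ = refl
  ∑-occurrences {N} s (x ∷ xs) bs (b ∷ ps) = trans (cong₂ _+_ term (∑-occurrences s xs bs ps)) (pos-+ _ _)
    where
    term : ⟦ does (toTriple x ≟T toTriple s) ⟧ ≡ ℤ.+ (if code N s ≡ᵇ code N x then 1 else 0)
    term with code N s ≡ᵇ code N x in e
    ... | true rewrite code-injective s x bs b (≡ᵇ-true e) = cong ⟦_⟧ (dec-true (toTriple x ≟T toTriple x) refl)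
    ... | false = cong ⟦_⟧ (dec-false (toTriple x ≟T toTriple s) λ { refl → contradiction (trans (sym e) (≡ᵇ-refl
        (code N x))) λ () })

-- Families of exponents with the same generating function at t = B, r = B^L, q = B^(L²) have the same members:
-- for large L the exponent of B determines the triple, and for large B the multiplicities are the digits in base B.
coefficients : ∀ xs ys → (∀ t r q → ∑ xs (eval (ℤ.+ (2 ℕ.+ t)) r (ℤ.+ (2 ℕ.+ q))) ≡ ∑ ys (eval (ℤ.+ (2 ℕ.+ t)) r (ℤ.+
    (2 ℕ.+ q)))) →
  ∀ s → ∑ xs (λ x → ⟦ does (toTriple x ≟T s) ⟧) ≡ ∑ ys (λ x → ⟦ does (toTriple x ≟T s) ⟧)
-- No triple in either family has a negative exponent of q, so both coefficients are 0.
coefficients xs ys h (a , b , ℤ.-[1+ c ]) = trans (none xs) (sym (none ys))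
  where
  none : ∀ xs → ∑ xs (λ x → ⟦ does (toTriple x ≟T (a , b , ℤ.-[1+ c ])) ⟧) ≡ 0ℤ
  none xs = trans (∑-cong xs (λ x → cong ⟦_⟧ (dec-false (toTriple x ≟T (a , b , ℤ.-[1+ c ])) λ ()))) (∑-zero xs)
coefficients xs ys h (a , b , ℤ.+ c) = begin
  ∑ xs (λ x → ⟦ does (toTriple x ≟T toTriple s) ⟧)
      ≡⟨ ∑-occurrences s xs (bound-a , bound-b) (total-bounds xs bound-xs) ⟩
  ℤ.+ occurrences (code N s) (map (code N) xs)
    ≡⟨ cong (ℤ.+_) (powerSum-injective (suc m) (map (code N) xs) (map (code N) ys) (size xs (ℕ.m≤m+n _ _)) (size ys
        (ℕ.m≤n+m _ (length xs))) sums (code N s)) ⟩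
  ℤ.+ occurrences (code N s) (map (code N) ys) ≡⟨ ∑-occurrences s ys (bound-a , bound-b) (total-bounds ys bound-ys) ⟨
  ∑ ys (λ x → ⟦ does (toTriple x ≟T toTriple s) ⟧) ∎
  where
  s : Exponents
  s = (a , b , c)
  N m base : ℕ
  -- N bounds the first two exponents of `s` and of all members of both families, so `code` is
  -- injective on them. The base is at least 2, as required by `h`, and exceeds both numbers of
  -- members, so no carries occur.
  N = a ℕ.+ b ℕ.+ (total xs ℕ.+ total ys)
  m = length xs ℕ.+ length ys
  base = 2 ℕ.+ m
  bound-a : a ≤ N
  bound-a = ℕ.≤-trans (ℕ.m≤m+n a b) (ℕ.m≤m+n (a ℕ.+ b) _)
  bound-b : b ≤ N
  bound-b = ℕ.≤-trans (ℕ.m≤n+m b a) (ℕ.m≤m+n (a ℕ.+ b) _)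
  bound-xs : total xs ≤ N
  bound-xs = ℕ.≤-trans (ℕ.m≤m+n _ (total ys)) (ℕ.m≤n+m _ (a ℕ.+ b))
  bound-ys : total ys ≤ N
  bound-ys = ℕ.≤-trans (ℕ.m≤n+m _ (total xs)) (ℕ.m≤n+m _ (a ℕ.+ b))
  size : ∀ zs → length zs ≤ m → length (map (code N) zs) ≤ suc m
  size zs p = ℕ.≤-trans (ℕ.≤-reflexive (List.length-map (code N) zs)) (ℕ.m≤n⇒m≤1+n p)
  q′ : ℕ
  q′ = base ℕ.^ (suc N ℕ.* suc N) ℕ.∸ 2
  q-form : (ℤ.+ base) ^ (suc N ℕ.* suc N) ≡ ℤ.+ (2 ℕ.+ q′)
  q-form = trans (pos-^ base (suc N ℕ.* suc N)) (cong (ℤ.+_) (sym (ℕ.m+[n∸m]≡n (ℕ.≤-trans (ℕ.≤-trans (ℕ.m≤m+n 2 m)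
      (ℕ.≤-reflexive (sym (ℕ.^-identityʳ base)))) (ℕ.^-monoʳ-≤ base {1} {suc N ℕ.* suc N} (ℕ.s≤s ℕ.z≤n))))))
  sums : powerSum base (map (code N) xs) ≡ powerSum base (map (code N) ys)
  sums = ℤ.+-injective (begin
    ℤ.+ powerSum base (map (code N) xs) ≡⟨ ∑-eval N base xs ⟨
    ∑ xs (eval (ℤ.+ base) ((ℤ.+ base) ^ suc N) ((ℤ.+ base) ^ (suc N ℕ.* suc N)))
        ≡⟨ cong (λ q → ∑ xs (eval (ℤ.+ base) ((ℤ.+ base) ^ suc N) q)) q-form ⟩
    ∑ xs (eval (ℤ.+ base) ((ℤ.+ base) ^ suc N) (ℤ.+ (2 ℕ.+ q′))) ≡⟨ h m ((ℤ.+ base) ^ suc N) q′ ⟩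
    ∑ ys (eval (ℤ.+ base) ((ℤ.+ base) ^ suc N) (ℤ.+ (2 ℕ.+ q′)))
        ≡⟨ cong (λ q → ∑ ys (eval (ℤ.+ base) ((ℤ.+ base) ^ suc N) q)) q-form ⟨
    ∑ ys (eval (ℤ.+ base) ((ℤ.+ base) ^ suc N) ((ℤ.+ base) ^ (suc N ℕ.* suc N))) ≡⟨ ∑-eval N base ys ⟩
    ℤ.+ powerSum base (map (code N) ys) ∎)

theorem4p17 : (l n : ℕ) → 1 ≤ l → 1 ≤ n → (s : Triple) → coeffLHS l n s ≡ coeffRHS l n s
theorem4p17 (suc k) n _ _ s = ℤ.+-injective (begin
  ℤ.+ coeffLHS (suc k) n s ≡⟨ coeffLHS-first s ⟩
  ∑ first (λ x → ⟦ does (toTriple x ≟T s) ⟧) ≡⟨ coefficients first second first≡second s ⟩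
  ∑ second (λ x → ⟦ does (toTriple x ≟T s) ⟧) ≡⟨ coeffRHS-second s ⟨
  ℤ.+ coeffRHS (suc k) n s ∎)
  where open Stats k n
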